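{- Let $F$ be a non-Archimedean local field and $E=F\times F\times F$. For integers $a,b\ge0$ and $c\in\mathfrak o$ let $\mathcal O_{a,b,c}$ be the $\mathfrak o$-submodule of $E$ generated by $(1,1,1)$, $(0,\pi^a,0)$, $(0,c,\pi^b)$. Then: (1) Every order of $E$ is of the form $\mathcal O_{a,b,c}$ where $$\begin{cases}c\in(\pi^{\lceil a/2\rceil}) & \text{if }a\le2b;\\ c\in(\pi^{a-b})\ \text{or}\ c\in\pi^b+(\pi^{a-b}) & \text{if }a>2b.\end{cases}$$ Conversely, an $\mathfrak o$-module $\mathcal O_{a,b,c}$ satisfying this condition is an order. (2) An order $\mathcal O_{a',b',c'}$ (satisfying the condition in (1)) contains an order $\mathcal O_{a,b,c}$ if and only if $a'\le a$, $b'\le b$, and $$\begin{cases}c'\in(\pi^{a'-(b-b')}) & \text{if }\mathrm{ord}(c)\ge a';\\ c'-\pi^{ -(b-b')}c\in(\pi^{a'-(b-b')}) & \text{if }\mathrm{ord}(c)<a'.\end{cases}$$ In the second case, $\lceil a'/2\rceil\le\mathrm{ord}(c)-(b-b')=\mathrm{ord}(c')$ if $a'\le2b'$, and $a'>b$ if $a'>2b'$. (3) Two orders $\mathcal O_{a',b',c'}$ and $\mathcal O_{a,b,c}$ are equal if and only if $a=a'$, $b=b'$ and $c-c'\in(\pi^a)$. (4) For an order $\mathcal O_{a,b,c}$, $S(\mathcal O_{a,b,c})=a+b$ and the conductor is $$\mathfrak f(\mathcal O_{a,b,c})=(\pi^{f_1})\times(\pi^{f_2})\times(\pi^{f_3})=(\pi^{\max(b,\,a+b-\mathrm{ord}(c-\pi^b))})\times(\pi^a)\times(\pi^{\max(b,\,a+b-\mathrm{ord}(c))}).$$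 More precisely, $(f_1,f_3)=(\max(a,b),\,b)$ if $\mathrm{ord}(c)\ge a$, and $(f_1,f_3)=(\max(b,\,a+b-\mathrm{ord}(c-\pi^b)),\,a+b-\mathrm{ord}(c))$ if $\mathrm{ord}(c)<a$. (5) An order $\mathcal O_{a,b,c}$ is Gorenstein if and only if $$\begin{cases}a=0\text{ or }b=0 & \text{if }\mathrm{ord}(c)\ge a;\\ \mathrm{ord}(c-\pi^b)=a-b>0 & \text{if }\mathrm{ord}(c)<a\text{ and }c-\pi^b\in(\pi^{b+1});\\ \mathrm{ord}(c)=\tfrac a2\le b,\ \text{or}\ \mathrm{ord}(c)=a-b>b & \text{if }\mathrm{ord}(c)<a\text{ and }c-\pi^b\notin(\pi^{b+1}).\end{cases}$$
   Context: $F$ has any characteristic, ring of integers $\mathfrak o$, uniformizer $\pi$; $\mathrm{ord}$ is the normalized valuation of $F$ with $\mathrm{ord}(0)=\infty$. For $j\in\mathbb Z$, $(\pi^j)=\pi^j\mathfrak o\subset F$ (conditions in (2) are read in $F$). The maximal order of $E$ is $\mathcal O_E=\mathfrak o\times\mathfrak o\times\mathfrak o$. An order of $E$ is a subring $\mathcal O\subset E$ containing $\mathfrak o$ (diagonally), finitely generated as an $\mathfrak o$-module, with $F\mathcal O=E$. $S(\mathcal O)$ is the $\mathfrak o$-length of $\mathcal O_E/\mathcal O$; $\mathfrak f(\mathcal O)=\{a\in\mathcal O_E:a\mathcal O_E\subset\mathcal O\}$. A fractional $\mathcal O$-ideal is a finitely generated $\mathcal O$-submodule $I\subset E$ with $FI=E$;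 it is invertible if $IJ=\mathcal O$ for some fractional ideal $J$. $\mathcal O$ is Gorenstein if every fractional $\mathcal O$-ideal $I$ with $\{y\in E:yI\subset I\}=\mathcal O$ is invertible.
   Formalization: In (5), second case, the condition is taken as "ord(c−π^b)=a−b>0, or b=0": as printed it fails for b=0, e.g. a=1, b=0, c=1, where the order 𝔬×{(y,z): y≡z mod π} is Gorenstein but ord(c−π^b)=∞; for b>0 it is unchanged. -}

module Defs where

open import Algebra.Bundles using (CommutativeMonoid; Ring; CommutativeRing; RawRing)
open import Algebra.Module.Bundles using (LeftModule)
import Algebra.Construct.DirectProduct as RingProduct
import Algebra.Definitions.RawMonoid as RawMonoidDefs
import Algebra.Module.Construct.DirectProduct as ModuleProduct
import Algebra.Module.Construct.TensorUnit as TensorUnit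
import Algebra.Morphism.RingMonomorphism as RingMonomorphism
import Algebra.Properties.AbelianGroup as AbelianGroupProperties
import Algebra.Properties.CommutativeSemigroup as CommutativeSemigroupProperties
import Algebra.Properties.Ring as RingProperties
import Algebra.Properties.Semiring.Exp as Exp
open import Data.Fin.Base using (Fin; inject₁) renaming (suc to fsuc)
open import Data.Integer.Base as ℤ using (ℤ; +_; -[1+_])
import Data.Integer.Properties as ℤ
open import Data.Nat.Base as ℕ using (ℕ; ⌈_/2⌉)
open import Data.Product.Base using (Σ; ∃; ∃₂; _×_; _,_; proj₁; proj₂)
open import Data.Sum.Base using (_⊎_; inj₁; inj₂)
open import Data.Vec.Functional using (Vector; []; _∷_)
open import Function.Bundles using (_⇔_; Equivalence)
open import Level using (Level; _⊔_) renaming (suc to lsuc)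
open import Relation.Binary.Core using (Rel)
open import Relation.Binary.PropositionalEquality as ≡ using (_≡_)
open import Relation.Nullary.Construct.Add.Supremum using (_⁺; ⊤⁺; [_])
import Relation.Binary.Construct.Add.Supremum.NonStrict as NonStrict
import Relation.Binary.Construct.Add.Supremum.Strict as Strict
open import Relation.Nullary.Negation.Core using (¬_; contradiction)
open import Relation.Unary
  using (Pred; U; _∈_; _⊆_; _≐_; _∖_; Satisfiable; _⟨×⟩_)

open NonStrict ℤ._≤_ public using (_≤⁺_; _≤⊤⁺)
open Strict ℤ._<_ public using (_<⁺_)

------------------------------------------------------------------------
-- Extended integers ℤ ∪ {∞}, with ∞ = ⊤⁺

infixl 6 _+⁺_ _-⁺_

_+⁺_ : ℤ ⁺ → ℤ ⁺ → ℤ ⁺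
[ m ] +⁺ [ n ] = [ m ℤ.+ n ]
[ m ] +⁺ ⊤⁺    = ⊤⁺
⊤⁺    +⁺ _     = ⊤⁺

_-⁺_ : ℤ ⁺ → ℤ → ℤ ⁺
m -⁺ n = m +⁺ [ ℤ.- n ]

-- max (m , s - v), where s - ∞ = - ∞.
max[_,_-_] : ℤ → ℤ → ℤ ⁺ → ℤ
max[ m , s - [ n ] ] = m ℤ.⊔ (s ℤ.- n)
max[ m , s - ⊤⁺ ]    = m

v+v≡v⇒v≡∞⊎v≡0 : ∀ v → v +⁺ v ≡ v → v ≡ ⊤⁺ ⊎ v ≡ [ + 0 ]
v+v≡v⇒v≡∞⊎v≡0 ⊤⁺    _  = inj₁ ≡.refl
v+v≡v⇒v≡∞⊎v≡0 [ n ] eq = inj₂ (≡.cong [_] (begin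
  n                       ≡⟨ ℤ.+-identityʳ n ⟨
  n ℤ.+ + 0               ≡⟨ ≡.cong (λ i → n ℤ.+ i) (ℤ.+-inverseʳ n) ⟨
  n ℤ.+ (n ℤ.- n)         ≡⟨ ℤ.+-assoc n n (ℤ.- n) ⟨
  (n ℤ.+ n) ℤ.- n         ≡⟨ ≡.cong (λ i → i ℤ.- n) (just-inj eq) ⟩
  n ℤ.- n                 ≡⟨ ℤ.+-inverseʳ n ⟩
  + 0                     ∎))
  where
  open ≡.≡-Reasoning
  just-inj : ∀ {i j : ℤ} → _≡_ {A = ℤ ⁺} [ i ] [ j ] → i ≡ j
  just-inj ≡.refl = ≡.refl

0≤+⁺ : ∀ {u v} → [ + 0 ] ≤⁺ u → [ + 0 ] ≤⁺ v → [ + 0 ] ≤⁺ u +⁺ v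
0≤+⁺ NonStrict.[ p ] NonStrict.[ q ] = NonStrict.[ ℤ.+-mono-≤ p q ]
0≤+⁺ NonStrict.[ p ] (_ ≤⊤⁺)         = _ ≤⊤⁺
0≤+⁺ (_ ≤⊤⁺)         _               = _ ≤⊤⁺

0≤-half : ∀ v → [ + 0 ] ≤⁺ v +⁺ v → [ + 0 ] ≤⁺ v
0≤-half ⊤⁺           _ = _ ≤⊤⁺
0≤-half [ + n ]      _ = NonStrict.[ ℤ.+≤+ ℕ.z≤n ]
0≤-half [ -[1+ n ] ] NonStrict.[ () ]

≤⁺-trans : ∀ {u v w} → u ≤⁺ v → v ≤⁺ w → u ≤⁺ w
≤⁺-trans = NonStrict.≤⁺-trans ℤ._≤_ ℤ.≤-trans

------------------------------------------------------------------------
-- Quotients and length of modules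

module _ {r ℓr m ℓm} {R : Ring r ℓr} (M : LeftModule R m ℓm) where
  open LeftModule M
  private
    module R = Ring R
    module G = AbelianGroupProperties +ᴹ-abelianGroup
    module S = CommutativeSemigroupProperties
      (CommutativeMonoid.commutativeSemigroup +ᴹ-commutativeMonoid)

  record IsSubmodule {p} (N : Pred Carrierᴹ p) : Set (r ⊔ m ⊔ ℓm ⊔ p) where
    field
      resp : ∀ {x y} → x ≈ᴹ y → x ∈ N → y ∈ N
      0∈   : 0ᴹ ∈ N
      +∈   : ∀ {x y} → x ∈ N → y ∈ N → x +ᴹ y ∈ N
      -∈   : ∀ {x} → x ∈ N → -ᴹ x ∈ N
      *∈   : ∀ a {x} → x ∈ N → a *ₗ x ∈ N

  quotient : ∀ {p} {N : Pred Carrierᴹ p} → IsSubmodule N → LeftModule R m p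
  quotient {p} {N} isSub = record
    { Carrierᴹ = Carrierᴹ
    ; _≈ᴹ_ = _∼_
    ; _+ᴹ_ = _+ᴹ_
    ; _*ₗ_ = _*ₗ_
    ; 0ᴹ = 0ᴹ
    ; -ᴹ_ = -ᴹ_
    ; isLeftModule = record
      { isLeftSemimodule = record
        { +ᴹ-isCommutativeMonoid = record
          { isMonoid = record
            { isSemigroup = record
              { isMagma = record
                { isEquivalence = record
                  { refl = ↑ ≈ᴹ-refl ; sym = ∼-sym ; trans = ∼-trans }
                ; ∙-cong = ∼-+-cong
                }
              ; assoc = λ x y z → ↑ (+ᴹ-assoc x y z)
              }
            ; identity = (λ x → ↑ (+ᴹ-identityˡ x)) , (λ x → ↑ (+ᴹ-identityʳ x))
            }
          ; comm = λ x y → ↑ (+ᴹ-comm x y)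
          }
        ; isPreleftSemimodule = record
          { *ₗ-cong = ∼-*-cong
          ; *ₗ-zeroˡ = λ x → ↑ (*ₗ-zeroˡ x)
          ; *ₗ-distribʳ = λ x a b → ↑ (*ₗ-distribʳ x a b)
          ; *ₗ-identityˡ = λ x → ↑ (*ₗ-identityˡ x)
          ; *ₗ-assoc = λ a b x → ↑ (*ₗ-assoc a b x)
          ; *ₗ-zeroʳ = λ a → ↑ (*ₗ-zeroʳ a)
          ; *ₗ-distribˡ = λ a x y → ↑ (*ₗ-distribˡ a x y)
          }
        }
      ; -ᴹ‿cong = λ {x} {y} x∼y →
          resp (≈ᴹ-sym (G.⁻¹-∙-comm x (-ᴹ y))) (-∈ x∼y)
      ; -ᴹ‿inverse = (λ x → ↑ (-ᴹ‿inverseˡ x)) , (λ x → ↑ (-ᴹ‿inverseʳ x))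
      }
    }
    where
    open IsSubmodule isSub

    _∼_ : Rel Carrierᴹ p
    x ∼ y = x +ᴹ -ᴹ y ∈ N

    ↑ : ∀ {x y} → x ≈ᴹ y → x ∼ y
    ↑ {x} {y} x≈y =
      resp (≈ᴹ-sym (≈ᴹ-trans (+ᴹ-cong x≈y ≈ᴹ-refl) (-ᴹ‿inverseʳ y))) 0∈

    ∼-sym : ∀ {x y} → x ∼ y → y ∼ x
    ∼-sym {x} {y} p = resp (G.⁻¹-anti-homo‿- x y) (-∈ p)

    ∼-trans : ∀ {x y z} → x ∼ y → y ∼ z → x ∼ z
    ∼-trans {x} {y} {z} p q = resp eq (+∈ p q)
      where
      eq : (x +ᴹ -ᴹ y) +ᴹ (y +ᴹ -ᴹ z) ≈ᴹ x +ᴹ -ᴹ z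
      eq = ≈ᴹ-trans (+ᴹ-assoc x (-ᴹ y) _) (+ᴹ-cong ≈ᴹ-refl
             (≈ᴹ-trans (≈ᴹ-sym (+ᴹ-assoc (-ᴹ y) y (-ᴹ z)))
               (≈ᴹ-trans (+ᴹ-cong (-ᴹ‿inverseˡ y) ≈ᴹ-refl) (+ᴹ-identityˡ _))))

    ∼-+-cong : ∀ {x y u v} → x ∼ y → u ∼ v → (x +ᴹ u) ∼ (y +ᴹ v)
    ∼-+-cong {x} {y} {u} {v} p q = resp
      (≈ᴹ-trans (S.interchange x (-ᴹ y) u (-ᴹ v))
        (+ᴹ-cong ≈ᴹ-refl (G.⁻¹-∙-comm y v)))
      (+∈ p q)

    *-neg : ∀ a y → a *ₗ (-ᴹ y) ≈ᴹ -ᴹ (a *ₗ y)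
    *-neg a y = G.inverseʳ-unique (a *ₗ y) (a *ₗ (-ᴹ y))
      (≈ᴹ-trans (≈ᴹ-sym (*ₗ-distribˡ a y (-ᴹ y)))
        (≈ᴹ-trans (*ₗ-cong R.refl (-ᴹ‿inverseʳ y)) (*ₗ-zeroʳ a)))

    ∼-*-cong : ∀ {a b x y} → a R.≈ b → x ∼ y → (a *ₗ x) ∼ (b *ₗ y)
    ∼-*-cong {a} {b} {x} {y} a≈b p = ∼-trans
      (resp (≈ᴹ-trans (*ₗ-distribˡ a x (-ᴹ y)) (+ᴹ-cong ≈ᴹ-refl (*-neg a y)))
        (*∈ a p))
      (↑ (*ₗ-cong a≈b ≈ᴹ-refl))

  StrictChain : ℕ → Set (r ⊔ lsuc (m ⊔ ℓm))
  StrictChain n = ∃ λ (N : Vector (Pred Carrierᴹ (m ⊔ ℓm)) (ℕ.suc n)) →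
    (∀ i → IsSubmodule (N i)) ×
    (∀ (i : Fin n) → N (inject₁ i) ⊆ N (fsuc i)
                   × Satisfiable (N (fsuc i) ∖ N (inject₁ i)))

  -- The length of M is n: the supremum of the lengths of its strict chains of
  -- submodules is n.
  HasLength : ℕ → Set (r ⊔ lsuc (m ⊔ ℓm))
  HasLength n = StrictChain n × (∀ k → StrictChain k → k ℕ.≤ n)

------------------------------------------------------------------------
-- Non-Archimedean local fields: fields complete with respect to a discrete
-- valuation, with finite residue field.

record NonArchimedeanLocalField κ ℓ : Set (lsuc (κ ⊔ ℓ)) where
  field
    commutativeRing : CommutativeRing κ ℓ

  open CommutativeRing commutativeRing public

  field
    1≉0     : 1# ≉ 0#
    inverse : ∀ x → x ≉ 0# → ∃ λ y → x * y ≈ 1#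

    ord            : Carrier → ℤ ⁺
    ord-cong       : ∀ {x y} → x ≈ y → ord x ≡ ord y
    ord≡∞⇔≈0       : ∀ x → (ord x ≡ ⊤⁺) ⇔ (x ≈ 0#)
    ord-*          : ∀ x y → ord (x * y) ≡ ord x +⁺ ord y
    -- ord (x + y) ≥ min (ord x , ord y)
    ord-+          : ∀ x y → (ord x ≤⁺ ord (x + y)) ⊎ (ord y ≤⁺ ord (x + y))
    ord-normalized : ∃ λ x → ord x ≡ [ + 1 ]

  IsCauchy : (ℕ → Carrier) → Set
  IsCauchy u = ∀ (k : ℤ) → ∃ λ N → ∀ m n → N ℕ.≤ m → N ℕ.≤ n →
    [ k ] ≤⁺ ord (u m - u n)

  _ConvergesTo_ : (ℕ → Carrier) → Carrier → Set
  u ConvergesTo x = ∀ (k : ℤ) → ∃ λ N → ∀ n → N ℕ.≤ n →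
    [ k ] ≤⁺ ord (u n - x)

  field
    complete : ∀ u → IsCauchy u → ∃ λ x → u ConvergesTo x
    -- The residue field is finite: finitely many residue classes exhaust it.
    finite-residue-field : ∃₂ λ q (ρ : Vector Carrier q) →
      (∀ i → [ + 0 ] ≤⁺ ord (ρ i)) ×
      (∀ x → [ + 0 ] ≤⁺ ord x → ∃ λ i → [ + 1 ] ≤⁺ ord (x - ρ i))

------------------------------------------------------------------------
-- The algebra E = F × F × F, its orders and their fractional ideals

module CubicAlgebra {κ ℓ} (F : NonArchimedeanLocalField κ ℓ) where
  open NonArchimedeanLocalField F

  𝔬 : Pred Carrier _
  𝔬 x = [ + 0 ] ≤⁺ ord x

  0∈𝔬 : 0# ∈ 𝔬
  0∈𝔬 = ≡.subst ([ + 0 ] ≤⁺_)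
    (≡.sym (Equivalence.from (ord≡∞⇔≈0 0#) refl)) (_ ≤⊤⁺)

  1∈𝔬 : 1# ∈ 𝔬
  1∈𝔬 with v+v≡v⇒v≡∞⊎v≡0 (ord 1#)
             (≡.trans (≡.sym (ord-* 1# 1#)) (ord-cong (*-identityˡ 1#)))
  ... | inj₁ ≡∞ = contradiction (Equivalence.to (ord≡∞⇔≈0 1#) ≡∞) 1≉0
  ... | inj₂ ≡0 = ≡.subst ([ + 0 ] ≤⁺_) (≡.sym ≡0) NonStrict.[ ℤ.≤-refl ]

  +∈𝔬 : ∀ {x y} → x ∈ 𝔬 → y ∈ 𝔬 → x + y ∈ 𝔬
  +∈𝔬 {x} {y} x∈𝔬 y∈𝔬 with ord-+ x y
  ... | inj₁ p = ≤⁺-trans x∈𝔬 p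
  ... | inj₂ p = ≤⁺-trans y∈𝔬 p

  *∈𝔬 : ∀ {x y} → x ∈ 𝔬 → y ∈ 𝔬 → x * y ∈ 𝔬
  *∈𝔬 {x} {y} x∈𝔬 y∈𝔬 =
    ≡.subst ([ + 0 ] ≤⁺_) (≡.sym (ord-* x y)) (0≤+⁺ x∈𝔬 y∈𝔬)

  -∈𝔬 : ∀ {x} → x ∈ 𝔬 → - x ∈ 𝔬
  -∈𝔬 {x} x∈𝔬 = 0≤-half (ord (- x)) (≡.subst ([ + 0 ] ≤⁺_)
    (≡.trans (ord-cong x*x≈) (ord-* (- x) (- x))) (*∈𝔬 x∈𝔬 x∈𝔬))
    where
    open RingProperties ring using (-‿distribˡ-*; -‿distribʳ-*; -‿involutive)
    x*x≈ : x * x ≈ - x * - x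
    x*x≈ = trans (sym (-‿involutive (x * x)))
      (trans (-‿cong (-‿distribʳ-* x x)) (-‿distribˡ-* x (- x)))

  𝔬-rawRing : RawRing κ ℓ
  𝔬-rawRing = record
    { Carrier = Σ Carrier 𝔬
    ; _≈_ = λ x y → proj₁ x ≈ proj₁ y
    ; _+_ = λ x y → proj₁ x + proj₁ y , +∈𝔬 (proj₂ x) (proj₂ y)
    ; _*_ = λ x y → proj₁ x * proj₁ y , *∈𝔬 (proj₂ x) (proj₂ y)
    ; -_  = λ x → - proj₁ x , -∈𝔬 (proj₂ x)
    ; 0#  = 0# , 0∈𝔬
    ; 1#  = 1# , 1∈𝔬
    }

  𝔬-commutativeRing : CommutativeRing κ ℓ
  𝔬-commutativeRing = record
    { RawRing 𝔬-rawRing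
    ; isCommutativeRing = RingMonomorphism.isCommutativeRing
        {R₁ = 𝔬-rawRing} {R₂ = rawRing} {⟦_⟧ = proj₁}
        record
          { isRingHomomorphism = record
            { isSemiringHomomorphism = record
              { isNearSemiringHomomorphism = record
                { +-isMonoidHomomorphism = record
                  { isMagmaHomomorphism = record
                    { isRelHomomorphism = record { cong = λ x≈y → x≈y }
                    ; homo = λ _ _ → refl
                    }
                  ; ε-homo = refl
                  }
                ; *-homo = λ _ _ → refl
                }
              ; 1#-homo = refl
              }
            ; -‿homo = λ _ → refl
            }
          ; injective = λ x≈y → x≈y
          }
        isCommutativeRing
    }

  E-commutativeRing : CommutativeRing κ ℓ
  E-commutativeRing =
    RingProduct.commutativeRing commutativeRing
      (RingProduct.commutativeRing commutativeRing commutativeRing)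

  module E = CommutativeRing E-commutativeRing
  open RawMonoidDefs E.+-rawMonoid using (sum)

  Subset : Set (lsuc (κ ⊔ ℓ))
  Subset = Pred E.Carrier (κ ⊔ ℓ)

  𝓞ᴱ : Pred E.Carrier _
  𝓞ᴱ = 𝔬 ⟨×⟩ 𝔬 ⟨×⟩ 𝔬

  Δ : Carrier → E.Carrier
  Δ x = x , x , x

  Δ[_] : ∀ {p} → Pred Carrier p → Pred E.Carrier (κ ⊔ ℓ ⊔ p)
  Δ[ S ] e = ∃ λ x → x ∈ S × e E.≈ Δ x

  -- The set of R-linear combinations of g (an R-module when R is a subring).
  Span : Subset → ∀ {n} → Vector E.Carrier n → Subset
  Span R {n} g e = ∃ λ (r : Vector E.Carrier n) →
    (∀ i → r i ∈ R) × e E.≈ sum (λ i → r i E.* g i)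

  -- The additive subgroup (for I, J closed under negation) generated by the
  -- products of elements of I and J.
  infixl 7 _·_
  _·_ : Subset → Subset → Subset
  (I · J) e = ∃ λ n → ∃₂ λ (u v : Vector E.Carrier n) →
    (∀ i → u i ∈ I) × (∀ i → v i ∈ J) × e E.≈ sum (λ i → u i E.* v i)

  SpansE : Subset → Set (κ ⊔ ℓ)
  SpansE I = ∀ e → e ∈ Δ[ U ] · I

  record IsOrder (O : Subset) : Set (κ ⊔ ℓ) where
    field
      resp   : ∀ {x y} → x E.≈ y → x ∈ O → y ∈ O
      0∈     : E.0# ∈ O
      1∈     : E.1# ∈ O
      +∈     : ∀ {x y} → x ∈ O → y ∈ O → x E.+ y ∈ O
      -∈     : ∀ {x} → x ∈ O → E.- x ∈ O
      *∈     : ∀ {x y} → x ∈ O → y ∈ O → x E.* y ∈ O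
      Δ𝔬⊆    : ∀ {x} → x ∈ 𝔬 → Δ x ∈ O
      finite : ∃₂ λ n (g : Vector E.Carrier n) → O ≐ Span Δ[ 𝔬 ] g
      spans  : SpansE O

  conductor : Subset → Subset
  conductor O a = a ∈ 𝓞ᴱ × (∀ x → x ∈ 𝓞ᴱ → a E.* x ∈ O)

  IsFractionalIdeal : Subset → Subset → Set (κ ⊔ ℓ)
  IsFractionalIdeal O I =
    (∃₂ λ n (g : Vector E.Carrier n) → I ≐ Span O g) × SpansE I

  IsInvertible : Subset → Subset → Set (lsuc (κ ⊔ ℓ))
  IsInvertible O I = ∃ λ J → IsFractionalIdeal O J × (I · J ≐ O)

  multiplierRing : Subset → Subset
  multiplierRing I y = ∀ x → x ∈ I → y E.* x ∈ I

  IsGorenstein : Subset → Set (lsuc (κ ⊔ ℓ))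
  IsGorenstein O = ∀ I → IsFractionalIdeal O I → multiplierRing I ≐ O →
    IsInvertible O I

  𝓞ᴱ-module : LeftModule (CommutativeRing.ring 𝔬-commutativeRing) κ ℓ
  𝓞ᴱ-module = ModuleProduct.leftModule 𝔬-module
    (ModuleProduct.leftModule 𝔬-module 𝔬-module)
    where
    𝔬-module : LeftModule (CommutativeRing.ring 𝔬-commutativeRing) κ ℓ
    𝔬-module = TensorUnit.leftModule

  𝓞ᴱ/ : ∀ {O} → IsOrder O →
        LeftModule (CommutativeRing.ring 𝔬-commutativeRing) κ (κ ⊔ ℓ)
  𝓞ᴱ/ {O} isOrder = quotient 𝓞ᴱ-module {N = O′} record
    { resp = resp
    ; 0∈   = 0∈
    ; +∈   = +∈
    ; -∈   = -∈
    ; *∈   = λ r x∈O → *∈ (Δ𝔬⊆ (proj₂ r)) x∈O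
    }
    where
    open IsOrder isOrder
    O′ : Pred (LeftModule.Carrierᴹ 𝓞ᴱ-module) (κ ⊔ ℓ)
    O′ ((x , _) , (y , _) , (z , _)) = (x , y , z) ∈ O

  -- S(O) = n
  S[_]≡_ : ∀ {O} → IsOrder O → ℕ → Set (lsuc (κ ⊔ ℓ))
  S[ isOrder ]≡ n = HasLength (𝓞ᴱ/ isOrder) n

  module Uniformizer (π : Carrier) (ord-π : ord π ≡ [ + 1 ]) where
    open Exp semiring using (_^_)

    π≉0 : π ≉ 0#
    π≉0 π≈0 with ≡.trans (≡.sym ord-π) (Equivalence.from (ord≡∞⇔≈0 π) π≈0)
    ... | ()

    π^_ : ℤ → Carrier
    π^ (+ n)    = π ^ n
    π^ -[1+ n ] = proj₁ (inverse π π≉0) ^ ℕ.suc n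

    ⟨π^_⟩ : ℤ → Pred Carrier (κ ⊔ ℓ)
    ⟨π^ j ⟩ x = ∃ λ y → y ∈ 𝔬 × x ≈ (π^ j) * y

    𝓞 : ℕ → ℕ → Carrier → Subset
    𝓞 a b c = Span Δ[ 𝔬 ]
      ((1# , 1# , 1#) ∷ (0# , π^ (+ a) , 0#) ∷ (0# , c , π^ (+ b)) ∷ [])

    OrderCondition : ℕ → ℕ → Carrier → Set (κ ⊔ ℓ)
    OrderCondition a b c =
      (a ℕ.≤ 2 ℕ.* b → c ∈ ⟨π^ + ⌈ a /2⌉ ⟩) ×
      (a ℕ.> 2 ℕ.* b →
        c ∈ ⟨π^ + a ℤ.- + b ⟩ ⊎ c - π^ (+ b) ∈ ⟨π^ + a ℤ.- + b ⟩)

    ContainmentCondition : (a′ b′ : ℕ) (c′ : Carrier)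
                           (a b : ℕ) (c : Carrier) → Set (κ ⊔ ℓ)
    ContainmentCondition a′ b′ c′ a b c =
      a′ ℕ.≤ a × b′ ℕ.≤ b ×
      ([ + a′ ] ≤⁺ ord c → c′ ∈ ⟨π^ + a′ ℤ.- δ ⟩) ×
      (ord c <⁺ [ + a′ ] → c′ - (π^ (ℤ.- δ)) * c ∈ ⟨π^ + a′ ℤ.- δ ⟩)
      where
      δ : ℤ
      δ = + b ℤ.- + b′

    -- The alternative b ≡ 0 in the second case corrects the condition
    -- ord (c - π^b) = a - b > 0.  Since 𝓞 a b c depends on c only
    -- modulo π^a, for b = 0 that condition is not well defined: 𝓞 1 0 1 =
    -- 𝓞 1 0 (1 + π) = 𝔬 × {(y , z) : y ≡ z mod π} is Gorenstein, while
    -- ord (1 - π^0) = ∞ and ord (1 + π - π^0) = 1 = a - b.  For b > 0 the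
    -- alternative is void.
    GorensteinCondition : ℕ → ℕ → Carrier → Set (κ ⊔ ℓ)
    GorensteinCondition a b c =
      ([ + a ] ≤⁺ ord c → a ≡ 0 ⊎ b ≡ 0) ×
      (ord c <⁺ [ + a ] → c - π^ (+ b) ∈ ⟨π^ + ℕ.suc b ⟩ →
        (ord (c - π^ (+ b)) ≡ [ + a ℤ.- + b ] × + a ℤ.- + b ℤ.> + 0) ⊎ b ≡ 0) ×
      (ord c <⁺ [ + a ] → ¬ (c - π^ (+ b) ∈ ⟨π^ + ℕ.suc b ⟩) →
        (ord c +⁺ ord c ≡ [ + a ] × a ℕ.≤ 2 ℕ.* b) ⊎
        (ord c ≡ [ + a ℤ.- + b ] × + a ℤ.- + b ℤ.> + b))

{-# OPTIONS --safe #-}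

-- An 𝔬-lattice in E is handled through a pair of bases dual under the trace
-- form, which makes membership in it decidable; a vector outside the lattice can
-- be exchanged for a basis vector, and this lowers the valuation of the
-- determinant.  This bounds the length of 𝓞ᴱ/O and turns finitely generated
-- modules of full rank into lattices.
--
-- The module 𝓞 a b c is a ring if and only if c (c - π^b) ∈ (π^a).  If
-- ord (c (c - π^b)) = a, or a = 0 or b = 0, then 𝓞 a b c is its own dual under a
-- form tr (w · ·) with w ∈ E^×, so the dual of an ideal I with multiplier ring
-- 𝓞 a b c is an inverse of I.  Otherwise 𝓞 a b c / π is k[s , t] / (s , t)²
-- over the residue field k, and the trace dual of 𝓞 a b c is not invertible.
module Submission where

open import Defs
open import Algebra.Bundles using (CommutativeRing)
open import Algebra.Module.Bundles using (LeftModule)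
import Algebra.Properties.AbelianGroup as AbelianGroupProperties
import Algebra.Properties.CommutativeSemiring.Exp as Exp
import Algebra.Properties.Ring as RingProperties
import Algebra.Properties.Semiring.Mult.TCOptimised as Mult
import Algebra.Properties.Semiring.Sum as Sum
import Algebra.Solver.Ring as RingSolver
open import Algebra.Solver.Ring.AlmostCommutativeRing
  using (fromCommutativeRing; _-Raw-AlmostCommutative⟶_)
open import Data.Fin.Base using (Fin; zero; suc; toℕ; inject₁; combine; remQuot)
open import Data.Fin.Patterns using (0F; 1F; 2F)
open import Data.Fin.Properties using (toℕ-inject₁; toℕ<n; remQuot-combine)
open import Data.Integer.Base as ℤ using (ℤ; +_; -[1+_])
import Data.Integer.Properties as ℤ
import Data.Integer.Solver as ℤSolver
import Data.Maybe.Base as Maybe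
open import Data.Nat.Base as ℕ using (ℕ; zero; suc; ⌈_/2⌉)
import Data.Nat.Properties as ℕ
open import Data.Product.Base using (Σ; ∃; ∃₂; _×_; _,_; proj₁; proj₂)
open import Data.Sum.Base using (_⊎_; inj₁; inj₂)
open import Data.Vec.Functional using (Vector; []; _∷_)
open import Function.Base using (_∘_)
open import Function.Bundles using (_⇔_; Equivalence; mk⇔)
open import Level using (_⊔_)
import Relation.Binary.Construct.Add.Supremum.NonStrict as NonStrict
import Relation.Binary.Construct.Add.Supremum.Strict as Strict
open import Relation.Binary.PropositionalEquality as ≡ using (_≡_; _≢_)
open import Relation.Nullary.Construct.Add.Supremum using (⊤⁺; [_]; []-injective)
open import Relation.Nullary.Decidable.Core using (Dec; yes; no; dec⇒maybe)
open import Relation.Nullary.Negation.Core using (¬_; contradiction)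
open import Relation.Unary using (Pred; _∈_; _⊆_; _≐_; _∖_; Satisfiable; _⟨×⟩_)

-- Ideals and submodules are arbitrary predicates and the reasoning is constructive, so only
-- valuations can be decided. No element is ever picked from a module by a maximality argument:
-- lattices are grown inside it from explicit vectors, and every test is the valuation of a pairing.
-- With `s = (0 , π^a , 0)` and `t = (0 , c , π^b)` one has `s² = π^a s`, `s t = c s` and
-- `t² = π^b t + (0 , c (c - π^b) , 0)`; for integral `c` only the last product can leave the
-- module. `OrderCondition` spells out `ord c + ord (c - π^b) ≥ a`, and `GorensteinCondition`, apart
-- from `a = 0` or `b = 0`, the corresponding equality, according to how `ord c` compares with `b`.
-- The three products vanish modulo `π` times the order exactly when `a` and `b` are positive,
-- `c ∈ (π)` and `ord (c (c - π^b)) > a`. For `a = 0` or `b = 0` the order splits off a factor `𝔬`,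
-- and each way of splitting has a form of its own.

private
  module ≤⁺ = NonStrict ℤ._≤_
  module <⁺ = Strict ℤ._<_

-- Integer coefficients let the solver cancel x - x: equality of coefficients
-- in R itself does not compute.
module IntegerSolver {r ℓ} (R : CommutativeRing r ℓ) where
  open CommutativeRing R
  open Mult semiring using (1+×; ×-homo-+; ×1-homo-*) renaming (_×_ to _×ᴿ_)
  open RingProperties ring using (-‿distribˡ-*; -‿distribʳ-*; -‿involutive; -0#≈0#)
  open AbelianGroupProperties +-abelianGroup using (⁻¹-∙-comm)
  open import Relation.Binary.Reasoning.Setoid setoid

  private
    fromℤ : ℤ → Carrier
    fromℤ (+ n)    = n ×ᴿ 1#
    fromℤ -[1+ n ] = - (suc n ×ᴿ 1#)

    fromℤ-⊖ : ∀ m n → fromℤ (m ℤ.⊖ n) ≈ m ×ᴿ 1# - n ×ᴿ 1#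
    fromℤ-⊖ zero    zero    = sym (-‿inverseʳ 0#)
    fromℤ-⊖ zero    (suc n) = sym (+-identityˡ _)
    fromℤ-⊖ (suc m) zero    = sym (trans (+-congˡ -0#≈0#) (+-identityʳ _))
    fromℤ-⊖ (suc m) (suc n) = begin
      fromℤ (suc m ℤ.⊖ suc n)               ≡⟨ ≡.cong fromℤ (ℤ.[1+m]⊖[1+n]≡m⊖n m n) ⟩
      fromℤ (m ℤ.⊖ n)                       ≈⟨ fromℤ-⊖ m n ⟩
      m ×ᴿ 1# - n ×ᴿ 1#                       ≈⟨ +-congʳ (+-identityʳ _) ⟨
      m ×ᴿ 1# + 0# - n ×ᴿ 1#                  ≈⟨ +-congʳ (+-congˡ (-‿inverseʳ 1#)) ⟨
      m ×ᴿ 1# + (1# - 1#) - n ×ᴿ 1#           ≈⟨ +-congʳ (+-assoc _ _ _) ⟨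
      m ×ᴿ 1# + 1# - 1# - n ×ᴿ 1#             ≈⟨ +-assoc _ _ _ ⟩
      m ×ᴿ 1# + 1# + (- 1# - n ×ᴿ 1#)         ≈⟨ +-cong (+-comm _ _) (⁻¹-∙-comm _ _) ⟩
      1# + m ×ᴿ 1# - (1# + n ×ᴿ 1#)           ≈⟨ +-cong (1+× m 1#) (-‿cong (1+× n 1#)) ⟨
      suc m ×ᴿ 1# - suc n ×ᴿ 1#               ∎

    fromℤ-neg : ∀ i → fromℤ (ℤ.- i) ≈ - fromℤ i
    fromℤ-neg (+ zero)  = sym -0#≈0#
    fromℤ-neg (+ suc n) = refl
    fromℤ-neg -[1+ n ]  = sym (-‿involutive _)

    fromℤ-+ : ∀ i j → fromℤ (i ℤ.+ j) ≈ fromℤ i + fromℤ j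
    fromℤ-+ (+ m)    (+ n)    = ×-homo-+ 1# m n
    fromℤ-+ (+ m)    -[1+ n ] = fromℤ-⊖ m (suc n)
    fromℤ-+ -[1+ m ] (+ n)    = trans (fromℤ-⊖ n (suc m)) (+-comm _ _)
    fromℤ-+ -[1+ m ] -[1+ n ] = begin
      - (suc (suc (m ℕ.+ n)) ×ᴿ 1#)      ≡⟨ ≡.cong (λ k → - (suc k ×ᴿ 1#)) (ℕ.+-suc m n) ⟨
      - ((suc m ℕ.+ suc n) ×ᴿ 1#)        ≈⟨ -‿cong (×-homo-+ 1# (suc m) (suc n)) ⟩
      - (suc m ×ᴿ 1# + suc n ×ᴿ 1#)       ≈⟨ ⁻¹-∙-comm _ _ ⟨
      - (suc m ×ᴿ 1#) - suc n ×ᴿ 1#       ∎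

    fromℤ-*⁺ : ∀ m j → fromℤ (+ m ℤ.* j) ≈ fromℤ (+ m) * fromℤ j
    fromℤ-*⁺ m (+ n) = trans (reflexive (≡.cong fromℤ (≡.sym (ℤ.pos-* m n)))) (×1-homo-* m n)
    fromℤ-*⁺ m -[1+ n ] = begin
      fromℤ (+ m ℤ.* -[1+ n ])        ≡⟨ ≡.cong fromℤ (ℤ.neg-distribʳ-* (+ m) (+ suc n)) ⟨
      fromℤ (ℤ.- (+ m ℤ.* + suc n))   ≈⟨ fromℤ-neg (+ m ℤ.* + suc n) ⟩
      - fromℤ (+ m ℤ.* + suc n)       ≡⟨ ≡.cong (λ i → - fromℤ i) (ℤ.pos-* m (suc n)) ⟨
      - ((m ℕ.* suc n) ×ᴿ 1#)          ≈⟨ -‿cong (×1-homo-* m (suc n)) ⟩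
      - (m ×ᴿ 1# * (suc n ×ᴿ 1#))       ≈⟨ -‿distribʳ-* _ _ ⟩
      m ×ᴿ 1# * - (suc n ×ᴿ 1#)         ∎

    fromℤ-* : ∀ i j → fromℤ (i ℤ.* j) ≈ fromℤ i * fromℤ j
    fromℤ-* (+ m)    j = fromℤ-*⁺ m j
    fromℤ-* -[1+ m ] j = begin
      fromℤ (-[1+ m ] ℤ.* j)          ≡⟨ ≡.cong fromℤ (ℤ.neg-distribˡ-* (+ suc m) j) ⟨
      fromℤ (ℤ.- (+ suc m ℤ.* j))     ≈⟨ fromℤ-neg (+ suc m ℤ.* j) ⟩
      - fromℤ (+ suc m ℤ.* j)         ≈⟨ -‿cong (fromℤ-*⁺ (suc m) j) ⟩
      - (suc m ×ᴿ 1# * fromℤ j)        ≈⟨ -‿distribˡ-* _ _ ⟩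
      - (suc m ×ᴿ 1#) * fromℤ j        ∎

    morphism : ℤ.+-*-rawRing -Raw-AlmostCommutative⟶ fromCommutativeRing R
    morphism = record
      { ⟦_⟧    = fromℤ
      ; +-homo = fromℤ-+
      ; *-homo = fromℤ-*
      ; -‿homo = fromℤ-neg
      ; 0-homo = refl
      ; 1-homo = refl
      }

  open RingSolver ℤ.+-*-rawRing (fromCommutativeRing R) morphism
    (λ i j → Maybe.map (λ i≡j → reflexive (≡.cong fromℤ i≡j)) (dec⇒maybe (i ℤ.≟ j)))
    public using (Polynomial; solve; _:=_; _:+_; _:*_; _:-_; :-_; con)

  :0 :1 : ∀ {n} → Polynomial n
  :0 = con (+ 0)
  :1 = con (+ 1)

-- Valuation calculus and powers of the uniformizer.

module Valuation {κ ℓ} (F : NonArchimedeanLocalField κ ℓ) where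
  open NonArchimedeanLocalField F hiding (zero)
  open CubicAlgebra F using (𝔬; 0∈𝔬; 1∈𝔬; +∈𝔬; *∈𝔬; -∈𝔬)
  open IntegerSolver commutativeRing

  V : ℤ → Carrier → Set
  V n x = [ n ] ≤⁺ ord x

  V? : ∀ n x → Dec (V n x)
  V? n x = ≤⁺.≤⁺-dec ℤ._≤?_ [ n ] (ord x)

  private variable
    x y z : Carrier
    m n : ℤ

  V-resp : x ≈ y → V n x → V n y
  V-resp {n = n} x≈y = ≡.subst ([ n ] ≤⁺_) (ord-cong x≈y)

  V-0 : V n 0#
  V-0 {n} = ≡.subst ([ n ] ≤⁺_) (≡.sym (Equivalence.from (ord≡∞⇔≈0 0#) refl)) (_ ≤⊤⁺)

  V-≤ : m ℤ.≤ n → V n x → V m x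
  V-≤ m≤n = ≤⁺-trans ≤⁺.[ m≤n ]

  V-+ : V n x → V n y → V n (x + y)
  V-+ {x = x} {y = y} p q with ord-+ x y
  ... | inj₁ r = ≤⁺-trans p r
  ... | inj₂ r = ≤⁺-trans q r

  +⁺-mono : ∀ {u v} → [ m ] ≤⁺ u → [ n ] ≤⁺ v → [ m ℤ.+ n ] ≤⁺ u +⁺ v
  +⁺-mono ≤⁺.[ p ] ≤⁺.[ q ] = ≤⁺.[ ℤ.+-mono-≤ p q ]
  +⁺-mono ≤⁺.[ p ] (_ ≤⊤⁺) = _ ≤⊤⁺
  +⁺-mono (_ ≤⊤⁺) _ = _ ≤⊤⁺

  V-* : V m x → V n y → V (m ℤ.+ n) (x * y)
  V-* {x = x} {y = y} p q = ≡.subst ([ _ ] ≤⁺_) (≡.sym (ord-* x y)) (+⁺-mono p q)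

  V-*ˡ : 𝔬 x → V n y → V n (x * y)
  V-*ˡ p q = ≡.subst (λ k → V k _) (ℤ.+-identityˡ _) (V-* p q)

  V-*ʳ : V n x → 𝔬 y → V n (x * y)
  V-*ʳ p q = ≡.subst (λ k → V k _) (ℤ.+-identityʳ _) (V-* p q)

  V-neg : V n x → V n (- x)
  V-neg {x = x} p =
    V-resp (solve 1 (λ x → x :* :- :1 := :- x) refl x) (V-*ʳ p (-∈𝔬 1∈𝔬))

  V-- : V n x → V n y → V n (x - y)
  V-- p q = V-+ p (V-neg q)

  V-cancelʳ : V n y → V n (x + y) → V n x
  V-cancelʳ {y = y} {x = x} p q =
    V-resp (solve 2 (λ x y → x :+ y :- y := x) refl x y) (V-- q p)

  V-cancelˡ : V n x → V n (x + y) → V n y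
  V-cancelˡ p q = V-cancelʳ p (V-resp (+-comm _ _) q)

  ord⇒V : ord x ≡ [ n ] → V n x
  ord⇒V p = ≡.subst ([ _ ] ≤⁺_) (≡.sym p) ≤⁺.[ ℤ.≤-refl ]

  V⇒≤ : ord x ≡ [ m ] → V n x → n ℤ.≤ m
  V⇒≤ p q = ≤⁺.[≤]-injective (≡.subst ([ _ ] ≤⁺_) p q)

  V⇒ord : V n x → ¬ V (ℤ.suc n) x → ord x ≡ [ n ]
  V⇒ord {n} {x} p q = lemma (ord x) p q
    where
    lemma : ∀ u → [ n ] ≤⁺ u → ¬ [ ℤ.suc n ] ≤⁺ u → u ≡ [ n ]
    lemma ⊤⁺ _ q = contradiction (_ ≤⊤⁺) q
    lemma [ k ] ≤⁺.[ p ] q =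
      ≡.cong [_] (ℤ.≤-antisym (ℤ.≮⇒≥ (q ∘ ≤⁺.[_] ∘ ℤ.i<j⇒suc[i]≤j)) p)

  ¬V⇒ord : ¬ V n x → ∃ λ m → ord x ≡ [ m ] × m ℤ.< n
  ¬V⇒ord {n} {x} q = lemma (ord x) ≡.refl q
    where
    lemma : ∀ u → ord x ≡ u → ¬ [ n ] ≤⁺ u → ∃ λ m → ord x ≡ [ m ] × m ℤ.< n
    lemma ⊤⁺ _ q = contradiction (_ ≤⊤⁺) q
    lemma [ k ] eq q = k , eq , ℤ.≰⇒> (q ∘ ≤⁺.[_])

  ord-+ˡ : ord x ≡ [ n ] → V (ℤ.suc n) y → ord (x + y) ≡ [ n ]
  ord-+ˡ {n = n} p q = V⇒ord (V-+ (ord⇒V p) (V-≤ (ℤ.i≤suc[i] n) q))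
    (λ r → ℤ.<⇒≱ (ℤ.suc[i]≤j⇒i<j ℤ.≤-refl) (V⇒≤ p (V-cancelʳ q r)))

  ord-neg : ord x ≡ [ n ] → ord (- x) ≡ [ n ]
  ord-neg {x} {n} p = V⇒ord (V-neg (ord⇒V p)) (λ r → ℤ.<⇒≱ (ℤ.suc[i]≤j⇒i<j ℤ.≤-refl)
    (V⇒≤ p (V-resp (solve 1 (λ x → :- (:- x) := x) refl x) (V-neg r))))

  ord≡⇒≉0 : ord x ≡ [ n ] → x ≉ 0#
  ord≡⇒≉0 {x = x} p x≈0 with ≡.trans (≡.sym p) (Equivalence.from (ord≡∞⇔≈0 x) x≈0)
  ... | ()

  ≉0⇒ord : x ≉ 0# → ∃ λ n → ord x ≡ [ n ]
  ≉0⇒ord {x} x≉0 = lemma (ord x) ≡.refl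
    where
    lemma : ∀ u → ord x ≡ u → ∃ λ n → ord x ≡ [ n ]
    lemma ⊤⁺ eq = contradiction (Equivalence.to (ord≡∞⇔≈0 x) eq) x≉0
    lemma [ n ] eq = n , eq

  -- The valuation is data, so a case split on `ord x` decides this although equality in `F` is not
  -- assumed decidable.
  _≈0? : ∀ x → Dec (x ≈ 0#)
  x ≈0? = lemma (ord x) ≡.refl
    where
    lemma : ∀ u → ord x ≡ u → Dec (x ≈ 0#)
    lemma ⊤⁺ eq = yes (Equivalence.to (ord≡∞⇔≈0 x) eq)
    lemma [ n ] eq = no (ord≡⇒≉0 eq)

  ord-1 : ord 1# ≡ [ + 0 ]
  ord-1 with v+v≡v⇒v≡∞⊎v≡0 (ord 1#)
               (≡.trans (≡.sym (ord-* 1# 1#)) (ord-cong (*-identityˡ 1#)))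
  ... | inj₁ ≡∞ = contradiction (Equivalence.to (ord≡∞⇔≈0 1#) ≡∞) 1≉0
  ... | inj₂ ≡0 = ≡0

  ord-*-≡ : ord x ≡ [ m ] → ord y ≡ [ n ] → ord (x * y) ≡ [ m ℤ.+ n ]
  ord-*-≡ {x} {y = y} p q = ≡.trans (ord-* x y) (≡.cong₂ _+⁺_ p q)

  ord-inverse : x * y ≈ 1# → ord x ≡ [ n ] → ord y ≡ [ ℤ.- n ]
  ord-inverse {x} {y} {n} xy≈1 p = lemma (ord y)
    (≡.trans (≡.cong (_+⁺ ord y) (≡.sym p)) (≡.trans (≡.sym (ord-* x y))
      (≡.trans (ord-cong xy≈1) ord-1)))
    where
    lemma : ∀ u → [ n ] +⁺ u ≡ [ + 0 ] → u ≡ [ ℤ.- n ]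
    lemma [ k ] eq = ≡.cong [_] (≡.sym (begin
      ℤ.- n                    ≡⟨ ℤ.+-identityʳ (ℤ.- n) ⟨
      ℤ.- n ℤ.+ + 0            ≡⟨ ≡.cong (λ i → ℤ.- n ℤ.+ i) ([]-injective eq) ⟨
      ℤ.- n ℤ.+ (n ℤ.+ k)      ≡⟨ ℤ.+-assoc (ℤ.- n) n k ⟨
      ℤ.- n ℤ.+ n ℤ.+ k        ≡⟨ ≡.cong (ℤ._+ k) (ℤ.+-inverseˡ n) ⟩
      + 0 ℤ.+ k                ≡⟨ ℤ.+-identityˡ k ⟩
      k                        ∎))
      where open ≡.≡-Reasoning

  inverse-ord : ord x ≡ [ n ] → ∃ λ y → x * y ≈ 1# × ord y ≡ [ ℤ.- n ]
  inverse-ord {x} p = let y , xy≈1 = inverse x (ord≡⇒≉0 p) in y , xy≈1 , ord-inverse xy≈1 p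

  argmin : ∀ {k} (v : Vector Carrier (suc k)) → ∃ λ i → ∀ j → ord (v i) ≤⁺ ord (v j)
  argmin {zero} v = zero , λ { zero → ≤⁺.≤⁺-reflexive-≡ ℤ.≤-reflexive ≡.refl }
  argmin {suc k} v with argmin (v ∘ suc)
  ... | i , p with ≤⁺.≤⁺-total ℤ.≤-total (ord (v zero)) (ord (v (suc i)))
  ... | inj₁ q = zero , λ { zero → ≤⁺.≤⁺-reflexive-≡ ℤ.≤-reflexive ≡.refl ; (suc j) →
    ≤⁺-trans q (p j) }
  ... | inj₂ q = suc i , λ { zero → q ; (suc j) → p j }

  bounded⁺ : ∀ u → ∃ λ N → [ ℤ.- (+ N) ] ≤⁺ u
  bounded⁺ ⊤⁺         = 0 , (_ ≤⊤⁺)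
  bounded⁺ [ + n ]      = 0 , ≤⁺.[ ℤ.+≤+ ℕ.z≤n ]
  bounded⁺ [ -[1+ n ] ] = suc n , ≤⁺.[ ℤ.≤-refl ]

  V-bounded : ∀ {k} (v : Vector Carrier k) → ∃ λ N → ∀ i → V (ℤ.- (+ N)) (v i)
  V-bounded {zero}  v = 0 , λ ()
  V-bounded {suc k} v with V-bounded (v ∘ suc) | bounded⁺ (ord (v zero))
  ... | M , p | N , q = M ℕ.+ N , λ
    { zero    → V-≤ (ℤ.neg-mono-≤ (ℤ.+≤+ (ℕ.m≤n+m N M))) q
    ; (suc i) → V-≤ (ℤ.neg-mono-≤ (ℤ.+≤+ (ℕ.m≤m+n M N))) (p i) }

  module Powers (π : Carrier) (ord-π : ord π ≡ [ + 1 ]) where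
    open CubicAlgebra.Uniformizer F π ord-π
    open Exp commutativeSemiring using (_^_; ^-distrib-*)

    ord-^ : ∀ {i} k → ord x ≡ [ i ] → ord (x ^ k) ≡ [ + k ℤ.* i ]
    ord-^ zero p = ord-1
    ord-^ {i = i} (suc k) p = ≡.trans (ord-*-≡ p (ord-^ k p)) (≡.cong [_] (≡.sym (ℤ.suc-* (+ k) i)))

    ord-π^ : ∀ j → ord (π^ j) ≡ [ j ]
    ord-π^ (+ n) = ≡.trans (ord-^ n ord-π) (≡.cong [_] (ℤ.*-identityʳ (+ n)))
    ord-π^ -[1+ n ] = ≡.trans (ord-^ (suc n) (ord-inverse (proj₂ (inverse π π≉0)) ord-π))
      (≡.cong [_] (≡.trans (≡.sym (ℤ.neg-distribʳ-* (+ suc n) (+ 1)))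
        (≡.cong ℤ.-_ (ℤ.*-identityʳ (+ suc n)))))

    1^ : ∀ k → 1# ^ k ≈ 1#
    1^ zero = refl
    1^ (suc k) = trans (*-identityˡ _) (1^ k)

    ^-cong : ∀ k → x ≈ y → x ^ k ≈ y ^ k
    ^-cong zero p = refl
    ^-cong (suc k) p = *-cong p (^-cong k p)

    π^-inverse : ∀ n → (π^ (+ n)) * (π^ (ℤ.- (+ n))) ≈ 1#
    π^-inverse zero = *-identityˡ 1#
    π^-inverse (suc n) = trans (sym (^-distrib-* π _ (suc n)))
      (trans (^-cong (suc n) (proj₂ (inverse π π≉0))) (1^ (suc n)))

    π^-+ : ∀ m n → π^ (+ (m ℕ.+ n)) ≈ (π^ (+ m)) * (π^ (+ n))
    π^-+ zero n = sym (*-identityˡ _)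
    π^-+ (suc m) n = trans (*-congˡ (π^-+ m n)) (sym (*-assoc _ _ _))

    -- The bridge from the fractional ideals of the statement to decidable valuation bounds: divide
    -- by `π^ j`. The inverse comes from the field axiom, which treats both signs of `j` at once.
    ⟨π^⟩⇔V : ∀ {x} j → ⟨π^ j ⟩ x ⇔ V j x
    ⟨π^⟩⇔V {x} j = mk⇔
      (λ (y , y∈𝔬 , x≈) → V-resp (sym x≈) (V-*ʳ (ord⇒V (ord-π^ j)) y∈𝔬))
      (λ p → let q , pq≈1 , ord-q = inverse-ord (ord-π^ j) in
        q * x ,
        ≡.subst (λ k → V k (q * x)) (ℤ.+-inverseˡ j) (V-* (ord⇒V ord-q) p) ,
        trans (trans (sym (*-identityˡ x)) (*-congʳ (sym pq≈1))) (*-assoc _ q x))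

-- Trace form, dual bases and the exchange step.

module Lattices {κ ℓ} (F : NonArchimedeanLocalField κ ℓ) where
  open NonArchimedeanLocalField F hiding (zero)
  open CubicAlgebra F
  open Valuation F
  open Sum E.semiring using (sum; sum-cong-≋; ∑-distrib-+; *-distribˡ-sum)
  private
    module S = IntegerSolver commutativeRing
    module SE = IntegerSolver E-commutativeRing

  private variable
    m n : ℤ

  Δ-cong : ∀ {x y} → x ≈ y → Δ x E.≈ Δ y
  Δ-cong p = p , p , p

  infix 7 _∙_

  tr : E.Carrier → Carrier
  tr (x , y , z) = x + y + z

  _∙_ : E.Carrier → E.Carrier → Carrier
  e ∙ f = tr (e E.* f)

  tr-cong : ∀ {e f} → e E.≈ f → tr e ≈ tr f
  tr-cong (p , q , r) = +-cong (+-cong p q) r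

  ∙-cong : ∀ {e e′ f f′} → e E.≈ e′ → f E.≈ f′ → e ∙ f ≈ e′ ∙ f′
  ∙-cong {e} {e′} {f} {f′} p q = tr-cong (E.*-cong {e} {e′} {f} {f′} p q)

  ∙-congˡ : ∀ {e f f′} → f E.≈ f′ → e ∙ f ≈ e ∙ f′
  ∙-congˡ {e} {f} {f′} = ∙-cong {e} {e} {f} {f′} E.refl

  ∙-congʳ : ∀ {e e′ f} → e E.≈ e′ → e ∙ f ≈ e′ ∙ f
  ∙-congʳ {e} {e′} {f} p = ∙-cong {e} {e′} {f} {f} p E.refl

  ∙-comm : ∀ e f → e ∙ f ≈ f ∙ e
  ∙-comm e f = tr-cong (E.*-comm e f)

  ∙-0ʳ : ∀ e → e ∙ E.0# ≈ 0#
  ∙-0ʳ e = trans (tr-cong (E.zeroʳ e)) (trans (+-congʳ (+-identityʳ 0#)) (+-identityʳ 0#))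

  ∙-+ʳ : ∀ e f g → e ∙ (f E.+ g) ≈ e ∙ f + e ∙ g
  ∙-+ʳ (a , b , c) (x , y , z) (x′ , y′ , z′) = S.solve 9
    (λ a b c x y z x′ y′ z′ →
      a S.:* (x S.:+ x′) S.:+ b S.:* (y S.:+ y′) S.:+ c S.:* (z S.:+ z′) S.:=
      (a S.:* x S.:+ b S.:* y S.:+ c S.:* z) S.:+ (a S.:* x′ S.:+ b S.:* y′ S.:+ c S.:* z′))
    refl a b c x y z x′ y′ z′

  ∙-Δʳ : ∀ e r f → e ∙ (Δ r E.* f) ≈ r * (e ∙ f)
  ∙-Δʳ (a , b , c) r (x , y , z) = S.solve 7
    (λ a b c r x y z →
      a S.:* (r S.:* x) S.:+ b S.:* (r S.:* y) S.:+ c S.:* (r S.:* z) S.:=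
      r S.:* (a S.:* x S.:+ b S.:* y S.:+ c S.:* z))
    refl a b c r x y z

  ∙-+ˡ : ∀ e f g → (e E.+ f) ∙ g ≈ e ∙ g + f ∙ g
  ∙-+ˡ e f g = trans (∙-comm (e E.+ f) g)
    (trans (∙-+ʳ g e f) (+-cong (∙-comm g e) (∙-comm g f)))

  ∙-Δˡ : ∀ r e f → (Δ r E.* e) ∙ f ≈ r * (e ∙ f)
  ∙-Δˡ r e f = trans (∙-comm (Δ r E.* e) f) (trans (∙-Δʳ f r e) (*-congˡ (∙-comm f e)))

  ∙-Δ-Δʳ : ∀ e f r g → e ∙ (f E.- Δ r E.* g) ≈ e ∙ f - r * (e ∙ g)
  ∙-Δ-Δʳ (a , b , c) (x , y , z) r (x′ , y′ , z′) = S.solve 10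
    (λ a b c x y z r x′ y′ z′ →
      a S.:* (x S.:- r S.:* x′) S.:+ b S.:* (y S.:- r S.:* y′) S.:+ c S.:* (z S.:- r S.:* z′) S.:=
      (a S.:* x S.:+ b S.:* y S.:+ c S.:* z) S.:- r S.:* (a S.:* x′ S.:+ b S.:* y′ S.:+ c S.:* z′))
    refl a b c x y z r x′ y′ z′

  -- Negation is left out because it is the action of `- 1#`. The level is free so that duals, which
  -- live in `Set`, and spans are treated alike.
  record IsModule {p} (M : Pred E.Carrier p) : Set (κ ⊔ ℓ ⊔ p) where
    field
      resp : ∀ {x y} → x E.≈ y → x ∈ M → y ∈ M
      0∈   : E.0# ∈ M
      +∈   : ∀ {x y} → x ∈ M → y ∈ M → x E.+ y ∈ M
      *∈   : ∀ {r x} → r ∈ 𝔬 → x ∈ M → Δ r E.* x ∈ M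

    sum∈ : ∀ {k} (v : Vector E.Carrier k) → (∀ i → v i ∈ M) → sum v ∈ M
    sum∈ {zero}  v p = 0∈
    sum∈ {suc k} v p = +∈ (p zero) (sum∈ (v ∘ suc) (p ∘ suc))

    span⊆ : ∀ {k} {g : Vector E.Carrier k} → (∀ i → g i ∈ M) → Span Δ[ 𝔬 ] g ⊆ M
    span⊆ {g = g} p {e} (r , r∈ , e≈) = resp (E.sym {e} e≈) (sum∈ _ term∈)
      where
      term∈ : ∀ i → r i E.* g i ∈ M
      term∈ i = let s , s∈𝔬 , r≈ = r∈ i in
        resp (E.*-congʳ {g i} {Δ s} {r i} (E.sym {r i} r≈)) (*∈ s∈𝔬 (p i))

  comb : ∀ {k} → Vector Carrier k → Vector E.Carrier k → E.Carrier
  comb r g = sum (λ i → Δ (r i) E.* g i)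

  comb∈span : ∀ {k} {r : Vector Carrier k} {g} → (∀ i → r i ∈ 𝔬) → comb r g ∈ Span Δ[ 𝔬 ] g
  comb∈span {r = r} r∈𝔬 = (Δ ∘ r) , (λ i → r i , r∈𝔬 i , E.refl) , E.refl

  kronecker : ∀ {k} → Fin k → Fin k → Carrier
  kronecker zero    zero    = 1#
  kronecker zero    (suc j) = 0#
  kronecker (suc i) zero    = 0#
  kronecker (suc i) (suc j) = kronecker i j

  kronecker∈𝔬 : ∀ {k} (i j : Fin k) → kronecker i j ∈ 𝔬
  kronecker∈𝔬 zero    zero    = 1∈𝔬
  kronecker∈𝔬 zero    (suc j) = 0∈𝔬
  kronecker∈𝔬 (suc i) zero    = 0∈𝔬
  kronecker∈𝔬 (suc i) (suc j) = kronecker∈𝔬 i j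

  gen∈span : ∀ {k} (g : Vector E.Carrier k) i → g i ∈ Span Δ[ 𝔬 ] g
  gen∈span g i = (λ j → Δ (kronecker i j)) , (λ j → kronecker i j , kronecker∈𝔬 i j , E.refl) ,
    E.sym (pick g i)
    where
    comb-0 : ∀ {k} (g : Vector E.Carrier k) → comb (λ _ → 0#) g E.≈ E.0#
    comb-0 {zero}  g = E.refl
    comb-0 {suc k} g = E.trans (E.+-cong (E.zeroˡ (g zero)) (comb-0 (g ∘ suc))) (E.+-identityˡ E.0#)
    pick : ∀ {k} (g : Vector E.Carrier k) i → comb (kronecker i) g E.≈ g i
    pick {suc k} g zero    = E.trans (E.+-cong (E.*-identityˡ (g zero)) (comb-0 (g ∘ suc)))
      (E.+-identityʳ (g zero))
    pick {suc k} g (suc i) = E.trans (E.+-cong (E.zeroˡ (g zero)) (pick (g ∘ suc) i))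
      (E.+-identityˡ (g (suc i)))

  V-∙-comb : ∀ {k n} u (r : Vector Carrier k) (g : Vector E.Carrier k) →
    (∀ i → V n (r i)) → (∀ i → u ∙ g i ∈ 𝔬) → V n (u ∙ comb r g)
  V-∙-comb {zero}  u r g p q = V-resp (sym (∙-0ʳ u)) V-0
  V-∙-comb {suc k} u r g p q = V-resp (sym (∙-+ʳ u (Δ (r zero) E.* g zero) _))
    (V-+ (V-resp (sym (∙-Δʳ u (r zero) (g zero))) (V-*ʳ (p zero) (q zero)))
      (V-∙-comb u (r ∘ suc) (g ∘ suc) (p ∘ suc) (q ∘ suc)))

  module SpanClosure {R : Subset} (0∈R : E.0# ∈ R) (+∈R : ∀ {x y} → x ∈ R → y ∈ R → x E.+ y ∈ R)
    (*∈R : ∀ {x y} → x ∈ R → y ∈ R → x E.* y ∈ R) {k} (g : Vector E.Carrier k) where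

    resp∈ : ∀ {x y} → x E.≈ y → x ∈ Span R g → y ∈ Span R g
    resp∈ {x} {y} x≈y (r , r∈ , x≈) = r , r∈ , E.trans {y} (E.sym {x} x≈y) x≈

    0∈ : E.0# ∈ Span R g
    0∈ = (λ _ → E.0#) , (λ i → 0∈R) ,
      E.trans {E.0#} (E.sym {sum g E.* E.0#} (E.zeroʳ (sum g)))
        (E.trans {sum g E.* E.0#} (E.*-comm (sum g) E.0#) (*-distribˡ-sum E.0# g))

    +∈ : ∀ {x y} → x ∈ Span R g → y ∈ Span R g → x E.+ y ∈ Span R g
    +∈ {x} {y} (r , r∈ , x≈) (s , s∈ , y≈) =
      (λ i → r i E.+ s i) , (λ i → +∈R (r∈ i) (s∈ i)) ,
      E.trans {x E.+ y} (E.+-cong {x} {_} {y} {_} x≈ y≈)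
        (E.trans (E.sym (∑-distrib-+ (λ i → r i E.* g i) (λ i → s i E.* g i)))
          (sum-cong-≋ (λ i → E.sym {(r i E.+ s i) E.* g i} (E.distribʳ (g i) (r i) (s i)))))

    *∈ : ∀ {a x} → a ∈ R → x ∈ Span R g → a E.* x ∈ Span R g
    *∈ {a} {x} a∈ (r , r∈ , x≈) =
      (λ i → a E.* r i) , (λ i → *∈R a∈ (r∈ i)) ,
      E.trans {a E.* x} (E.*-congˡ {a} {x} x≈)
        (E.trans (*-distribˡ-sum a (λ i → r i E.* g i))
          (sum-cong-≋ (λ i → E.sym {(a E.* r i) E.* g i} (E.*-assoc a (r i) (g i)))))

  span-isModule : ∀ {k} (g : Vector E.Carrier k) → IsModule (Span Δ[ 𝔬 ] g)
  span-isModule g = record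
    { resp = C.resp∈ ; 0∈ = C.0∈ ; +∈ = C.+∈ ; *∈ = λ {r} r∈ → C.*∈ (r , r∈ , E.refl) }
    where
    module C = SpanClosure {Δ[ 𝔬 ]} (0# , 0∈𝔬 , E.refl)
      (λ {x} {y} (a , a∈ , x≈) (b , b∈ , y≈) → a + b , +∈𝔬 a∈ b∈ ,
        E.+-cong {x} {Δ a} {y} {Δ b} x≈ y≈)
      (λ {x} {y} (a , a∈ , x≈) (b , b∈ , y≈) → a * b , *∈𝔬 a∈ b∈ ,
        E.*-cong {x} {Δ a} {y} {Δ b} x≈ y≈) g

  Dual : Vector E.Carrier 3 → Pred E.Carrier _
  Dual f e = ∀ i → e ∙ f i ∈ 𝔬

  dual-isModule : ∀ f → IsModule (Dual f)
  dual-isModule f = record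
    { resp = λ {x} {y} x≈y p i → V-resp (∙-congʳ {x} {y} {f i} x≈y) (p i)
    ; 0∈ = λ i → V-resp (sym (trans (∙-comm E.0# (f i)) (∙-0ʳ (f i)))) V-0
    ; +∈ = λ {x} {y} p q i → V-resp (sym (∙-+ˡ x y (f i))) (V-+ (p i) (q i))
    ; *∈ = λ {r} {x} r∈ p i → V-resp (sym (∙-Δˡ r x (f i))) (V-*ˡ r∈ (p i))
    }

  -- Duality is recorded by the two expansions, the form in which it is used, and not by
  -- `b i ∙ f j ≈ kronecker i j`; having both makes the notion symmetric in `b` and `f`. By
  -- `expand`, `Dual f` lies in the span of `b`; `integral` gives the reverse inclusion.
  record DualBases (b f : Vector E.Carrier 3) : Set (κ ⊔ ℓ) where
    field
      expand   : ∀ e → e E.≈ comb (λ i → e ∙ f i) b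
      expand*  : ∀ e → e E.≈ comb (λ i → e ∙ b i) f
      integral : ∀ i → b i ∈ Dual f

    flip : DualBases f b
    flip = record
      { expand = expand* ; expand* = expand
      ; integral = λ i j → V-resp (∙-comm (b j) (f i)) (integral j i) }

    -- The pairings with `f` are the coordinates in `b`. Nothing is asked of `M` beyond being a
    -- module, so undecidable predicates are covered.
    dual⊆ : ∀ {p} {M : Pred E.Carrier p} → IsModule M → (∀ i → b i ∈ M) → Dual f ⊆ M
    dual⊆ M-mod b∈M {e} e∈ =
      M.resp (E.sym {e} (expand e)) (M.span⊆ {g = b} b∈M (comb∈span {g = b} e∈))
      where module M = IsModule M-mod

    dual⊆span : Dual f ⊆ Span Δ[ 𝔬 ] b
    dual⊆span = dual⊆ (span-isModule b) (gen∈span b)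

    span⊆dual : Span Δ[ 𝔬 ] b ⊆ Dual f
    span⊆dual = IsModule.span⊆ (dual-isModule f) integral

  open DualBases

  det : Vector E.Carrier 3 → Carrier
  det v = minors (v 0F) (v 1F) (v 2F)
    where
    minors : E.Carrier → E.Carrier → E.Carrier → Carrier
    minors (a , b , c) (d , e , f) (g , h , i) = a * (e * i - f * h) - b * (d * i - f * g) + c *
      (d * h - e * g)

  det-cong : ∀ {u v : Vector E.Carrier 3} → (∀ i → u i E.≈ v i) → det u ≈ det v
  det-cong p = +-cong (+-cong (*-cong (p 0F .proj₁)
    (+-cong (*-cong (p 1F .proj₂ .proj₁) (p 2F .proj₂ .proj₂))
    (-‿cong (*-cong (p 1F .proj₂ .proj₂) (p 2F .proj₂ .proj₁)))))
    (-‿cong (*-cong (p 0F .proj₂ .proj₁) (+-cong (*-cong (p 1F .proj₁) (p 2F .proj₂ .proj₂))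
      (-‿cong (*-cong (p 1F .proj₂ .proj₂) (p 2F .proj₁)))))))
    (*-cong (p 0F .proj₂ .proj₂) (+-cong (*-cong (p 1F .proj₁) (p 2F .proj₂ .proj₁))
      (-‿cong (*-cong (p 1F .proj₂ .proj₁) (p 2F .proj₁)))))

  det∈𝔬 : ∀ {v} → (∀ i → v i ∈ 𝓞ᴱ) → det v ∈ 𝔬
  det∈𝔬 p = V-+ (V-- (*∈𝔬 (p 0F .proj₁) (V-- (*∈𝔬 (p 1F
    .proj₂ .proj₁) (p 2F .proj₂ .proj₂)) (*∈𝔬 (p 1F .proj₂ .proj₂) (p 2F .proj₂ .proj₁))))
    (*∈𝔬 (p 0F .proj₂ .proj₁) (V-- (*∈𝔬 (p 1F .proj₁) (p 2F .proj₂ .proj₂))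
      (*∈𝔬 (p 1F .proj₂ .proj₂) (p 2F .proj₁)))))
    (*∈𝔬 (p 0F .proj₂ .proj₂) (V-- (*∈𝔬 (p 1F .proj₁) (p 2F .proj₂ .proj₁))
      (*∈𝔬 (p 1F .proj₂ .proj₁) (p 2F .proj₁))))

  σ : Fin 3 → Fin 3
  σ 0F = 1F
  σ 1F = 2F
  σ 2F = 0F

  -- The exchange is written out for position 0 only. The other positions are reached by cyclic
  -- shifts, which are even permutations of the three rows and preserve the determinant.
  rotate : ∀ {b f} → DualBases b f → DualBases (b ∘ σ) (f ∘ σ)
  rotate {b} {f} B = record
    { expand = λ e → E.trans {e} (expand B e) (rot (λ i → e ∙ f i) b)
    ; expand* = λ e → E.trans {e} (expand* B e) (rot (λ i → e ∙ b i) f)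
    ; integral = λ i j → integral B (σ i) (σ j)
    }
    where
    rot : ∀ r g → comb r g E.≈ comb (r ∘ σ) (g ∘ σ)
    rot r g = SE.solve 3 (λ x y z → x SE.:+ (y SE.:+ (z SE.:+ SE.:0)) SE.:=
      y SE.:+ (z SE.:+ (x SE.:+ SE.:0)))
      E.refl (Δ (r 0F) E.* g 0F) (Δ (r 1F) E.* g 1F) (Δ (r 2F) E.* g 2F)

  det-rotate : ∀ v → det (v ∘ σ) ≈ det v
  det-rotate v = S.solve 9 (λ a b c d e f g h i →
      let det = λ a b c d e f g h i → a S.:* (e S.:* i S.:- f S.:* h) S.:- b S.:*
            (d S.:* i S.:- f S.:* g) S.:+ c S.:* (d S.:* h S.:- e S.:* g)
      in det d e f g h i a b c S.:= det a b c d e f g h i)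
    refl _ _ _ _ _ _ _ _ _

  replace₀ : Vector E.Carrier 3 → E.Carrier → Vector E.Carrier 3
  replace₀ v x 0F = x
  replace₀ v x (suc i) = v (suc i)

  det-replace₀ : ∀ b r → det (replace₀ b (comb r b)) ≈ r 0F * det b
  det-replace₀ b r = S.solve 12 (λ a b c d e f g h i s t u →
      let det = λ a b c d e f g h i →  a S.:* (e S.:* i S.:- f S.:* h) S.:- b S.:*
            (d S.:* i S.:- f S.:* g) S.:+ c S.:* (d S.:* h S.:- e S.:* g)
          row = λ a d g → s S.:* a S.:+ (t S.:* d S.:+ (u S.:* g S.:+ S.:0))
      in det (row a d g) (row b e h) (row c f i) d e f g h i S.:= s S.:* det a b c d e f g h i) refl
      _ _ _ _ _ _ _ _ _ _ _ _

  -- `origin` tells where each new basis vector comes from; this carries membership in an arbitrary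
  -- predicate over from `x` and the old basis. `det<` is the strict descent that bounds chains.
  record Adjoined (b f : Vector E.Carrier 3) (x : E.Carrier) : Set (κ ⊔ ℓ) where
    field
      {b′ f′} : Vector E.Carrier 3
      bases   : DualBases b′ f′
      origin  : ∀ i → b′ i ≡ x ⊎ ∃ λ j → b′ i ≡ b j
      dual⊆dual : Dual f ⊆ Dual f′
      new∈    : x ∈ Dual f′
      det<    : ord (det b) ≡ [ m ] → ∃ λ n → ord (det b′) ≡ [ n ] × n ℤ.< m

    origin∈ : ∀ {p} {M : Pred E.Carrier p} → x ∈ M → (∀ i → b i ∈ M) → ∀ i → b′ i ∈ M
    origin∈ {M = M} x∈ b∈ i with origin i
    ... | inj₁ eq       = ≡.subst M (≡.sym eq) x∈
    ... | inj₂ (j , eq) = ≡.subst M (≡.sym eq) (b∈ j)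

  -- A pivot step. In `x = Σ t j b j` the coefficient `t 0F` has the least valuation, and it is
  -- negative, so `s = 1 / t 0F` and all `t j * s` are integral. With `x` in place of `b 0F` the
  -- dual basis becomes `s f 0F` and `f j - t j s f 0F`, integral combinations of the old one; the
  -- determinant is multiplied by `t 0F`.
  exchange : ∀ {b f x} → DualBases b f → ord (x ∙ f 0F) ≡ [ n ] → n ℤ.< + 0 →
             (∀ j → V n (x ∙ f j)) → Adjoined b f x
  exchange {n} {b} {f} {x} B ord-t n<0 V-t = record
    { b′ = b′
    ; f′ = f′
    ; bases = record { expand = expand′ ; expand* = expand*′ ; integral =
      λ { 0F → x∈ ; 1F → old∈ {b 1F} (integral B 1F) ; 2F → old∈ {b 2F} (integral B 2F) } }
    ; origin = λ { 0F → inj₁ ≡.refl ; 1F → inj₂ (1F , ≡.refl) ; 2F → inj₂ (2F , ≡.refl) }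
    ; dual⊆dual = λ {e} → old∈ {e}
    ; new∈ = x∈
    ; det< = λ {m} p → n ℤ.+ m , ≡.trans (ord-cong det′) (ord-*-≡ ord-t p) ,
        ≡.subst (n ℤ.+ m ℤ.<_) (ℤ.+-identityˡ m) (ℤ.+-monoˡ-< m n<0)
    }
    where
    t : Vector Carrier 3
    t j = x ∙ f j
    inv = inverse-ord ord-t
    s = proj₁ inv
    ts≈1 : t 0F * s ≈ 1#
    ts≈1 = proj₁ (proj₂ inv)
    Vs : V (ℤ.- n) s
    Vs = ord⇒V (proj₂ (proj₂ inv))
    s∈𝔬 : s ∈ 𝔬
    s∈𝔬 = V-≤ (ℤ.neg-mono-≤ (ℤ.<⇒≤ n<0)) Vs
    ts∈𝔬 : ∀ j → t j * s ∈ 𝔬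
    ts∈𝔬 j = ≡.subst (λ k → V k (t j * s)) (ℤ.+-inverseʳ n) (V-* (V-t j) Vs)
    b′ = replace₀ b x
    f′ : Vector E.Carrier 3
    f′ 0F = Δ s E.* f 0F
    f′ 1F = f 1F E.- Δ (t 1F * s) E.* f 0F
    f′ 2F = f 2F E.- Δ (t 2F * s) E.* f 0F
    old∈ : Dual f ⊆ Dual f′
    old∈ {e} p 0F = V-resp (sym (∙-Δʳ e s (f 0F))) (*∈𝔬 s∈𝔬 (p 0F))
    old∈ {e} p 1F = V-resp (sym (∙-Δ-Δʳ e (f 1F) (t 1F * s) (f 0F)))
      (V-- (p 1F) (*∈𝔬 (ts∈𝔬 1F) (p 0F)))
    old∈ {e} p 2F = V-resp (sym (∙-Δ-Δʳ e (f 2F) (t 2F * s) (f 0F)))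
      (V-- (p 2F) (*∈𝔬 (ts∈𝔬 2F) (p 0F)))
    cancel : ∀ a → a - (a * s) * t 0F ≈ 0#
    cancel a = trans (+-congˡ (-‿cong (trans (*-assoc a s (t 0F))
      (trans (*-congˡ (trans (*-comm s (t 0F)) ts≈1)) (*-identityʳ a))))) (-‿inverseʳ a)
    x∈ : x ∈ Dual f′
    x∈ 0F = V-resp (sym (trans (∙-Δʳ x s (f 0F)) (trans (*-comm _ _) ts≈1))) 1∈𝔬
    x∈ 1F = V-resp (sym (trans (∙-Δ-Δʳ x (f 1F) (t 1F * s) (f 0F)) (cancel (t 1F)))) V-0
    x∈ 2F = V-resp (sym (trans (∙-Δ-Δʳ x (f 2F) (t 2F * s) (f 0F)) (cancel (t 2F)))) V-0
    det′ : det b′ ≈ t 0F * det b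
    det′ = trans (det-cong {b′} {replace₀ b (comb t b)}
      (λ { 0F → expand B x ; 1F → E.refl ; 2F → E.refl })) (det-replace₀ b t)
    T : Vector E.Carrier 3
    T j = Δ (t j)
    module _ (e : E.Carrier) where
      private
        A = λ j → Δ (e ∙ f j)
        A* = λ j → Δ (e ∙ b j)
      expand′ : e E.≈ comb (λ i → e ∙ f′ i) b′
      -- The solver cannot use `t 0F * s ≈ 1#`: the factor `t 0F * s` is first inserted into the
      -- leading term, after which the identity is polynomial.
      expand′ = E.trans {e} (expand B e) (E.trans
        (E.sym (E.+-congʳ {A 1F E.* b 1F E.+ (A 2F E.* b 2F E.+ E.0#)}
          {A 0F E.* (T 0F E.* Δ s) E.* b 0F} {A 0F E.* b 0F}
          (E.*-congʳ {b 0F} {A 0F E.* (T 0F E.* Δ s)} {A 0F}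
            (Δ-cong (trans (*-congˡ ts≈1) (*-identityʳ _))))))
        (E.trans
        (SE.solve 10 (λ s t₀ t₁ t₂ a₀ a₁ a₂ b₀ b₁ b₂ →
          a₀ SE.:* (t₀ SE.:* s) SE.:* b₀ SE.:+ (a₁ SE.:* b₁ SE.:+ (a₂ SE.:* b₂ SE.:+ SE.:0)) SE.:=
          s SE.:* a₀ SE.:* (t₀ SE.:* b₀ SE.:+ (t₁ SE.:* b₁ SE.:+ (t₂ SE.:* b₂ SE.:+ SE.:0))) SE.:+
          ((a₁ SE.:- t₁ SE.:* s SE.:* a₀) SE.:* b₁ SE.:+
            ((a₂ SE.:- t₂ SE.:* s SE.:* a₀) SE.:* b₂ SE.:+ SE.:0)))
          E.refl (Δ s) (T 0F) (T 1F) (T 2F) (A 0F) (A 1F) (A 2F) (b 0F) (b 1F) (b 2F))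
        (E.+-cong (E.*-cong {Δ s E.* A 0F} (Δ-cong (sym (∙-Δʳ e s (f 0F))))
          (E.sym {x} (expand B x)))
          (E.+-cong (E.*-congʳ {b 1F} (Δ-cong (sym (∙-Δ-Δʳ e (f 1F) (t 1F * s) (f 0F)))))
          (E.+-cong (E.*-congʳ {b 2F} (Δ-cong (sym (∙-Δ-Δʳ e (f 2F) (t 2F * s) (f 0F)))))
          (E.refl {E.0#}))))))
      e∙x : e ∙ x ≈ t 0F * (e ∙ b 0F) + (t 1F * (e ∙ b 1F) + (t 2F * (e ∙ b 2F) + 0#))
      e∙x = trans (∙-congˡ {e} {x} (expand B x)) (trans (∙-+ʳ e (T 0F E.* b 0F) _)
        (+-cong (∙-Δʳ e (t 0F) (b 0F)) (trans (∙-+ʳ e (T 1F E.* b 1F) _)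
        (+-cong (∙-Δʳ e (t 1F) (b 1F)) (trans (∙-+ʳ e (T 2F E.* b 2F) _)
        (+-cong (∙-Δʳ e (t 2F) (b 2F)) (∙-0ʳ e)))))))
      expand*′ : e E.≈ comb (λ i → e ∙ b′ i) f′
      expand*′ = E.trans {e} (expand* B e) (E.trans
        (E.sym (E.+-congʳ {A* 1F E.* f 1F E.+ (A* 2F E.* f 2F E.+ E.0#)}
          {A* 0F E.* (T 0F E.* Δ s) E.* f 0F} {A* 0F E.* f 0F}
          (E.*-congʳ {f 0F} {A* 0F E.* (T 0F E.* Δ s)} {A* 0F}
            (Δ-cong (trans (*-congˡ ts≈1) (*-identityʳ _))))))
        (E.trans
        (SE.solve 10 (λ s t₀ t₁ t₂ a₀ a₁ a₂ b₀ b₁ b₂ →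
          a₀ SE.:* (t₀ SE.:* s) SE.:* b₀ SE.:+ (a₁ SE.:* b₁ SE.:+ (a₂ SE.:* b₂ SE.:+ SE.:0)) SE.:=
          (t₀ SE.:* a₀ SE.:+ (t₁ SE.:* a₁ SE.:+ (t₂ SE.:* a₂ SE.:+ SE.:0))) SE.:* (s SE.:* b₀) SE.:+
          (a₁ SE.:* (b₁ SE.:- t₁ SE.:* s SE.:* b₀) SE.:+
            (a₂ SE.:* (b₂ SE.:- t₂ SE.:* s SE.:* b₀) SE.:+ SE.:0)))
          E.refl (Δ s) (T 0F) (T 1F) (T 2F) (A* 0F) (A* 1F) (A* 2F) (f 0F) (f 1F) (f 2F))
        (E.+-congʳ (E.*-congʳ {Δ s E.* f 0F} (Δ-cong (sym e∙x))))))

-- Adjoining vectors to a lattice; finitely generated modules of full rank.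

module Adjunction {κ ℓ} (F : NonArchimedeanLocalField κ ℓ) where
  open NonArchimedeanLocalField F hiding (zero)
  open CubicAlgebra F
  open Valuation F
  open Lattices F
  open Sum E.semiring using (*-distribˡ-sum)
  private
    module S = IntegerSolver commutativeRing

  unrotate : ∀ {b f x} → Adjoined (b ∘ σ) (f ∘ σ) x → Adjoined b f x
  unrotate {b} {f} {x} A = record
    { bases = A.bases
    ; origin = λ i → origin i (A.origin i)
    ; dual⊆dual = λ {e} p → A.dual⊆dual {e} (p ∘ σ)
    ; new∈ = A.new∈
    ; det< = λ p → A.det< (≡.trans (ord-cong (det-rotate b)) p)
    }
    where
    module A = Adjoined A
    origin : ∀ i → A.b′ i ≡ x ⊎ (∃ λ j → A.b′ i ≡ b (σ j)) → A.b′ i ≡ x ⊎ ∃ λ j → A.b′ i ≡ b j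
    origin i (inj₁ eq)       = inj₁ eq
    origin i (inj₂ (j , eq)) = inj₂ (σ j , eq)

  -- A coordinate of least valuation settles the matter: if it is integral then so are all, and
  -- otherwise it is the pivot required by `exchange`.
  adjoin : ∀ {b f} → DualBases b f → ∀ x → x ∈ Dual f ⊎ Adjoined b f x
  adjoin {b} {f} B x with argmin (λ i → x ∙ f i)
  ... | i , min with V? (+ 0) (x ∙ f i)
  ...   | yes p = inj₁ (λ j → ≤⁺-trans p (min j))
  ...   | no ¬p with ¬V⇒ord ¬p
  ...     | n , eq , n<0 = inj₂ (at i eq)
    where
    V-t : ∀ j → V n (x ∙ f j)
    V-t j = ≤⁺-trans (ord⇒V eq) (min j)
    at : ∀ i → ord (x ∙ f i) ≡ [ n ] → Adjoined b f x
    at 0F eq = exchange B eq n<0 V-t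
    at 1F eq = unrotate (exchange (rotate B) eq n<0 (V-t ∘ σ))
    at 2F eq = unrotate (unrotate (exchange (rotate (rotate B)) eq n<0 (V-t ∘ σ ∘ σ)))

  adjoinAll : ∀ {p k b f} {M : Pred E.Carrier p} → DualBases b f → (∀ i → b i ∈ M) →
    (v : Vector E.Carrier k) → (∀ j → v j ∈ M) →
    ∃₂ λ b′ f′ → DualBases b′ f′ × (∀ i → b′ i ∈ M) × Dual f ⊆ Dual f′ × (∀ j → v j ∈ Dual f′)
  adjoinAll {k = zero} B b∈ v v∈ = _ , _ , B , b∈ , (λ p → p) , λ ()
  adjoinAll {k = suc k} {M = M} B b∈ v v∈ with adjoin B (v zero)
  ... | inj₁ v₀∈ =
    let b′ , f′ , B′ , b′∈ , f⊆f′ , v∈′ = adjoinAll {M = M} B b∈ (v ∘ suc) (v∈ ∘ suc) in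
    b′ , f′ , B′ , b′∈ , (λ {e} → f⊆f′ {e}) , λ { zero → f⊆f′ {v zero} v₀∈ ; (suc j) → v∈′ j }
  ... | inj₂ A =
    let module A = Adjoined A
        b′ , f′ , B′ , b′∈ , f⊆f′ , v∈′ = adjoinAll {M = M} A.bases (A.origin∈ {M = M} (v∈ zero) b∈)
          (v ∘ suc) (v∈ ∘ suc) in
    b′ , f′ , B′ , b′∈ , (λ {e} p → f⊆f′ {e} (A.dual⊆dual {e} p)) ,
    λ { zero → f⊆f′ {v zero} A.new∈ ; (suc j) → v∈′ j }

  ε₀ ε₁ ε₂ : Carrier → E.Carrier
  ε₀ p = p , 0# , 0#
  ε₁ p = 0# , p , 0#
  ε₂ p = 0# , 0# , p

  diagonal : (p₀ p₁ p₂ : Carrier) → Vector E.Carrier 3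
  diagonal p₀ p₁ p₂ = ε₀ p₀ ∷ ε₁ p₁ ∷ ε₂ p₂ ∷ []

  ∙-ε₀ : ∀ e q → e ∙ ε₀ q ≈ proj₁ e * q
  ∙-ε₀ (x , y , w) q = S.solve 4 (λ x y w q → x S.:* q S.:+ y S.:* S.:0 S.:+ w S.:* S.:0 S.:=
    x S.:* q) refl x y w q

  ∙-ε₁ : ∀ e q → e ∙ ε₁ q ≈ proj₁ (proj₂ e) * q
  ∙-ε₁ (x , y , w) q = S.solve 4 (λ x y w q → x S.:* S.:0 S.:+ y S.:* q S.:+ w S.:* S.:0 S.:=
    y S.:* q) refl x y w q

  ∙-ε₂ : ∀ e q → e ∙ ε₂ q ≈ proj₂ (proj₂ e) * q
  ∙-ε₂ (x , y , w) q = S.solve 4 (λ x y w q → x S.:* S.:0 S.:+ y S.:* S.:0 S.:+ w S.:* q S.:=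
    w S.:* q) refl x y w q

  private
    cancel : ∀ {p q} x → p * q ≈ 1# → x * q * p ≈ x
    cancel {p} {q} x pq≈1 = trans (*-assoc x q p) (trans (*-congˡ (trans (*-comm q p) pq≈1))
      (*-identityʳ x))

    expand-diagonal : ∀ {p₀ p₁ p₂ q₀ q₁ q₂} → p₀ * q₀ ≈ 1# → p₁ * q₁ ≈ 1# → p₂ * q₂ ≈ 1# →
      ∀ e → e E.≈ comb (λ i → e ∙ diagonal q₀ q₁ q₂ i) (diagonal p₀ p₁ p₂)
    expand-diagonal {p₀} {p₁} {p₂} {q₀} {q₁} {q₂} pq₀ pq₁ pq₂ e@(x , y , w) =
      sym (trans (S.solve 4 (λ a b c p → a S.:* p S.:+
        (b S.:* S.:0 S.:+ (c S.:* S.:0 S.:+ S.:0)) S.:= a S.:* p) refl (e ∙ ε₀ q₀) (e ∙ ε₁ q₁)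
        (e ∙ ε₂ q₂) p₀)
        (trans (*-congʳ (∙-ε₀ e q₀)) (cancel x pq₀))) ,
      sym (trans (S.solve 4 (λ a b c p → a S.:* S.:0 S.:+
        (b S.:* p S.:+ (c S.:* S.:0 S.:+ S.:0)) S.:= b S.:* p) refl (e ∙ ε₀ q₀) (e ∙ ε₁ q₁)
        (e ∙ ε₂ q₂) p₁)
        (trans (*-congʳ (∙-ε₁ e q₁)) (cancel y pq₁))) ,
      sym (trans (S.solve 4 (λ a b c p → a S.:* S.:0 S.:+
        (b S.:* S.:0 S.:+ (c S.:* p S.:+ S.:0)) S.:= c S.:* p) refl (e ∙ ε₀ q₀) (e ∙ ε₁ q₁)
        (e ∙ ε₂ q₂) p₂)
        (trans (*-congʳ (∙-ε₂ e q₂)) (cancel w pq₂)))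

  diagonal-dualBases : ∀ {p₀ p₁ p₂ q₀ q₁ q₂} → p₀ * q₀ ≈ 1# → p₁ * q₁ ≈ 1# → p₂ * q₂ ≈ 1# →
    DualBases (diagonal p₀ p₁ p₂) (diagonal q₀ q₁ q₂)
  diagonal-dualBases {p₀} {p₁} {p₂} {q₀} {q₁} {q₂} pq₀ pq₁ pq₂ = record
    { expand = expand-diagonal pq₀ pq₁ pq₂
    ; expand* = expand-diagonal (trans (*-comm _ _) pq₀) (trans (*-comm _ _) pq₁)
      (trans (*-comm _ _) pq₂)
    ; integral = integral
    }
    where
    one : ∀ {a x} → a ≈ x → x ≈ 1# → a ∈ 𝔬
    one a≈x x≈1 = V-resp (sym (trans a≈x x≈1)) 1∈𝔬
    nil : ∀ {a q} → a ≈ 0# * q → a ∈ 𝔬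
    nil {q = q} a≈ = V-resp (sym (trans a≈ (zeroˡ q))) 0∈𝔬
    integral : ∀ i → diagonal p₀ p₁ p₂ i ∈ Dual (diagonal q₀ q₁ q₂)
    integral 0F 0F = one (∙-ε₀ (ε₀ p₀) q₀) pq₀
    integral 0F 1F = nil (∙-ε₁ (ε₀ p₀) q₁)
    integral 0F 2F = nil (∙-ε₂ (ε₀ p₀) q₂)
    integral 1F 0F = nil (∙-ε₀ (ε₁ p₁) q₀)
    integral 1F 1F = one (∙-ε₁ (ε₁ p₁) q₁) pq₁
    integral 1F 2F = nil (∙-ε₂ (ε₁ p₁) q₂)
    integral 2F 0F = nil (∙-ε₀ (ε₂ p₂) q₀)
    integral 2F 1F = nil (∙-ε₁ (ε₂ p₂) q₁)
    integral 2F 2F = one (∙-ε₂ (ε₂ p₂) q₂) pq₂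

  module Denominators (π : Carrier) (ord-π : ord π ≡ [ + 1 ]) where
    open Uniformizer π ord-π
    open Powers π ord-π

    clearDenominators : ∀ {I} → IsModule I → SpansE I → ∀ e → ∃ λ N → Δ (π^ (+ N)) E.* e ∈ I
    clearDenominators {I} I-mod spans e with spans e
    ... | k , u , v , u∈ , v∈ , e≈ with V-bounded (λ i → proj₁ (u∈ i))
    ...   | N , bound = N ,
      I.resp (E.sym {Δ (π^ (+ N)) E.* e} (E.trans {Δ (π^ (+ N)) E.* e}
        (E.*-congˡ {Δ (π^ (+ N))} {e} e≈) (*-distribˡ-sum (Δ (π^ (+ N))) (λ i → u i E.* v i))))
        (I.sum∈ _ term∈)
      where
      module I = IsModule I-mod
      term∈ : ∀ i → Δ (π^ (+ N)) E.* (u i E.* v i) ∈ I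
      term∈ i = let r , _ , u≈ = u∈ i in
        I.resp (E.trans {Δ ((π^ (+ N)) * r) E.* v i} (E.*-assoc (Δ (π^ (+ N))) (Δ r) (v i))
          (E.*-congˡ {Δ (π^ (+ N))} (E.*-congʳ {v i} {Δ r} {u i} (E.sym {u i} u≈))))
          (I.*∈ (≡.subst (λ k → V k ((π^ (+ N)) * r)) (ℤ.+-inverseʳ (+ N))
            (V-* (ord⇒V (ord-π^ (+ N))) (bound i))) (v∈ i))

    ε : Fin 3 → Carrier → E.Carrier
    ε 0F = ε₀
    ε 1F = ε₁
    ε 2F = ε₂

    -- Rank is expressed by multiples of the three idempotents, since these form a diagonal lattice
    -- with an explicit dual basis, the starting point of `lattice`.
    FullRank : Subset → Set (κ ⊔ ℓ)
    FullRank I = ∀ i → ∃ λ N → ε i (π^ (+ N)) ∈ I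

    spansE⇒fullRank : ∀ {I} → IsModule I → SpansE I → FullRank I
    spansE⇒fullRank I-mod spans i with clearDenominators I-mod spans (ε i 1#)
    ... | N , p∈ = N , IsModule.resp I-mod (scale i (π^ (+ N))) p∈
      where
      scale : ∀ i p → Δ p E.* ε i 1# E.≈ ε i p
      scale 0F p = *-identityʳ p , zeroʳ p , zeroʳ p
      scale 1F p = zeroʳ p , *-identityʳ p , zeroʳ p
      scale 2F p = zeroʳ p , zeroʳ p , *-identityʳ p

    fullRank-* : ∀ {I J K} → IsModule K → FullRank I → FullRank J →
      (∀ {x y} → x ∈ I → y ∈ J → x E.* y ∈ K) → FullRank K
    fullRank-* K-mod rankI rankJ *∈ i with rankI i | rankJ i
    ... | M , p∈ | N , q∈ = M ℕ.+ N , IsModule.resp K-mod (product i) (*∈ p∈ q∈)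
      where
      product : ∀ i → ε i (π^ (+ M)) E.* ε i (π^ (+ N)) E.≈ ε i (π^ (+ (M ℕ.+ N)))
      product 0F = sym (π^-+ M N) , zeroˡ 0# , zeroˡ 0#
      product 1F = zeroˡ 0# , sym (π^-+ M N) , zeroˡ 0#
      product 2F = zeroˡ 0# , zeroˡ 0# , sym (π^-+ M N)

    -- If the `v i j` generate `I`, the lattice found is `I` itself. The double index suits the
    -- products of generators of an order with those of an ideal, and the products of the bases of
    -- two ideals.
    lattice : ∀ {I k l} → FullRank I → (v : Fin l → Vector E.Carrier k) → (∀ i j → v i j ∈ I) →
      ∃₂ λ b f → DualBases b f × (∀ i → b i ∈ I) × (∀ i j → v i j ∈ Dual f)
    lattice {I} rank v v∈ =
      let N₀ , p₀∈ = rank 0F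
          N₁ , p₁∈ = rank 1F
          N₂ , p₂∈ = rank 2F
      in adjoinRows (diagonal-dualBases (π^-inverse N₀) (π^-inverse N₁) (π^-inverse N₂))
        (λ { 0F → p₀∈ ; 1F → p₁∈ ; 2F → p₂∈ }) v v∈
      where
      adjoinRows : ∀ {k l b f} → DualBases b f → (∀ i → b i ∈ I) →
        (v : Fin l → Vector E.Carrier k) → (∀ i j → v i j ∈ I) →
        ∃₂ λ b′ f′ → DualBases b′ f′ × (∀ i → b′ i ∈ I) × (∀ i j → v i j ∈ Dual f′)
      adjoinRows {l = zero} B b∈ v v∈ = _ , _ , B , b∈ , λ ()
      adjoinRows {l = suc l} B b∈ v v∈ =
        let _ , _ , B′ , b′∈ , rows∈ = adjoinRows B b∈ (v ∘ suc) (v∈ ∘ suc)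
            b″ , f″ , B″ , b″∈ , f′⊆f″ , row∈ = adjoinAll {M = I} B′ b′∈ (v zero) (v∈ zero)
        in b″ , f″ , B″ , b″∈ , λ { zero → row∈ ; (suc i) j → f′⊆f″ {v (suc i) j} (rows∈ i j) }

-- The modules `𝓞 a b c`: coordinates and ring structure.

module StandardOrders {κ ℓ} (F : NonArchimedeanLocalField κ ℓ) where
  open NonArchimedeanLocalField F hiding (zero)
  open CubicAlgebra F
  open Valuation F
  open Lattices F
  open Adjunction F
  open IntegerSolver commutativeRing

  -- The ring solver knows nothing of u ≈ 1 and v ≈ 1: it proves x ≈ y up to
  -- multiples k of u - 1 and l of v - 1.
  cancelUnits : ∀ {u v x y k l} → u ≈ 1# → v ≈ 1# →
                x ≈ y + k * (u - 1#) + l * (v - 1#) → x ≈ y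
  cancelUnits {u} {v} {x} {y} {k} {l} u≈1 v≈1 x≈ = trans x≈ (trans
    (+-cong (+-congˡ (*-congˡ (+-congʳ u≈1))) (*-congˡ (+-congʳ v≈1)))
    (solve 3 (λ y k l → y :+ k :* (:1 :- :1) :+ l :* (:1 :- :1) := y) refl y k l))

  spansE : ∀ {b f} {M : Subset} → DualBases b f → (∀ i → b i ∈ M) → SpansE M
  spansE {b} {f} B b∈ e =
    3 , (λ i → Δ (e ∙ f i)) , b , (λ i → e ∙ f i , _ , E.refl) , b∈ , DualBases.expand B e

  module Orders (π : Carrier) (ord-π : ord π ≡ [ + 1 ]) where
    open Uniformizer π ord-π
    open Powers π ord-π
    open Denominators π ord-π

    V⇔𝔬 : ∀ n x → V (+ n) x ⇔ (π^ (ℤ.- (+ n))) * x ∈ 𝔬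
    V⇔𝔬 n x = mk⇔
      (λ p → ≡.subst (λ k → V k ((π^ (ℤ.- (+ n))) * x)) (ℤ.+-inverseˡ (+ n))
        (V-* (ord⇒V (ord-π^ (ℤ.- (+ n)))) p))
      (λ p → V-resp (trans (sym (*-assoc _ _ x)) (trans (*-congʳ (π^-inverse n)) (*-identityˡ x)))
        (V-*ʳ (ord⇒V (ord-π^ (+ n))) p))

    gens : ℕ → ℕ → Carrier → Vector E.Carrier 3
    gens a b c = (1# , 1# , 1#) ∷ (0# , π^ (+ a) , 0#) ∷ (0# , c , π^ (+ b)) ∷ []

    module _ (a b : ℕ) (c : Carrier) where
      private
        A A⁻ B B⁻ : Carrier
        A = π^ (+ a)
        A⁻ = π^ (ℤ.- (+ a))
        B = π^ (+ b)
        B⁻ = π^ (ℤ.- (+ b))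
        AA⁻≈1 : A * A⁻ ≈ 1#
        AA⁻≈1 = π^-inverse a
        BB⁻≈1 : B * B⁻ ≈ 1#
        BB⁻≈1 = π^-inverse b

      -- With `s = (z - x) / π^b` one has `(x , y , z) = x (1 , 1 , 1) + ((y - x - c s) / π^a) (0 ,
      -- π^a , 0) + s (0 , c , π^b)`; these vectors represent the three coordinates under the trace
      -- form.
      dualGens : Vector E.Carrier 3
      dualGens = (1# , 0# , 0#) ∷ (A⁻ * (c * B⁻ - 1#) , A⁻ , - (A⁻ * (c * B⁻))) ∷
        (- B⁻ , 0# , B⁻) ∷ []

      -- π^a times the coordinate along (0 , π^a , 0); it does not depend on a.
      coord₁ : E.Carrier → Carrier
      coord₁ (x , y , z) = y - x - c * (B⁻ * (z - x))

      ∙-dual₀ : ∀ e → e ∙ dualGens 0F ≈ proj₁ e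
      ∙-dual₀ (x , y , z) = solve 3 (λ x y z → x :* :1 :+ y :* :0 :+ z :* :0 := x) refl x y z

      ∙-dual₁ : ∀ e → e ∙ dualGens 1F ≈ A⁻ * coord₁ e
      ∙-dual₁ (x , y , z) = solve 6 (λ x y z c p q →
        x :* (p :* (c :* q :- :1)) :+ y :* p :+ z :* (:- (p :* (c :* q))) :=
        p :* (y :- x :- c :* (q :* (z :- x)))) refl x y z c A⁻ B⁻

      ∙-dual₂ : ∀ e → e ∙ dualGens 2F ≈ B⁻ * (e .proj₂ .proj₂ - e .proj₁)
      ∙-dual₂ (x , y , z) = solve 4 (λ x y z q → x :* :- q :+ y :* :0 :+ z :* q := q :* (z :- x))
        refl x y z B⁻

      gens∙dual : ∀ i j → gens a b c i ∙ dualGens j ≈ kronecker i j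
      gens∙dual 0F 0F = (∙-dual₀ (gens a b c 0F))
      gens∙dual 0F 1F = (trans (∙-dual₁ (gens a b c 0F))
        (solve 3 (λ p c q → p :* (:1 :- :1 :- c :* (q :* (:1 :- :1))) := :0) refl A⁻ c B⁻))
      gens∙dual 0F 2F = (trans (∙-dual₂ (gens a b c 0F)) (solve 1 (λ q → q :* (:1 :- :1) := :0) refl
        B⁻))
      gens∙dual 1F 0F = (∙-dual₀ (gens a b c 1F))
      gens∙dual 1F 1F = (trans (∙-dual₁ (gens a b c 1F))
        (trans (solve 4 (λ p p′ c q → p′ :* (p :- :0 :- c :* (q :* (:0 :- :0))) := p :* p′) refl A
        A⁻ c B⁻) AA⁻≈1))
      gens∙dual 1F 2F = (trans (∙-dual₂ (gens a b c 1F)) (solve 1 (λ q → q :* (:0 :- :0) := :0) refl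
        B⁻))
      gens∙dual 2F 0F = (∙-dual₀ (gens a b c 2F))
      gens∙dual 2F 1F = (trans (∙-dual₁ (gens a b c 2F))
        (cancelUnits {k = 0#} AA⁻≈1 BB⁻≈1 (solve 5
        (λ p p′ c q q′ → p′ :* (c :- :0 :- c :* (q′ :* (q :- :0))) :=
        :0 :+ :0 :* (p :* p′ :- :1) :+ (:- (p′ :* c)) :* (q :* q′ :- :1)) refl A A⁻ c B B⁻)))
      gens∙dual 2F 2F = (trans (∙-dual₂ (gens a b c 2F)) (trans (solve 2 (λ q q′ →
        q′ :* (q :- :0) := q :* q′) refl B B⁻) BB⁻≈1))

      gens-dualBases : DualBases (gens a b c) dualGens
      gens-dualBases = record { expand = expand ; expand* = expand* ; integral = integral }
        where
        expand : ∀ e → e E.≈ comb (λ i → e ∙ dualGens i) (gens a b c)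
        expand e@(x , y , z) = E.trans {e}
          ( solve 3 (λ x g h → x := x :* :1 :+ (g :* :0 :+ (h :* :0 :+ :0))) refl x (A⁻ * coord₁ e)
            (B⁻ * (z - x))
          , sym (cancelUnits {l = 0#} AA⁻≈1 BB⁻≈1 (solve 8 (λ x y z c p p′ q q′ →
              let h = q′ :* (z :- x); g = y :- x :- c :* h in
              x :* :1 :+ (p′ :* g :* p :+ (h :* c :+ :0)) :=
              y :+ g :* (p :* p′ :- :1) :+ :0 :* (q :* q′ :- :1)) refl x y z c A A⁻ B B⁻))
          , sym (cancelUnits {k = 0#} AA⁻≈1 BB⁻≈1 (solve 8 (λ x y z c p p′ q q′ →
              let h = q′ :* (z :- x); g = y :- x :- c :* h in
              x :* :1 :+ (p′ :* g :* :0 :+ (h :* q :+ :0)) :=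
              z :+ :0 :* (p :* p′ :- :1) :+ (z :- x) :* (q :* q′ :- :1)) refl x y z c A A⁻ B B⁻)))
          (sum-cong-≋ {3} {λ i → Δ (g i) E.* gens a b c i} {λ i →
            Δ (e ∙ dualGens i) E.* gens a b c i}
            (λ i → E.*-congʳ {gens a b c i} (Δ-cong (g≈ i))))
          where
          open Sum E.semiring using (sum-cong-≋)
          g : Vector Carrier 3
          g = x ∷ (A⁻ * coord₁ e) ∷ (B⁻ * (z - x)) ∷ []
          g≈ : ∀ i → g i ≈ e ∙ dualGens i
          g≈ 0F = sym (∙-dual₀ e)
          g≈ 1F = sym (∙-dual₁ e)
          g≈ 2F = sym (∙-dual₂ e)
        expand* : ∀ e → e E.≈ comb (λ i → e ∙ gens a b c i) dualGens
        expand* e@(x , y , z) =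
          sym (cancelUnits AA⁻≈1 BB⁻≈1 (solve 8 (λ x y z c p p′ q q′ →
              (x :* :1 :+ y :* :1 :+ z :* :1) :* :1
                :+ ((x :* :0 :+ y :* p :+ z :* :0) :* (p′ :* (c :* q′ :- :1))
                :+ ((x :* :0 :+ y :* c :+ z :* q) :* :- q′ :+ :0)) :=
              x :+ (y :* (c :* q′ :- :1)) :* (p :* p′ :- :1) :+ (:- z) :* (q :* q′ :- :1)) refl x y
                z c A A⁻ B B⁻)) ,
          sym (cancelUnits {l = 0#} AA⁻≈1 BB⁻≈1 (solve 8 (λ x y z c p p′ q q′ →
              (x :* :1 :+ y :* :1 :+ z :* :1) :* :0
                :+ ((x :* :0 :+ y :* p :+ z :* :0) :* p′
                :+ ((x :* :0 :+ y :* c :+ z :* q) :* :0 :+ :0)) :=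
              y :+ y :* (p :* p′ :- :1) :+ :0 :* (q :* q′ :- :1)) refl x y z c A A⁻ B B⁻)) ,
          sym (cancelUnits AA⁻≈1 BB⁻≈1 (solve 8 (λ x y z c p p′ q q′ →
              (x :* :1 :+ y :* :1 :+ z :* :1) :* :0
                :+ ((x :* :0 :+ y :* p :+ z :* :0) :* :- (p′ :* (c :* q′))
                :+ ((x :* :0 :+ y :* c :+ z :* q) :* q′ :+ :0)) :=
              z :+ (:- (y :* (c :* q′))) :* (p :* p′ :- :1) :+ z :* (q :* q′ :- :1)) refl x y z c A
                A⁻ B B⁻))
        integral : ∀ i → gens a b c i ∈ Dual dualGens
        integral i j = V-resp (sym (gens∙dual i j)) (kronecker∈𝔬 i j)

      Coordinates : E.Carrier → Set
      Coordinates e@(x , y , z) = x ∈ 𝔬 × V (+ a) (coord₁ e) × V (+ b) (z - x)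

      Dual⇒Coordinates : ∀ e → Dual dualGens e → Coordinates e
      Dual⇒Coordinates e p =
        V-resp (∙-dual₀ e) (p 0F) ,
        Equivalence.from (V⇔𝔬 a (coord₁ e)) (V-resp (∙-dual₁ e) (p 1F)) ,
        Equivalence.from (V⇔𝔬 b (e .proj₂ .proj₂ - e .proj₁)) (V-resp (∙-dual₂ e) (p 2F))

      Coordinates⇒Dual : ∀ e → Coordinates e → Dual dualGens e
      Coordinates⇒Dual e (p , q , r) 0F = V-resp (sym (∙-dual₀ e)) p
      Coordinates⇒Dual e (p , q , r) 1F = V-resp (sym (∙-dual₁ e))
        (Equivalence.to (V⇔𝔬 a (coord₁ e)) q)
      Coordinates⇒Dual e (p , q , r) 2F = V-resp (sym
        (∙-dual₂ e)) (Equivalence.to (V⇔𝔬 b (e .proj₂ .proj₂ - e .proj₁)) r)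

      ∈𝓞⇒ : ∀ e → e ∈ 𝓞 a b c → Coordinates e
      ∈𝓞⇒ e p = Dual⇒Coordinates e (DualBases.span⊆dual gens-dualBases {e} p)

      ∈𝓞⇐ : ∀ e → Coordinates e → e ∈ 𝓞 a b c
      ∈𝓞⇐ e p = DualBases.dual⊆span gens-dualBases {e} (Coordinates⇒Dual e p)

      𝓞-isModule : IsModule (𝓞 a b c)
      𝓞-isModule = span-isModule (gens a b c)

      gen∈ : ∀ i → gens a b c i ∈ 𝓞 a b c
      gen∈ = gen∈span (gens a b c)

      square∈𝓞⇒ : gens a b c 2F E.* gens a b c 2F ∈ 𝓞 a b c → V (+ a) (c * (c - B))
      square∈𝓞⇒ p = V-resp
        (cancelUnits {k = 0#} AA⁻≈1 BB⁻≈1 (solve 5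
          (λ p p′ c q q′ → c :* c :- :0 :* :0 :- c :* (q′ :* (q :* q :- :0 :* :0)) :=
          c :* (c :- q) :+ :0 :* (p :* p′ :- :1) :+ (:- (c :* q)) :* (q :* q′ :- :1)) refl A A⁻ c
          B B⁻))
        (proj₁ (proj₂ (∈𝓞⇒ (gens a b c 2F E.* gens a b c 2F) p)))

      ring⇒ : IsOrder (𝓞 a b c) → V (+ a) (c * (c - B))
      ring⇒ isOrder = square∈𝓞⇒ (IsOrder.*∈ isOrder (gen∈ 2F) (gen∈ 2F))

      𝓞⊆𝓞ᴱ : c ∈ 𝔬 → 𝓞 a b c ⊆ 𝓞ᴱ
      𝓞⊆𝓞ᴱ c∈𝔬 {e@(x , y , z)} e∈ =
        let x∈ , Vy , Vz = ∈𝓞⇒ e e∈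
            s∈ = Equivalence.to (V⇔𝔬 b (z - x)) Vz in
        x∈ ,
        V-cancelʳ (V-neg x∈) (V-cancelʳ (V-neg (*∈𝔬 c∈𝔬 s∈)) (V-≤ (ℤ.+≤+ ℕ.z≤n) Vy)) ,
        V-cancelʳ (V-neg x∈) (V-≤ (ℤ.+≤+ ℕ.z≤n) Vz)

      ⇒ring : c ∈ 𝔬 → V (+ a) (c * (c - B)) → IsOrder (𝓞 a b c)
      ⇒ring c∈𝔬 Vc = record
        { resp = O.resp
        ; 0∈ = O.0∈
        ; 1∈ = gen∈ 0F
        ; +∈ = O.+∈
        ; -∈ = λ {x} x∈ → O.resp (E.trans {Δ (- 1#) E.* x} (E-neg x) (E.refl {E.- x}))
          (O.*∈ (-∈𝔬 1∈𝔬) x∈)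
        ; *∈ = λ {x} {y} x∈ y∈ → ∈𝓞⇐ (x E.* y)
            (product (𝓞⊆𝓞ᴱ c∈𝔬 {x} x∈) (𝓞⊆𝓞ᴱ c∈𝔬 {y} y∈) (∈𝓞⇒ x x∈) (∈𝓞⇒ y y∈))
        ; Δ𝔬⊆ = λ {x} x∈ → O.resp (E.*-identityʳ (Δ x)) (O.*∈ x∈ (gen∈ 0F))
        ; finite = 3 , gens a b c , (λ p → p) , (λ p → p)
        ; spans = spansE {M = 𝓞 a b c} gens-dualBases gen∈
        }
        where
        module O = IsModule 𝓞-isModule
        E-neg : ∀ x → Δ (- 1#) E.* x E.≈ E.- x
        E-neg (x , y , z) = neg x , neg y , neg z
          where
          neg : ∀ x → - 1# * x ≈ - x
          neg = solve 1 (λ x → :- :1 :* x := :- x) refl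
        product : ∀ {e e′} → e ∈ 𝓞ᴱ → e′ ∈ 𝓞ᴱ → Coordinates e → Coordinates e′ →
          Coordinates (e E.* e′)
        product {x , y , z} {x′ , y′ , z′} (_ , _ , z∈) (_ , y′∈ , z′∈) (x∈ , w∈ , r∈)
          (x′∈ , w′∈ , r′∈) =
          *∈𝔬 x∈ x′∈ ,
          V-resp (sym identity) (V-+ (V-+ (V-*ʳ Vc (*∈𝔬 s∈ s′∈)) (V-*ʳ w∈ y′∈))
            (V-*ˡ (+∈𝔬 x∈ (*∈𝔬 c∈𝔬 s∈)) w′∈)) ,
          V-resp (solve 4 (λ x z x′ z′ → z :* (z′ :- x′) :+ x′ :* (z :- x) := z :* z′ :- x :* x′)
            refl x z x′ z′)
            (V-+ (V-*ˡ z∈ r′∈) (V-*ˡ x′∈ r∈))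
          where
          s = B⁻ * (z - x)
          s′ = B⁻ * (z′ - x′)
          s∈ = Equivalence.to (V⇔𝔬 b (z - x)) r∈
          s′∈ = Equivalence.to (V⇔𝔬 b (z′ - x′)) r′∈
          -- Write `y = x + c s + g` and `z = x + π^b s` with `g = coord₁ (x , y , z)`, and likewise
          -- for the second factor: `coord₁` of the product differs from a combination of `g` and
          -- `g′` only by `c (c - π^b) s s′`.
          identity : y * y′ - x * x′ - c * (B⁻ * (z * z′ - x * x′)) ≈
            c * (c - B) * (s * s′) + coord₁ (x , y , z) * y′ + (x + c * s) * coord₁ (x′ , y′ , z′)
          identity = trans (+-congˡ (-‿cong (*-congˡ z-x)))
            (solve 8 (λ x y x′ y′ c s s′ q →
              y :* y′ :- x :* x′ :- c :* (s :* (x′ :+ q :* s′) :+ x :* s′) :=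
              c :* (c :- q) :* (s :* s′) :+ (y :- x :- c :* s) :* y′ :+ (x :+ c :* s)
                :* (y′ :- x′ :- c :* s′))
              refl x y x′ y′ c s s′ B)
            where
            z-x : B⁻ * (z * z′ - x * x′) ≈ s * (x′ + B * s′) + x * s′
            z-x = cancelUnits {k = 0#} AA⁻≈1 BB⁻≈1 (solve 8 (λ x z x′ z′ p p′ q q′ →
              q′ :* (z :* z′ :- x :* x′) :=
              q′ :* (z :- x) :* (x′ :+ q :* (q′ :* (z′ :- x′))) :+ x :* (q′ :* (z′ :- x′))
              :+ :0 :* (p :* p′ :- :1) :+ (:- (q′ :* (z :- x) :* (z′ :- x′))) :* (q :* q′ :- :1))
              refl x z x′ z′ A A⁻ B B⁻)

-- Inequalities are transported along equal differences, because an equation between differences is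
-- a ring identity that the integer solver proves.
≤-from : ∀ {i j i′ j′} → i′ ℤ.≤ j′ → j ℤ.- i ≡ j′ ℤ.- i′ → i ℤ.≤ j
≤-from p eq = ℤ.0≤i-j⇒j≤i (≡.subst (+ 0 ℤ.≤_) (≡.sym eq) (ℤ.i≤j⇒0≤j-i p))

<-from : ∀ {i j i′ j′} → i′ ℤ.< j′ → j ℤ.- i ≡ j′ ℤ.- i′ → i ℤ.< j
<-from {i} {j} {i′} {j′} p eq = ℤ.suc[i]≤j⇒i<j (≤-from (ℤ.i<j⇒suc[i]≤j p)
  (≡.trans (lemma j i) (≡.trans (≡.cong (ℤ._- + 1) eq) (≡.sym (lemma j′ i′)))))
  where
  open ℤSolver.+-*-Solver
  lemma : ∀ j i → j ℤ.- (+ 1 ℤ.+ i) ≡ j ℤ.- i ℤ.- + 1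
  lemma = solve 2 (λ j i → j :- (con (+ 1) :+ i) := j :- i :- con (+ 1)) ≡.refl

⌈n/2⌉≤m : ∀ {n m} → n ℕ.≤ m ℕ.+ m → ⌈ n /2⌉ ℕ.≤ m
⌈n/2⌉≤m {n} {m} p = ≡.subst (⌈ n /2⌉ ℕ.≤_) (≡.sym (ℕ.n≡⌈n+n/2⌉ m)) (ℕ.⌈n/2⌉-mono p)

n≤⌈n/2⌉+⌈n/2⌉ : ∀ n → n ℕ.≤ ⌈ n /2⌉ ℕ.+ ⌈ n /2⌉
n≤⌈n/2⌉+⌈n/2⌉ n = ≡.subst (ℕ._≤ ⌈ n /2⌉ ℕ.+ ⌈ n /2⌉) (ℕ.⌊n/2⌋+⌈n/2⌉≡n n)
  (ℕ.+-monoˡ-≤ ⌈ n /2⌉ (ℕ.⌊n/2⌋≤⌈n/2⌉ n))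

2*n≡n+n : ∀ n → 2 ℕ.* n ≡ n ℕ.+ n
2*n≡n+n n = ≡.cong (n ℕ.+_) (ℕ.+-identityʳ n)

-- The order condition as a valuation bound for `c (c - π^b)`.

module Conditions {κ ℓ} (F : NonArchimedeanLocalField κ ℓ) where
  open NonArchimedeanLocalField F hiding (zero)
  open CubicAlgebra F
  open Valuation F
  open IntegerSolver commutativeRing
  private module ℤS = ℤSolver.+-*-Solver

  private variable
    m n : ℤ
    x y : Carrier

  V-scale : ord x ≡ [ m ] → V n y → V (m ℤ.+ n) (x * y)
  V-scale p = V-* (ord⇒V p)

  V-unscale : ord x ≡ [ m ] → V (m ℤ.+ n) (x * y) → V n y
  V-unscale {x} {m} {n} {y} p q =
    let x⁻ , xx⁻≈1 , p⁻ = inverse-ord p in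
    V-resp (trans (trans (sym (*-assoc x⁻ x y)) (*-congʳ (trans (*-comm x⁻ x) xx⁻≈1)))
      (*-identityˡ y))
      (≡.subst (λ k → V k (x⁻ * (x * y))) (lemma m n) (V-* (ord⇒V p⁻) q))
    where
    lemma : ∀ m n → ℤ.- m ℤ.+ (m ℤ.+ n) ≡ n
    lemma = ℤS.solve 2 (λ m n → ℤS.:- m ℤS.:+ (m ℤS.:+ n) ℤS.:= n) ≡.refl

  -- Meant for `ord p ≡ [ n ]`. When the valuations of `c` and `p` differ, the smaller one is that
  -- of `c - p`; when they agree, `c - p` is only bounded from below. In `below` the exponent is a
  -- natural number because `c` is integral.
  data Ultrametric (c p : Carrier) (n : ℤ) : Set where
    below : ∀ k → ord c ≡ [ + k ] → + k ℤ.< n → ord (c - p) ≡ [ + k ] → Ultrametric c p n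
    above : V (ℤ.suc n) c → ord (c - p) ≡ [ n ] → Ultrametric c p n
    equal : ord c ≡ [ n ] → V n (c - p) → Ultrametric c p n

  private
    n<suc : ∀ n → n ℤ.< ℤ.suc n
    n<suc n = ℤ.suc[i]≤j⇒i<j ℤ.≤-refl

  ultrametric : ∀ {c p n} → c ∈ 𝔬 → ord p ≡ [ n ] → Ultrametric c p n
  ultrametric {c} {p} {n} c∈𝔬 ord-p with V? n c
  ... | no ¬q with ¬V⇒ord ¬q
  ...   | + k , eq , k<n = below k eq k<n (ord-+ˡ eq
    (V-≤ (ℤ.i<j⇒suc[i]≤j k<n) (V-neg (ord⇒V ord-p))))
  ...   | -[1+ k ] , eq , k<n = contradiction (V⇒≤ eq c∈𝔬) λ ()
  ultrametric {c} {p} {n} c∈𝔬 ord-p | yes q with V? (ℤ.suc n) c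
  ...   | yes r = above r (≡.trans (ord-cong (+-comm c (- p))) (ord-+ˡ (ord-neg ord-p) r))
  ...   | no ¬r = equal (V⇒ord q ¬r) (V-- q (ord⇒V ord-p))

  module _ (π : Carrier) (ord-π : ord π ≡ [ + 1 ]) where
    open Uniformizer π ord-π
    open Powers π ord-π

    -- `ord c + ord (c - π^b) ≥ a`. For `ord c < b` the two summands are equal, so `2 ord c ≥ a`,
    -- which excludes `a > 2b`. For `ord c > b` the second is `b`, for `ord c = b` the first is, and
    -- the other one is at least `a - b`; if `a ≤ 2b`, `ord c ≥ b` is already enough.
    ring⇒condition : ∀ a b {c} → c ∈ 𝔬 → V (+ a) (c * (c - (π^ (+ b)))) → OrderCondition a b c
    ring⇒condition a b {c} c∈𝔬 Vcc = small , large
      where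
      B = π^ (+ b)
      ord-B = ord-π^ (+ b)
      shift : + a ≡ + b ℤ.+ (+ a ℤ.- + b)
      shift = ≡.sym (ℤS.solve 2 (λ a b → b ℤS.:+ (a ℤS.:- b) ℤS.:= a) ≡.refl (+ a) (+ b))
      a≤k+k : ∀ k → ord c ≡ [ + k ] → ord (c - B) ≡ [ + k ] → a ℕ.≤ k ℕ.+ k
      a≤k+k k p q = ℤ.drop‿+≤+ (V⇒≤ (ord-*-≡ p q) Vcc)
      V-half : a ℕ.≤ 2 ℕ.* b → V (+ b) c → V (+ ⌈ a /2⌉) c
      V-half a≤2b = V-≤ (ℤ.+≤+ (⌈n/2⌉≤m (≡.subst (a ℕ.≤_) (2*n≡n+n b) a≤2b)))
      V-quotient : ∀ {x y} → c * (c - B) ≈ x * y → ord x ≡ [ + b ] → V (+ a ℤ.- + b) y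
      V-quotient {x} {y} eq p = V-unscale p (≡.subst (λ k → V k (x * y)) shift (V-resp eq Vcc))
      small : a ℕ.≤ 2 ℕ.* b → c ∈ ⟨π^ + ⌈ a /2⌉ ⟩
      small a≤2b = Equivalence.from (⟨π^⟩⇔V (+ ⌈ a /2⌉)) (go (ultrametric c∈𝔬 ord-B))
        where
        go : Ultrametric c B (+ b) → V (+ ⌈ a /2⌉) c
        go (below k p _ q) = V-≤ (ℤ.+≤+ (⌈n/2⌉≤m (a≤k+k k p q))) (ord⇒V p)
        go (above p _) = V-half a≤2b (V-≤ (ℤ.i≤suc[i] (+ b)) p)
        go (equal p _) = V-half a≤2b (ord⇒V p)
      large : a ℕ.> 2 ℕ.* b → c ∈ ⟨π^ + a ℤ.- + b ⟩ ⊎ c - B ∈ ⟨π^ + a ℤ.- + b ⟩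
      large a>2b with ultrametric c∈𝔬 ord-B
      ... | below k p k<b q = contradiction (ℕ.≤-trans (a≤k+k k p q)
              (≡.subst (k ℕ.+ k ℕ.≤_) (≡.sym (2*n≡n+n b)) (ℕ.+-mono-≤ k≤b k≤b))) (ℕ.<⇒≱ a>2b)
        where k≤b = ℕ.<⇒≤ (ℤ.drop‿+<+ k<b)
      ... | above _ q = inj₁ (Equivalence.from (⟨π^⟩⇔V (+ a ℤ.- + b))
        (V-quotient (*-comm c (c - B)) q))
      ... | equal p _ = inj₂ (Equivalence.from (⟨π^⟩⇔V (+ a ℤ.- + b)) (V-quotient refl p))

    b≤a-b : ∀ a b → a ℕ.> 2 ℕ.* b → + b ℤ.≤ + a ℤ.- + b
    b≤a-b a b p = ≤-from (ℤ.+≤+ (ℕ.<⇒≤ (≡.subst (ℕ._< a) (2*n≡n+n b) p)))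
      (ℤS.solve 2 (λ a b → a ℤS.:- b ℤS.:- b ℤS.:= a ℤS.:- (b ℤS.:+ b)) ≡.refl (+ a) (+ b))

    -- For `a ≤ 2b` both factors lie in `(π^⌈a/2⌉)`, since `⌈a/2⌉ ≤ b`. For `a > 2b` one factor lies
    -- in `(π^(a-b))` and, as `b ≤ a - b`, the other one in `(π^b)`.
    condition⇒ring : ∀ a b {c} → c ∈ 𝔬 → OrderCondition a b c → V (+ a) (c * (c - (π^ (+ b))))
    condition⇒ring a b {c} c∈𝔬 (small , large) with a ℕ.≤? 2 ℕ.* b
    ... | yes a≤2b = V-≤ (ℤ.+≤+ (n≤⌈n/2⌉+⌈n/2⌉ a))
      (V-* Vc (V-- Vc (V-≤ (ℤ.+≤+ h≤b) (ord⇒V (ord-π^ (+ b))))))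
      where
      Vc : V (+ ⌈ a /2⌉) c
      Vc = Equivalence.to (⟨π^⟩⇔V (+ ⌈ a /2⌉)) (small a≤2b)
      h≤b : ⌈ a /2⌉ ℕ.≤ b
      h≤b = ⌈n/2⌉≤m (≡.subst (a ℕ.≤_) (2*n≡n+n b) a≤2b)
    ... | no a≰2b = go (large a>2b)
      where
      a>2b = ℕ.≰⇒> a≰2b
      B = π^ (+ b)
      VB : V (+ b) B
      VB = ord⇒V (ord-π^ (+ b))
      eq₁ : + a ℤ.- + b ℤ.+ + b ≡ + a
      eq₁ = ℤS.solve 2 (λ a b → a ℤS.:- b ℤS.:+ b ℤS.:= a) ≡.refl (+ a) (+ b)
      go : c ∈ ⟨π^ + a ℤ.- + b ⟩ ⊎ c - B ∈ ⟨π^ + a ℤ.- + b ⟩ → V (+ a) (c * (c - B))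
      go (inj₁ p) = ≡.subst (λ k → V k (c * (c - B))) eq₁
        (V-* Vc (V-- (V-≤ (b≤a-b a b a>2b) Vc) VB))
        where
        Vc : V (+ a ℤ.- + b) c
        Vc = Equivalence.to (⟨π^⟩⇔V (+ a ℤ.- + b)) p
      go (inj₂ p) = ≡.subst (λ k → V k (c * (c - B))) (≡.trans (ℤ.+-comm (+ b) (+ a ℤ.- + b)) eq₁)
        (V-* (V-cancelʳ (V-neg VB) (V-≤ (b≤a-b a b a>2b) Vc-B)) Vc-B)
        where
        Vc-B : V (+ a ℤ.- + b) (c - B)
        Vc-B = Equivalence.to (⟨π^⟩⇔V (+ a ℤ.- + b)) p

-- Inclusion and equality of the orders.

module Containment {κ ℓ} (F : NonArchimedeanLocalField κ ℓ)
  (π : NonArchimedeanLocalField.Carrier F)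
  (ord-π : NonArchimedeanLocalField.ord F π ≡ [ + 1 ]) where
  open NonArchimedeanLocalField F hiding (zero)
  open CubicAlgebra F
  open Uniformizer π ord-π
  open Valuation F
  open Powers π ord-π
  open Lattices F
  open StandardOrders F
  open Orders π ord-π
  open Conditions F
  open IntegerSolver commutativeRing
  private module ℤS = ℤSolver.+-*-Solver

  module _ (a′ b′ : ℕ) (c′ : Carrier) (a b : ℕ) (c : Carrier) where
    private
      δ : ℤ
      δ = + b ℤ.- + b′
      D B B′⁻ : Carrier
      D = π^ (ℤ.- δ)
      B = π^ (+ b)
      B′⁻ = π^ (ℤ.- (+ b′))

    -- Both cases of `ContainmentCondition` in one congruence: if `ord c ≥ a′` then `D * c` itself
    -- lies in `(π^(a′-δ))` and drops out.
    Contained : Set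
    Contained = a′ ℕ.≤ a × b′ ℕ.≤ b × V (+ a′ ℤ.- δ) (c′ - D * c)

    private
      D-unit : b′ ℕ.≤ b → D * (B′⁻ * B) ≈ 1#
      D-unit b′≤b = trans (*-cong (reflexive (≡.cong (λ i → π^ (ℤ.- i)) δ≡k)) B′⁻B)
        (trans (*-comm _ _) (π^-inverse k))
        where
        k = b ℕ.∸ b′
        δ≡k : δ ≡ + k
        δ≡k = ≡.trans (ℤ.m-n≡m⊖n b b′) (ℤ.⊖-≥ b′≤b)
        B′⁻B : B′⁻ * B ≈ π^ (+ k)
        B′⁻B = trans (*-congˡ (trans (reflexive (≡.cong (λ n → π^ (+ n))
          (≡.sym (ℕ.m+[n∸m]≡n b′≤b)))) (π^-+ b′ k)))
          (trans (sym (*-assoc _ _ _)) (trans (*-congʳ (trans (*-comm _ _) (π^-inverse b′)))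
            (*-identityˡ _)))

      shift : ℤ.- δ ℤ.+ + a′ ≡ + a′ ℤ.- δ
      shift = ℤ.+-comm (ℤ.- δ) (+ a′)

      scaled : b′ ℕ.≤ b → D * (c - 0# - c′ * (B′⁻ * (B - 0#))) ≈ - (c′ - D * c)
      scaled b′≤b = trans
        (solve 5 (λ d c c′ p q → d :* (c :- :0 :- c′ :* (p :* (q :- :0))) :=
          :- (c′ :* (d :* (p :* q)) :- d :* c)) refl D c c′ B′⁻ B)
        (-‿cong (+-congʳ (trans (*-congˡ (D-unit b′≤b)) (*-identityʳ c′))))

    -- The larger module contains `(0 , π^a , 0)` and `(0 , c , π^b)`. The `coord₁` of the first is
    -- `π^a`; that of the second is `c - c′ π^(b-b′)`, which is then multiplied by `D`. The last
    -- coordinate of the second yields `b′ ≤ b`.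
    ⊆⇒contained : 𝓞 a b c ⊆ 𝓞 a′ b′ c′ → Contained
    ⊆⇒contained sub =
      ℤ.drop‿+≤+ (V⇒≤ (ord-π^ (+ a)) (V-resp (solve 3
        (λ p c q → p :- :0 :- c :* (q :* (:0 :- :0)) := p) refl (π^ (+ a)) c′ B′⁻)
        (proj₁ (proj₂ g₁)))) ,
      b′≤b ,
      V-resp (solve 1 (λ x → :- (:- x) := x) refl _) (V-neg (V-resp (scaled b′≤b)
        (≡.subst (λ k → V k (D * (c - 0# - c′ * (B′⁻ * (B - 0#))))) shift
          (V-scale (ord-π^ (ℤ.- δ)) (proj₁ (proj₂ g₂))))))
      where
      g₁ : Coordinates a′ b′ c′ (gens a b c 1F)
      g₁ = ∈𝓞⇒ a′ b′ c′ (gens a b c 1F) (sub (gen∈ a b c 1F))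
      g₂ : Coordinates a′ b′ c′ (gens a b c 2F)
      g₂ = ∈𝓞⇒ a′ b′ c′ (gens a b c 2F) (sub (gen∈ a b c 2F))
      b′≤b : b′ ℕ.≤ b
      b′≤b = ℤ.drop‿+≤+ (V⇒≤ (ord-π^ (+ b)) (V-resp (solve 1 (λ q → q :- :0 := q) refl B)
        (proj₂ (proj₂ g₂))))

    contained⇒⊆ : Contained → 𝓞 a b c ⊆ 𝓞 a′ b′ c′
    contained⇒⊆ (a′≤a , b′≤b , p) {e} = IsModule.span⊆ (𝓞-isModule a′ b′ c′) {g = gens a b c} g∈ {e}
      where
      g₁ : Coordinates a′ b′ c′ (gens a b c 1F)
      g₁ = 0∈𝔬 ,
        V-resp (solve 3 (λ p c q → p := p :- :0 :- c :* (q :* (:0 :- :0))) refl (π^ (+ a)) c′ B′⁻)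
          (V-≤ (ℤ.+≤+ a′≤a) (ord⇒V (ord-π^ (+ a)))) ,
        V-resp (solve 0 (:0 := :0 :- :0) refl) V-0
      g₂ : Coordinates a′ b′ c′ (gens a b c 2F)
      g₂ = 0∈𝔬 ,
        V-unscale (ord-π^ (ℤ.- δ)) (≡.subst (λ k → V k (D * (c - 0# - c′ * (B′⁻ * (B - 0#)))))
          (≡.sym shift) (V-resp (sym (scaled b′≤b)) (V-neg p))) ,
        V-resp (solve 1 (λ q → q := q :- :0) refl B) (V-≤ (ℤ.+≤+ b′≤b) (ord⇒V (ord-π^ (+ b))))
      g∈ : ∀ i → gens a b c i ∈ 𝓞 a′ b′ c′
      g∈ 0F = gen∈ a′ b′ c′ 0F
      g∈ 1F = ∈𝓞⇐ a′ b′ c′ (gens a b c 1F) g₁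
      g∈ 2F = ∈𝓞⇐ a′ b′ c′ (gens a b c 2F) g₂

    private
      VDc : [ + a′ ] ≤⁺ ord c → V (+ a′ ℤ.- δ) (D * c)
      VDc p = ≡.subst (λ k → V k (D * c)) shift (V-scale (ord-π^ (ℤ.- δ)) p)

    contained⇒condition : Contained → ContainmentCondition a′ b′ c′ a b c
    contained⇒condition (a′≤a , b′≤b , p) = a′≤a , b′≤b ,
      (λ q → Equivalence.from (⟨π^⟩⇔V (+ a′ ℤ.- δ)) (V-cancelʳ (V-neg (VDc q)) p)) ,
      (λ _ → Equivalence.from (⟨π^⟩⇔V (+ a′ ℤ.- δ)) p)

    condition⇒contained : ContainmentCondition a′ b′ c′ a b c → Contained
    condition⇒contained (a′≤a , b′≤b , large , small) = a′≤a , b′≤b , go (V? (+ a′) c)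
      where
      go : Dec (V (+ a′) c) → V (+ a′ ℤ.- δ) (c′ - D * c)
      go (yes p) = V-- (Equivalence.to (⟨π^⟩⇔V (+ a′ ℤ.- δ)) (large p)) (VDc p)
      go (no ¬p) = Equivalence.to (⟨π^⟩⇔V (+ a′ ℤ.- δ)) (small (≰⇒>⁺ (ord c) ¬p))
        where
        ≰⇒>⁺ : ∀ u → ¬ [ + a′ ] ≤⁺ u → u <⁺ [ + a′ ]
        ≰⇒>⁺ ⊤⁺ q = contradiction (_ ≤⊤⁺) q
        ≰⇒>⁺ [ k ] q = <⁺.[ ℤ.≰⇒> (q ∘ ≤⁺.[_]) ]

    contained⇒ord : Contained → ∀ {n} → ord c ≡ [ n ] → n ℤ.< + a′ → ord c′ ≡ [ n ℤ.- δ ]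
    contained⇒ord (_ , _ , p) {n} eq n<a′ =
      ≡.trans (ord-cong (solve 2 (λ x y → x := y :+ (x :- y)) refl c′ (D * c)))
        (ord-+ˡ ord-Dc (V-≤ (ℤ.i<j⇒suc[i]≤j (<-from n<a′
          (ℤS.solve 3 (λ a d n → a ℤS.:- d ℤS.:- (n ℤS.:- d) ℤS.:= a ℤS.:- n) ≡.refl (+ a′) δ n)))
          p))
      where
      ord-Dc : ord (D * c) ≡ [ n ℤ.- δ ]
      ord-Dc = ≡.trans (ord-*-≡ (ord-π^ (ℤ.- δ)) eq) (≡.cong [_] (ℤ.+-comm (ℤ.- δ) n))

    contained⇒halfBound : Contained → OrderCondition a′ b′ c′ → ord c <⁺ [ + a′ ] →
      (a′ ℕ.≤ 2 ℕ.* b′ → [ + ⌈ a′ /2⌉ ] ≤⁺ ord c -⁺ δ × ord c -⁺ δ ≡ ord c′) ×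
        (a′ ℕ.> 2 ℕ.* b′ → a′ ℕ.> b)
    contained⇒halfBound contained (small , large) ord<a′ = go (ord c) ≡.refl ord<a′
      where
      go : ∀ u → ord c ≡ u → u <⁺ [ + a′ ] →
        (a′ ℕ.≤ 2 ℕ.* b′ → [ + ⌈ a′ /2⌉ ] ≤⁺ ord c -⁺ δ × ord c -⁺ δ ≡ ord c′) ×
          (a′ ℕ.> 2 ℕ.* b′ → a′ ℕ.> b)
      go [ n ] eq <⁺.[ n<a′ ] =
        (λ a′≤2b′ → ≡.subst ([ + ⌈ a′ /2⌉ ] ≤⁺_) (≡.sym eq′)
          (Equivalence.to (⟨π^⟩⇔V (+ ⌈ a′ /2⌉)) (small a′≤2b′)) , eq′) ,
        (λ a′>2b′ → bound a′>2b′ (large a′>2b′))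
        where
        ord-c′ : ord c′ ≡ [ n ℤ.- δ ]
        ord-c′ = contained⇒ord contained eq n<a′
        eq′ : ord c -⁺ δ ≡ ord c′
        eq′ = ≡.trans (≡.cong (_-⁺ δ) eq) (≡.sym ord-c′)
        bound : a′ ℕ.> 2 ℕ.* b′ → c′ ∈ ⟨π^ + a′ ℤ.- + b′ ⟩ ⊎ c′ - π^ (+ b′) ∈ ⟨π^ + a′ ℤ.- + b′ ⟩ →
          a′ ℕ.> b
        -- `n - δ = ord c′ ≥ a′ - b′ ≥ b′` gives `n ≥ b`, and `n < a′`.
        bound a′>2b′ (inj₁ q) = ℤ.drop‿+<+ (ℤ.≤-<-trans b≤n n<a′)
          where
          a′-b′≤n-δ : + a′ ℤ.- + b′ ℤ.≤ n ℤ.- δ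
          a′-b′≤n-δ = V⇒≤ ord-c′ (Equivalence.to (⟨π^⟩⇔V (+ a′ ℤ.- + b′)) q)
          b≤n : + b ℤ.≤ n
          b≤n = ≤-from (ℤ.≤-trans (b≤a-b π ord-π a′ b′ a′>2b′) a′-b′≤n-δ)
            (ℤS.solve 3 (λ n b b′ → n ℤS.:- b ℤS.:= n ℤS.:- (b ℤS.:- b′) ℤS.:- b′) ≡.refl n (+ b)
              (+ b′))
        -- Here `a′ - b′ > b′` forces `ord c′ = b′`, so `n - δ = b′`, that is `n = b`.
        bound a′>2b′ (inj₂ q) = ℤ.drop‿+<+ (≡.subst (ℤ._< + a′) n≡b n<a′)
          where
          B′ = π^ (+ b′)
          2b′<a′ : + b′ ℤ.< + a′ ℤ.- + b′
          2b′<a′ = <-from (ℤ.+<+ (≡.subst (ℕ._< a′) (2*n≡n+n b′) a′>2b′))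
            (ℤS.solve 2 (λ a b → a ℤS.:- b ℤS.:- b ℤS.:= a ℤS.:- (b ℤS.:+ b)) ≡.refl (+ a′) (+ b′))
          ord-c′-b′ : ord c′ ≡ [ + b′ ]
          ord-c′-b′ = ≡.trans (ord-cong (solve 2 (λ x y → x := y :+ (x :- y)) refl c′ B′))
            (ord-+ˡ (ord-π^ (+ b′)) (V-≤ (ℤ.i<j⇒suc[i]≤j 2b′<a′)
              (Equivalence.to (⟨π^⟩⇔V (+ a′ ℤ.- + b′)) q)))
          n≡b : n ≡ + b
          n≡b = ≡.trans (ℤS.solve 3 (λ n b b′ → n ℤS.:= n ℤS.:- (b ℤS.:- b′) ℤS.:+ (b ℤS.:- b′))
            ≡.refl n (+ b) (+ b′))
            (≡.trans (≡.cong (ℤ._+ (+ b ℤ.- + b′))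
              ([]-injective (≡.trans (≡.sym ord-c′) ord-c′-b′)))
              (ℤS.solve 2 (λ b b′ → b′ ℤS.:+ (b ℤS.:- b′) ℤS.:= b) ≡.refl (+ b) (+ b′)))

  private
    shift₀ : ∀ a b → + a ℤ.- (+ b ℤ.- + b) ≡ + a
    shift₀ a b = ℤS.solve 2 (λ a b → a ℤS.:- (b ℤS.:- b) ℤS.:= a) ≡.refl (+ a) (+ b)

    unit₀ : ∀ b c → (π^ (ℤ.- (+ b ℤ.- + b))) * c ≈ c
    unit₀ b c = trans (*-congʳ (reflexive (≡.cong (λ i → π^ (ℤ.- i)) (ℤ.+-inverseʳ (+ b)))))
      (*-identityˡ c)

  contained-antisym : ∀ {a′ b′ c′ a b c} → Contained a′ b′ c′ a b c → Contained a b c a′ b′ c′ →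
    a ≡ a′ × b ≡ b′ × c - c′ ∈ ⟨π^ + a ⟩
  contained-antisym {a′} {b′} {c′} {a} {b} {c} (a′≤a , b′≤b , p) (a≤a′ , b≤b′ , _) =
    ℕ.≤-antisym a≤a′ a′≤a , ℕ.≤-antisym b≤b′ b′≤b ,
    Equivalence.from (⟨π^⟩⇔V (+ a)) (congruence (ℕ.≤-antisym a≤a′ a′≤a) (ℕ.≤-antisym b≤b′ b′≤b) p)
    where
    congruence : ∀ {a′ b′ a b} → a ≡ a′ → b ≡ b′ →
      V (+ a′ ℤ.- (+ b ℤ.- + b′)) (c′ - (π^ (ℤ.- (+ b ℤ.- + b′))) * c) → V (+ a) (c - c′)
    congruence {a = a} {b = b} ≡.refl ≡.refl p = V-resp
      (trans (-‿cong (+-congˡ (-‿cong (unit₀ b c))))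
        (solve 2 (λ c c′ → :- (c′ :- c) := c :- c′) refl c c′))
      (V-neg (≡.subst (λ k → V k (c′ - (π^ (ℤ.- (+ b ℤ.- + b))) * c)) (shift₀ a b) p))

  congruent⇒⊆ : ∀ a b {c c′} → c - c′ ∈ ⟨π^ + a ⟩ → 𝓞 a b c ⊆ 𝓞 a b c′
  congruent⇒⊆ a b {c} {c′} p {e} = contained⇒⊆ a b c′ a b c (ℕ.≤-refl , ℕ.≤-refl , Vc) {e}
    where
    Vc : V (+ a ℤ.- (+ b ℤ.- + b)) (c′ - (π^ (ℤ.- (+ b ℤ.- + b))) * c)
    Vc = ≡.subst (λ k → V k (c′ - (π^ (ℤ.- (+ b ℤ.- + b))) * c)) (≡.sym (shift₀ a b))
      (V-resp (trans (solve 2 (λ c c′ → :- (c :- c′) := c′ :- c) refl c c′)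
        (+-congˡ (-‿cong (sym (unit₀ b c)))))
        (V-neg (Equivalence.to (⟨π^⟩⇔V (+ a)) p)))

  module _ (a′ b′ : ℕ) (c′ : Carrier) (a b : ℕ) (c : Carrier) where

    ⊆⇒condition : 𝓞 a b c ⊆ 𝓞 a′ b′ c′ → ContainmentCondition a′ b′ c′ a b c
    ⊆⇒condition sub = contained⇒condition a′ b′ c′ a b c
      (⊆⇒contained a′ b′ c′ a b c (λ {e} → sub {e}))

    condition⇒⊆ : ContainmentCondition a′ b′ c′ a b c → 𝓞 a b c ⊆ 𝓞 a′ b′ c′
    condition⇒⊆ cond {e} = contained⇒⊆ a′ b′ c′ a b c (condition⇒contained a′ b′ c′ a b c cond) {e}

    ⊆⇒halfBound : OrderCondition a′ b′ c′ → 𝓞 a b c ⊆ 𝓞 a′ b′ c′ → ord c <⁺ [ + a′ ] →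
      (a′ ℕ.≤ 2 ℕ.* b′ → [ + ⌈ a′ /2⌉ ] ≤⁺ ord c -⁺ (+ b ℤ.- + b′) × ord c -⁺
        (+ b ℤ.- + b′) ≡ ord c′) × (a′ ℕ.> 2 ℕ.* b′ → a′ ℕ.> b)
    ⊆⇒halfBound cond sub = contained⇒halfBound a′ b′ c′ a b c
      (⊆⇒contained a′ b′ c′ a b c (λ {e} → sub {e})) cond

    equal⇒ : 𝓞 a′ b′ c′ ≐ 𝓞 a b c → a ≡ a′ × b ≡ b′ × c - c′ ∈ ⟨π^ + a ⟩
    equal⇒ (sub , sup) = contained-antisym {a′} {b′} {c′} {a} {b} {c}
      (⊆⇒contained a′ b′ c′ a b c sup) (⊆⇒contained a b c a′ b′ c′ sub)

    equal⇐ : a ≡ a′ × b ≡ b′ × c - c′ ∈ ⟨π^ + a ⟩ → 𝓞 a′ b′ c′ ≐ 𝓞 a b c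
    equal⇐ (≡.refl , ≡.refl , p) = congruent⇒⊆ a b p′ , congruent⇒⊆ a b p
      where
      p′ : c′ - c ∈ ⟨π^ + a ⟩
      p′ = Equivalence.from (⟨π^⟩⇔V (+ a)) (V-resp
        (solve 2 (λ x y → :- (x :- y) := y :- x) refl c c′)
        (V-neg (Equivalence.to (⟨π^⟩⇔V (+ a)) p)))

-- Normal form of an arbitrary order.

module Normalisation {κ ℓ} (F : NonArchimedeanLocalField κ ℓ)
  (π : NonArchimedeanLocalField.Carrier F)
  (ord-π : NonArchimedeanLocalField.ord F π ≡ [ + 1 ]) where
  open NonArchimedeanLocalField F hiding (zero)
  open CubicAlgebra F
  open Uniformizer π ord-π
  open Valuation F
  open Powers π ord-π
  open Lattices F
  open Adjunction F
  open Denominators π ord-π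
  open StandardOrders F
  open Orders π ord-π
  open Conditions F
  open IntegerSolver commutativeRing
  open Exp commutativeSemiring using (_^_)

  V∙-isModule : ∀ n f → IsModule (λ e → V n (e ∙ f))
  V∙-isModule n f = record
    { resp = λ {x} {y} x≈y → V-resp (∙-congʳ {x} {y} {f} x≈y)
    ; 0∈ = V-resp (sym (trans (∙-comm E.0# f) (∙-0ʳ f))) V-0
    ; +∈ = λ {x} {y} p q → V-resp (sym (∙-+ˡ x y f)) (V-+ p q)
    ; *∈ = λ {r} {x} r∈ p → V-resp (sym (∙-Δˡ r x f)) (V-*ˡ r∈ p)
    }

  order-isModule : ∀ {O} → IsOrder O → IsModule O
  order-isModule isOrder = record
    { resp = O.resp ; 0∈ = O.0∈ ; +∈ = O.+∈ ; *∈ = λ r∈ x∈ → O.*∈ (O.Δ𝔬⊆ r∈) x∈ }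
    where module O = IsOrder isOrder

  -- A linear form on `O` attains its least valuation at a generator. It cannot vanish on `O`,
  -- because a multiple `π^N w` of the given witness lies in `O`. The least valuations of two such
  -- forms are the exponents `b` and `a` of the normal form.
  leastValue : ∀ {O} → IsOrder O → ∀ f {w} → w ∙ f ≉ 0# →
    ∃₂ λ n e → e ∈ O × ord (e ∙ f) ≡ [ n ] × (∀ {e′} → e′ ∈ O → V n (e′ ∙ f))
  leastValue {O} isOrder f {w} w∙f≉0 with IsOrder.finite isOrder
  ... | k , g , O⊆ , ⊆O = result (argmin (λ i → g₀ i ∙ f))
    where
    module O = IsOrder isOrder
    g₀ : Vector E.Carrier (suc k)
    -- `argmin` needs a nonempty family, and the number of generators could be 0; the added zero
    -- vector can be least only if the form vanishes on all of them.
    g₀ = E.0# ∷ g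
    g₀∈ : ∀ i → g₀ i ∈ O
    g₀∈ zero    = O.0∈
    g₀∈ (suc i) = ⊆O (gen∈span g i)
    all : ∀ n → (∀ i → V n (g₀ i ∙ f)) → ∀ {e} → e ∈ O → V n (e ∙ f)
    all n p {e} e∈ = IsModule.span⊆ (V∙-isModule n f) {g = g} (p ∘ suc) {e} (O⊆ e∈)
    result : (∃ λ i → ∀ j → ord (g₀ i ∙ f) ≤⁺ ord (g₀ j ∙ f)) →
      ∃₂ λ n e → e ∈ O × ord (e ∙ f) ≡ [ n ] × (∀ {e′} → e′ ∈ O → V n (e′ ∙ f))
    result (i , min) with (g₀ i ∙ f) ≈0?
    ... | no ≉0 =
      let n , eq = ≉0⇒ord ≉0 in
      n , g₀ i , g₀∈ i , eq , λ {e} → all n (λ j → ≤⁺-trans (ord⇒V eq) (min j)) {e}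
    ... | yes ≈0 =
      let N , w∈ = clearDenominators (order-isModule isOrder) O.spans w
          m , eq = ≉0⇒ord w∙f≉0
          p = all (ℤ.suc (+ N ℤ.+ m)) (λ j → ≤⁺-trans (V-resp (sym ≈0) V-0) (min j)) w∈
      in contradiction (V⇒≤ (≡.trans (ord-cong (∙-Δˡ (π^ (+ N)) w f)) (ord-*-≡ (ord-π^ (+ N)) eq))
        p)
           (ℤ.<⇒≱ (ℤ.suc[i]≤j⇒i<j ℤ.≤-refl))

  -- If `ord x ≤ -1`, then `x ^ (N + 1)` has valuation below `- N`.
  bounded-powers⇒𝔬 : ∀ {x} N → (∀ k → V (ℤ.- (+ N)) (x ^ k)) → x ∈ 𝔬
  bounded-powers⇒𝔬 {x} N p with V? (+ 0) x
  ... | yes q = q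
  ... | no ¬q with ¬V⇒ord ¬q
  ...   | -[1+ i ] , eq , _ = contradiction (V⇒≤ (ord-^ (suc N) eq) (p (suc N)))
          (ℤ.<⇒≱ N<)
    where
    N< : + suc N ℤ.* -[1+ i ] ℤ.< ℤ.- (+ N)
    N< = ℤ.≤-<-trans (ℤ.*-monoˡ-≤-nonNeg (+ suc N) (ℤ.-≤- (ℕ.z≤n {i})))
      (≡.subst (ℤ._< ℤ.- (+ N)) (≡.sym (≡.trans (ℤ.*-comm (+ suc N) -[1+ 0 ])
        (ℤ.-1*i≡-i (+ suc N)))) (ℤ.neg-mono-< (ℤ.+<+ (ℕ.n<1+n N))))
  ...   | + i , eq , ℤ.+<+ ()

  -- Elements of an order are integral: all powers of `e` lie in one finitely generated module, so
  -- the denominators of their coordinates are bounded.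
  order⊆𝓞ᴱ : ∀ {O} → IsOrder O → O ⊆ 𝓞ᴱ
  order⊆𝓞ᴱ {O} isOrder {x , y , z} e∈ with IsOrder.finite isOrder
  ... | k , g , O⊆ , _ with V-bounded (λ i → g i .proj₁) | V-bounded
    (λ i → g i .proj₂ .proj₁) | V-bounded (λ i → g i .proj₂ .proj₂)
  ...   | N₀ , p₀ | N₁ , p₁ | N₂ , p₂ =
    bounded-powers⇒𝔬 N₀ (λ k → V-resp (∙-ε₀1 _) (bound N₀ (ε₀ 1#)
      (λ i → V-resp (sym (∙-ε₀1 (g i))) (p₀ i)) k)) ,
    bounded-powers⇒𝔬 N₁ (λ k → V-resp (∙-ε₁1 _) (bound N₁ (ε₁ 1#)
      (λ i → V-resp (sym (∙-ε₁1 (g i))) (p₁ i)) k)) ,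
    bounded-powers⇒𝔬 N₂ (λ k → V-resp (∙-ε₂1 _) (bound N₂ (ε₂ 1#) (λ i →
      V-resp (sym (∙-ε₂1 (g i))) (p₂ i)) k))
    where
    powers∈ : ∀ k → (x ^ k , y ^ k , z ^ k) ∈ O
    powers∈ zero    = IsOrder.1∈ isOrder
    powers∈ (suc k) = IsOrder.*∈ isOrder e∈ (powers∈ k)
    ∙-ε₀1 : ∀ e → e ∙ ε₀ 1# ≈ e .proj₁
    ∙-ε₀1 e = trans (∙-ε₀ e 1#) (*-identityʳ _)
    ∙-ε₁1 : ∀ e → e ∙ ε₁ 1# ≈ e .proj₂ .proj₁
    ∙-ε₁1 e = trans (∙-ε₁ e 1#) (*-identityʳ _)
    ∙-ε₂1 : ∀ e → e ∙ ε₂ 1# ≈ e .proj₂ .proj₂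
    ∙-ε₂1 e = trans (∙-ε₂ e 1#) (*-identityʳ _)
    bound : ∀ N f → (∀ i → V (ℤ.- (+ N)) (g i ∙ f)) → ∀ k →
      V (ℤ.- (+ N)) ((x ^ k , y ^ k , z ^ k) ∙ f)
    bound N f p k = IsModule.span⊆ (V∙-isModule (ℤ.- (+ N)) f) {g = g} p {x ^ k , y ^ k , z ^ k}
      (O⊆ (powers∈ k))

  contains-gens⇒≐ : ∀ {O} → IsOrder O → ∀ a b {c} →
    gens a b c 1F ∈ O → gens a b c 2F ∈ O → (∀ {e} → e ∈ O → Coordinates a b c e) →
    c ∈ 𝔬 × OrderCondition a b c × O ≐ 𝓞 a b c
  contains-gens⇒≐ {O} isOrder a b {c} g₁∈ g₂∈ coordinates =
    c∈𝔬 ,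
    ring⇒condition π ord-π a b c∈𝔬 (square∈𝓞⇒ a b c (O⊆ (IsOrder.*∈ isOrder g₂∈ g₂∈))) ,
    O⊆ , IsModule.span⊆ (order-isModule isOrder) {g = gens a b c} g∈
    where
    c∈𝔬 : c ∈ 𝔬
    c∈𝔬 = proj₁ (proj₂ (order⊆𝓞ᴱ isOrder g₂∈))
    O⊆ : O ⊆ 𝓞 a b c
    O⊆ {e} e∈ = ∈𝓞⇐ a b c e (coordinates e∈)
    g∈ : ∀ i → gens a b c i ∈ O
    g∈ 0F = IsOrder.1∈ isOrder
    g∈ 1F = g₁∈
    g∈ 2F = g₂∈

  module _ {O : Subset} (isOrder : IsOrder O) where
    private
      module O = IsOrder isOrder
      Om = order-isModule isOrder
      nonneg : ∀ {x n} → ord x ≡ [ n ] → x ∈ 𝔬 → ∃ λ a → n ≡ + a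
      nonneg {n = + a} eq p = a , ≡.refl
      nonneg {n = -[1+ a ]} eq p = contradiction (V⇒≤ eq p) λ ()
      rescale : ∀ {x n} → ord x ≡ [ n ] → ∃ λ u → u ∈ 𝔬 × u * x ≈ π^ n
      rescale {x} {n} eq = let x⁻ , xx⁻≈1 , p = inverse-ord eq in
        (π^ n) * x⁻ ,
        ≡.subst (λ k → V k ((π^ n) * x⁻)) (ℤ.+-inverseʳ n) (V-* (ord⇒V (ord-π^ n)) (ord⇒V p)) ,
        trans (*-assoc _ x⁻ x) (trans (*-congˡ (trans (*-comm x⁻ x) xx⁻≈1)) (*-identityʳ _))

      minus-first : ∀ {e} → e ∈ O → e E.- Δ (proj₁ e) ∈ O
      minus-first {e} e∈ = O.+∈ e∈ (O.-∈ (O.Δ𝔬⊆ (proj₁ (order⊆𝓞ᴱ isOrder {e} e∈))))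

    LastGenerator : Set (κ ⊔ ℓ)
    LastGenerator = ∃₂ λ b c → gens 0 b c 2F ∈ O ×
      (∀ {e} → e ∈ O → V (+ b) (e .proj₂ .proj₂ - e .proj₁))

    lastGenerator : LastGenerator
    -- `dualGens 0 0 0# 2F` is `(- 1 , 0 , 1)`, the form `z - x`. Subtracting `Δ x` from a
    -- minimizing element and scaling by a unit turn it into `(0 , c , π^b)`.
    lastGenerator = step (leastValue isOrder (dualGens 0 0 0# 2F) {ε₂ 1#} nonzero)
      where
      simplify : ∀ e → e ∙ dualGens 0 0 0# 2F ≈ e .proj₂ .proj₂ - e .proj₁
      simplify e = trans (∙-dual₂ 0 0 0# e) (*-identityˡ _)
      nonzero : ε₂ 1# ∙ dualGens 0 0 0# 2F ≉ 0#
      nonzero p = 1≉0 (trans (sym (trans (simplify (ε₂ 1#)) (solve 0 (:1 :- :0 := :1) refl))) p)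
      step : (∃₂ λ n e → e ∈ O × ord (e ∙ dualGens 0 0 0# 2F) ≡ [ n ] ×
        (∀ {e′} → e′ ∈ O → V n (e′ ∙ dualGens 0 0 0# 2F))) →
        LastGenerator
      step (n , e@(x , y , z) , e∈ , eq , min) =
        found (nonneg eq′ (proj₂ (proj₂ (order⊆𝓞ᴱ isOrder {e E.- Δ x} (minus-first e∈)))))
          (rescale eq′)
        where
        eq′ : ord (z - x) ≡ [ n ]
        eq′ = ≡.trans (≡.sym (ord-cong (simplify e))) eq
        found : (∃ λ b → n ≡ + b) → (∃ λ u → u ∈ 𝔬 × u * (z - x) ≈ π^ n) → LastGenerator
        found (b , n≡b) (u , u∈𝔬 , uz≈) = b , u * (y - x) ,
          O.resp (trans (*-congˡ (-‿inverseʳ x)) (zeroʳ u) , refl ,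
            trans uz≈ (reflexive (≡.cong π^_ n≡b))) (IsModule.*∈ Om u∈𝔬 (minus-first e∈)) ,
          (λ {e} e∈ → V-resp (simplify e) (≡.subst (λ n → V n (e ∙ dualGens 0 0 0# 2F)) n≡b
            (min e∈)))

    Normalised : Set (κ ⊔ ℓ)
    Normalised = ∃ λ a → ∃ λ b → ∃ λ c → c ∈ 𝔬 × OrderCondition a b c × O ≐ 𝓞 a b c

    normalise : Normalised
    normalise = step lastGenerator
      where
      step : LastGenerator → Normalised
      -- `dualGens 0 b c 1F` is the form `coord₁`, which kills `(1 , 1 , 1)` and `(0 , c , π^b)`;
      -- reducing a minimizing element by these two leaves `(0 , w , 0)` in `O`.
      step (b , c , h∈ , minz) = middle (leastValue isOrder (dualGens 0 b c 1F) {ε₁ 1#} nonzero)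
        where
        B⁻ = π^ (ℤ.- (+ b))
        simplify : ∀ e → e ∙ dualGens 0 b c 1F ≈ coord₁ 0 b c e
        simplify e = trans (∙-dual₁ 0 b c e) (*-identityˡ _)
        nonzero : ε₁ 1# ∙ dualGens 0 b c 1F ≉ 0#
        nonzero p = 1≉0 (trans (sym (trans (simplify (ε₁ 1#))
          (solve 2 (λ c q → :1 :- :0 :- c :* (q :* (:0 :- :0)) := :1) refl c B⁻))) p)
        middle : (∃₂ λ n e → e ∈ O × ord (e ∙ dualGens 0 b c 1F) ≡ [ n ] ×
          (∀ {e′} → e′ ∈ O → V n (e′ ∙ dualGens 0 b c 1F))) →
          Normalised
        middle (n , e@(x , y , z) , e∈ , eq , min) =
          found (nonneg eq′ (proj₁ (proj₂ (order⊆𝓞ᴱ isOrder {0# , w , 0#} w∈O)))) (rescale eq′)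
          where
          w : Carrier
          w = coord₁ 0 b c e
          eq′ : ord w ≡ [ n ]
          eq′ = ≡.trans (≡.sym (ord-cong (simplify e))) eq
          s : Carrier
          s = B⁻ * (z - x)
          s∈𝔬 : s ∈ 𝔬
          s∈𝔬 = Equivalence.to (V⇔𝔬 b (z - x)) (minz e∈)
          w∈O : (0# , w , 0#) ∈ O
          w∈O = O.resp
            ( solve 2 (λ x s → x :- x :- s :* :0 := :0) refl x s
            , solve 4 (λ x y s c → y :- x :- s :* c := y :- x :- c :* s) refl x y s c
            , trans (+-congˡ (-‿cong (trans (solve 3 (λ d p q → p :* d :* q := q :* p :* d) refl
              (z - x) B⁻ (π^ (+ b))) (trans (*-congʳ (π^-inverse b)) (*-identityˡ _)))))
              (-‿inverseʳ (z - x)))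
            (O.+∈ (minus-first e∈) (O.-∈ (IsModule.*∈ Om s∈𝔬 h∈)))
          found : (∃ λ a → n ≡ + a) → (∃ λ u → u ∈ 𝔬 × u * w ≈ π^ n) → Normalised
          found (a , n≡a) (u , u∈𝔬 , uw≈) =
            a , b , c , contains-gens⇒≐ isOrder a b
              (O.resp (zeroʳ u , trans uw≈ (reflexive (≡.cong π^_ n≡a)) , zeroʳ u)
                (IsModule.*∈ Om u∈𝔬 w∈O)) h∈
              (λ {e} e∈ → proj₁ (order⊆𝓞ᴱ isOrder {e} e∈) ,
                V-resp (simplify e) (≡.subst (λ n → V n (e ∙ dualGens 0 b c 1F)) n≡a (min e∈)) ,
                  minz e∈)

-- Conductor and length.

module ConductorAndLength {κ ℓ} (F : NonArchimedeanLocalField κ ℓ)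
  (π : NonArchimedeanLocalField.Carrier F)
  (ord-π : NonArchimedeanLocalField.ord F π ≡ [ + 1 ]) where
  open NonArchimedeanLocalField F hiding (zero)
  open CubicAlgebra F
  open Uniformizer π ord-π
  open Valuation F
  open Powers π ord-π
  open Lattices F
  open Adjunction F
  open StandardOrders F
  open Orders π ord-π
  open Conditions F
  open IntegerSolver commutativeRing
  private module ℤS = ℤSolver.+-*-Solver

  -- Together with `V-max⇐` this decodes the conductor exponents: `x ∈ (π^max(m , s - ord t))` means
  -- `x ∈ (π^m)` and `t x ∈ (π^s)`. For `t = 0` the second condition is void, in agreement with
  -- `s - ∞ = - ∞`.
  V-max⇒ : ∀ {m s} t {x} → V max[ m , s - ord t ] x → V m x × V s (t * x)
  V-max⇒ {m} {s} t {x} = go (ord t) ≡.refl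
    where
    go : ∀ u → ord t ≡ u → V max[ m , s - u ] x → V m x × V s (t * x)
    go ⊤⁺ eq p = p , V-resp (sym (trans (*-congʳ (Equivalence.to (ord≡∞⇔≈0 t) eq)) (zeroˡ x))) V-0
    go [ n ] eq p = V-≤ (ℤ.i≤i⊔j m (s ℤ.- n)) p ,
      ≡.subst (λ k → V k (t * x)) (ℤS.solve 2 (λ n s → n ℤS.:+ (s ℤS.:- n) ℤS.:= s) ≡.refl n s)
        (V-scale eq (V-≤ (ℤ.i≤j⊔i m (s ℤ.- n)) p))

  V-max⇐ : ∀ {m s} t {x} → V m x → V s (t * x) → V max[ m , s - ord t ] x
  V-max⇐ {m} {s} t {x} p q = go (ord t) ≡.refl
    where
    go : ∀ u → ord t ≡ u → V max[ m , s - u ] x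
    go ⊤⁺ eq = p
    go [ n ] eq = go⊔ (ℤ.⊔-sel m (s ℤ.- n))
      where
      go⊔ : m ℤ.⊔ (s ℤ.- n) ≡ m ⊎ m ℤ.⊔ (s ℤ.- n) ≡ s ℤ.- n → V (m ℤ.⊔ (s ℤ.- n)) x
      go⊔ (inj₁ eq′) = ≡.subst (λ k → V k x) (≡.sym eq′) p
      go⊔ (inj₂ eq′) = ≡.subst (λ k → V k x) (≡.sym eq′) (V-unscale eq
        (≡.subst (λ k → V k (t * x)) (≡.sym (ℤS.solve 2
          (λ n s → n ℤS.:+ (s ℤS.:- n) ℤS.:= s) ≡.refl n s)) q))

  max-absorb : ∀ {s} m u → [ s ℤ.- m ] ≤⁺ u → max[ m , s - u ] ≡ m
  max-absorb m ⊤⁺ _ = ≡.refl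
  max-absorb {s} m [ n ] ≤⁺.[ p ] = ℤ.i≥j⇒i⊔j≡i (≤-from p
    (ℤS.solve 3 (λ m s n → m ℤS.:- (s ℤS.:- n) ℤS.:= n ℤS.:- (s ℤS.:- m)) ≡.refl m s n))

  max-exceed : ∀ {s} m {u} n → u ≡ [ n ] → n ℤ.≤ s ℤ.- m → max[ m , s - u ] ≡ s ℤ.- n
  max-exceed {s} m n ≡.refl p = ℤ.i≤j⇒i⊔j≡j (≤-from p
    (ℤS.solve 3 (λ m s n → s ℤS.:- n ℤS.:- m ℤS.:= s ℤS.:- m ℤS.:- n) ≡.refl m s n))

  module _ (a b : ℕ) (c : Carrier) where
    private
      B B⁻ : Carrier
      B = π^ (+ b)
      B⁻ = π^ (ℤ.- (+ b))
      a+b-b : + (a ℕ.+ b) ℤ.- + b ≡ + a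
      a+b-b = ℤS.solve 2 (λ a b → a ℤS.:+ b ℤS.:- b ℤS.:= a) ≡.refl (+ a) (+ b)
      V-descend : ∀ {t} → V (+ (a ℕ.+ b)) t → V (+ a) (B⁻ * t)
      V-descend {t} p = ≡.subst (λ k → V k (B⁻ * t))
        (≡.trans (ℤ.+-comm (ℤ.- (+ b)) (+ (a ℕ.+ b))) a+b-b) (V-scale (ord-π^ (ℤ.- (+ b))) p)
      V-ascend : ∀ {t} → V (+ a) (B⁻ * t) → V (+ (a ℕ.+ b)) t
      V-ascend {t} p = V-unscale (ord-π^ (ℤ.- (+ b)))
        (≡.subst (λ k → V k (B⁻ * t)) (≡.sym (≡.trans (ℤ.+-comm (ℤ.- (+ b)) (+ (a ℕ.+ b))) a+b-b))
        p)
      f₁ f₃ : ℤ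
      f₁ = max[ + b , + (a ℕ.+ b) - ord (c - B) ]
      f₃ = max[ + b , + (a ℕ.+ b) - ord c ]
      B⁻c-B : ∀ x → B⁻ * ((c - B) * x) ≈ B⁻ * c * x - x
      B⁻c-B x = trans (solve 4 (λ c p q x → q :* ((c :- p) :* x) := q :* c :* x :- p :* q :* x) refl
        c B B⁻ x)
        (+-congˡ (-‿cong (trans (*-congʳ (π^-inverse b)) (*-identityˡ x))))

    -- Multiply by the three idempotents: `coord₁ (x , 0 , 0) = (c - π^b) x / π^b`,
    -- `coord₁ (0 , y , 0) = y` and `coord₁ (0 , 0 , z) = - c z / π^b` must lie in `(π^a)`, while
    -- the last coordinate puts `x` and `z` into `(π^b)`.
    conductor⊆ : conductor (𝓞 a b c) ⊆ (⟨π^ f₁ ⟩ ⟨×⟩ ⟨π^ + a ⟩ ⟨×⟩ ⟨π^ f₃ ⟩)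
    conductor⊆ {e@(x , y , z)} (_ , mult) =
      Equivalence.from (⟨π^⟩⇔V f₁) (V-max⇐ {+ b} {+ (a ℕ.+ b)} (c - B)
        (V-resp (solve 2 (λ x z → :- (z :* :0 :- x :* :1) := x) refl x z)
          (V-neg (proj₂ (proj₂ g₀))))
        (V-ascend (V-resp (trans (solve 5 (λ x y z c q →
          y :* :0 :- x :* :1 :- c :* (q :* (z :* :0 :- x :* :1)) := q :* c :* x :- x) refl x y z c
          B⁻) (sym (B⁻c-B x)))
          (proj₁ (proj₂ g₀))))) ,
      Equivalence.from (⟨π^⟩⇔V (+ a)) (V-resp (solve 5
        (λ x y z c q → y :* :1 :- x :* :0 :- c :* (q :* (z :* :0 :- x :* :0)) := y) refl x y z c B⁻)
        (proj₁ (proj₂ g₁))) ,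
      Equivalence.from (⟨π^⟩⇔V f₃) (V-max⇐ {+ b} {+ (a ℕ.+ b)} c
        (V-resp (solve 2 (λ x z → z :* :1 :- x :* :0 := z) refl x z) (proj₂ (proj₂ g₂)))
        (V-ascend (V-resp (solve 5 (λ x y z c q → :- (y :* :0 :- x :* :0 :- c
          :* (q :* (z :* :1 :- x :* :0))) := q :* (c :* z)) refl x y z c B⁻)
          (V-neg (proj₁ (proj₂ g₂))))))
      where
      g₀ : Coordinates a b c (e E.* ε₀ 1#)
      g₀ = ∈𝓞⇒ a b c (e E.* ε₀ 1#) (mult (ε₀ 1#) (1∈𝔬 , 0∈𝔬 , 0∈𝔬))
      g₁ : Coordinates a b c (e E.* ε₁ 1#)
      g₁ = ∈𝓞⇒ a b c (e E.* ε₁ 1#) (mult (ε₁ 1#) (0∈𝔬 , 1∈𝔬 , 0∈𝔬))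
      g₂ : Coordinates a b c (e E.* ε₂ 1#)
      g₂ = ∈𝓞⇒ a b c (e E.* ε₂ 1#) (mult (ε₂ 1#) (0∈𝔬 , 0∈𝔬 , 1∈𝔬))

    ⊆conductor : (⟨π^ f₁ ⟩ ⟨×⟩ ⟨π^ + a ⟩ ⟨×⟩ ⟨π^ f₃ ⟩) ⊆ conductor (𝓞 a b c)
    ⊆conductor {x , y , z} (p , q , r) =
      (V-≤ (ℤ.+≤+ ℕ.z≤n) Vx , V-≤ (ℤ.+≤+ ℕ.z≤n) Vy , V-≤ (ℤ.+≤+ ℕ.z≤n) Vz) ,
      λ { (x′ , y′ , z′) (x′∈ , y′∈ , z′∈) → ∈𝓞⇐ a b c (x * x′ , y * y′ , z * z′)
        ( *∈𝔬 (V-≤ (ℤ.+≤+ ℕ.z≤n) Vx) x′∈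
        , V-resp (trans (+-congʳ (+-congˡ (*-congʳ (B⁻c-B x)))) (solve 8 (λ x y z x′ y′ z′ c q →
            y :* y′ :+ (q :* c :* x :- x) :* x′ :- q :* (c :* z) :* z′ :=
            y :* y′ :- x :* x′ :- c :* (q :* (z :* z′ :- x :* x′))) refl x y z x′ y′ z′ c B⁻))
          (V-- (V-+ (V-*ʳ Vy y′∈) (V-*ʳ (V-descend Vcx) x′∈)) (V-*ʳ (V-descend Vcz) z′∈))
        , V-- (V-*ʳ Vz z′∈) (V-*ʳ Vx x′∈)) }
      where
      Vx×Vcx : V (+ b) x × V (+ (a ℕ.+ b)) ((c - B) * x)
      Vx×Vcx = V-max⇒ {+ b} {+ (a ℕ.+ b)} (c - B) (Equivalence.to (⟨π^⟩⇔V f₁) p)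
      Vx = proj₁ Vx×Vcx
      Vcx = proj₂ Vx×Vcx
      Vz×Vcz : V (+ b) z × V (+ (a ℕ.+ b)) (c * z)
      Vz×Vcz = V-max⇒ {+ b} {+ (a ℕ.+ b)} c (Equivalence.to (⟨π^⟩⇔V f₃) r)
      Vz = proj₁ Vz×Vcz
      Vcz = proj₂ Vz×Vcz
      Vy : V (+ a) y
      Vy = Equivalence.to (⟨π^⟩⇔V (+ a)) q

    -- If `a ≤ b` then `c - π^b` lies in `(π^a)` and neither maximum exceeds `b`; if `a > b` then
    -- `ord (c - π^b) = b` and the first one is `a`.
    conductorExponents≥ : [ + a ] ≤⁺ ord c → f₁ ≡ + (a ℕ.⊔ b) × f₃ ≡ + b
    conductorExponents≥ p = first (a ℕ.≤? b) , absorb p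
      where
      absorb : ∀ {u} → [ + a ] ≤⁺ u → max[ + b , + (a ℕ.+ b) - u ] ≡ + b
      absorb {u} q = max-absorb {+ (a ℕ.+ b)} (+ b) u (≡.subst (λ k → [ k ] ≤⁺ u) (≡.sym a+b-b) q)
      first : Dec (a ℕ.≤ b) → f₁ ≡ + (a ℕ.⊔ b)
      first (yes a≤b) = ≡.trans (absorb (V-- p (V-≤ (ℤ.+≤+ a≤b) (ord⇒V (ord-π^ (+ b))))))
        (≡.cong +_ (≡.sym (ℕ.m≤n⇒m⊔n≡n a≤b)))
      first (no a≰b) = ≡.trans (max-exceed {+ (a ℕ.+ b)} (+ b) (+ b) ord-c-B
        (ℤ.≤-trans (ℤ.+≤+ (ℕ.<⇒≤ b<a)) (ℤ.≤-reflexive (≡.sym a+b-b))))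
        (≡.trans a+b-b (≡.cong +_ (≡.sym (ℕ.m≥n⇒m⊔n≡m (ℕ.<⇒≤ b<a)))))
        where
        b<a = ℕ.≰⇒> a≰b
        ord-c-B : ord (c - B) ≡ [ + b ]
        ord-c-B = ≡.trans (ord-cong (+-comm c (- B)))
          (ord-+ˡ (ord-neg (ord-π^ (+ b))) (V-≤ (ℤ.+≤+ b<a) p))

    conductorExponents< : ∀ n → ord c ≡ [ n ] → n ℤ.< + a → f₃ ≡ + (a ℕ.+ b) ℤ.- n
    conductorExponents< n eq n<a = max-exceed {+ (a ℕ.+ b)} (+ b) n eq
      (ℤ.≤-trans (ℤ.<⇒≤ n<a) (ℤ.≤-reflexive (≡.sym a+b-b)))

    det-gens : ord (det (gens a b c)) ≡ [ + (a ℕ.+ b) ]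
    det-gens = ≡.trans (ord-cong (solve 3 (λ p c q →
      :1 :* (p :* q :- :0 :* c) :- :1 :* (:0 :* q :- :0 :* :0) :+ :1 :* (:0 :* c :- p :* :0) :=
      p :* q) refl (π^ (+ a)) c B))
      (ord-*-≡ (ord-π^ (+ a)) (ord-π^ (+ b)))

  embed : ∀ {e} → e ∈ 𝓞ᴱ → LeftModule.Carrierᴹ 𝓞ᴱ-module
  embed {x , y , z} (p , q , r) = (x , p) , (y , q) , (z , r)

  forget : LeftModule.Carrierᴹ 𝓞ᴱ-module → E.Carrier
  forget ((x , _) , (y , _) , (z , _)) = x , y , z

  module _ {O : Subset} (isOrder : IsOrder O) where
    private module O = IsOrder isOrder

    Underlying : ∀ {p} → Pred (LeftModule.Carrierᴹ 𝓞ᴱ-module) p → Pred E.Carrier p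
    Underlying N e = Σ (e ∈ 𝓞ᴱ) λ p → embed p ∈ N

    module _ {p} {N : Pred (LeftModule.Carrierᴹ 𝓞ᴱ-module) p}
      (isSub : IsSubmodule (𝓞ᴱ/ isOrder) N) where
      private module N = IsSubmodule isSub

      resp-forget : ∀ {u v} → forget u E.≈ forget v → u ∈ N → v ∈ N
      resp-forget {u} {v} u≈v = N.resp {u} {v} (O.resp
        (E.trans {E.0#} (E.sym {forget v E.- forget v} (E.-‿inverseʳ (forget v)))
          (E.+-congʳ {E.- forget v} {forget v} {forget u} (E.sym {forget u} u≈v))) O.0∈)

      underlying-isModule : IsModule (Underlying N)
      underlying-isModule = record
        { resp = λ {x} {y} x≈y ((p , q , r) , x∈) →
            let y∈ = V-resp (x≈y .proj₁) p , V-resp (x≈y .proj₂ .proj₁) q ,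
                  V-resp (x≈y .proj₂ .proj₂) r in
            y∈ , resp-forget {embed {x} (p , q , r)} {embed {y} y∈} x≈y x∈
        ; 0∈ = (0∈𝔬 , 0∈𝔬 , 0∈𝔬) , N.0∈
        ; +∈ = λ ((p , q , r) , x∈) ((p′ , q′ , r′) , y∈) →
          (+∈𝔬 p p′ , +∈𝔬 q q′ , +∈𝔬 r r′) , N.+∈ x∈ y∈
        ; *∈ = λ {r} r∈ ((p , q , s) , x∈) → (*∈𝔬 r∈ p , *∈𝔬 r∈ q , *∈𝔬 r∈ s) , N.*∈ (r , r∈) x∈
        }

      order⊆submodule : ∀ {e} → e ∈ 𝓞ᴱ → e ∈ O → e ∈ Underlying N
      order⊆submodule {e} e∈𝓞ᴱ e∈O = e∈𝓞ᴱ , N.resp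
        (O.resp (E.sym {E.0# E.- e} (E.+-identityˡ (E.- e))) (O.-∈ e∈O)) N.0∈

    private
      Chain : ∀ k → Vector (Pred (LeftModule.Carrierᴹ 𝓞ᴱ-module) (κ ⊔ ℓ)) (suc k) → Set _
      Chain k N = (∀ i → IsSubmodule (𝓞ᴱ/ isOrder) (N i)) ×
        (∀ (i : Fin k) → N (inject₁ i) ⊆ N (suc i) × Satisfiable (N (suc i) ∖ N (inject₁ i)))

    -- The members of the chain need not be decidable, but adjoining the
    -- successive witnesses gives lattices inside them, and each step lowers
    -- the valuation m of the determinant.
    chain-bound : ∀ k (N : Vector (Pred (LeftModule.Carrierᴹ 𝓞ᴱ-module) (κ ⊔ ℓ)) (suc k)) →
      Chain k N →
      ∀ {m b f} → DualBases b f → ord (det b) ≡ [ + m ] →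
        (∀ i → b i ∈ Underlying (N zero)) → k ℕ.≤ m
    chain-bound zero N _ _ _ _ = ℕ.z≤n
    chain-bound (suc k) N (sub , strict) {m} {b} {f} B eq b∈ =
      go (proj₂ (strict zero)) (adjoin B (forget (proj₁ (proj₂ (strict zero)))))
      where
      go : (w : Satisfiable (N (suc zero) ∖ N zero)) →
        forget (proj₁ w) ∈ Dual f ⊎ Adjoined b f (forget (proj₁ w)) → suc k ℕ.≤ m
      go (w , w∈ , w∉) (inj₁ w∈f) = contradiction
        (resp-forget (sub zero) {embed (proj₁ w∈N)} {w} E.refl (proj₂ w∈N)) w∉
        where
        w∈N : forget w ∈ Underlying (N zero)
        w∈N = DualBases.dual⊆ B (underlying-isModule (sub zero)) b∈ w∈f
      go (w , w∈ , w∉) (inj₂ A) = descend (A.det< eq)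
        where
        module A = Adjoined A
        b′∈ : ∀ i → A.b′ i ∈ Underlying (N (suc zero))
        b′∈ = A.origin∈ {M = Underlying (N (suc zero))}
          ((proj₂ (proj₁ w) , proj₂ (proj₁ (proj₂ w)) , proj₂ (proj₂ (proj₂ w))) , w∈)
          (λ i → proj₁ (b∈ i) , proj₁ (strict zero) (proj₂ (b∈ i)))
        descend : (∃ λ n → ord (det A.b′) ≡ [ n ] × n ℤ.< + m) → suc k ℕ.≤ m
        descend (+ m′ , eq′ , ℤ.+<+ m′<m) = ℕ.≤-trans
          (ℕ.s≤s (chain-bound k (N ∘ suc) (sub ∘ suc , strict ∘ suc) A.bases eq′ b′∈)) m′<m
        -- The new basis consists of integral vectors, so its determinant is integral: the descent
        -- stays within the natural numbers.
        descend (-[1+ n ] , eq′ , _) = contradiction (V⇒≤ eq′ (det∈𝔬 (λ i → proj₁ (b′∈ i)))) λ ()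

  m∸n≡suc : ∀ {m n} → n ℕ.< m → m ℕ.∸ n ≡ suc (m ℕ.∸ suc n)
  m∸n≡suc {suc m} {zero}  _           = ≡.refl
  m∸n≡suc {suc m} {suc n} (ℕ.s≤s n<m) = m∸n≡suc n<m

  module _ (a b : ℕ) {c : Carrier} (c∈𝔬 : c ∈ 𝔬) (isOrder : IsOrder (𝓞 a b c)) where

    length≤ : ∀ k → StrictChain (𝓞ᴱ/ isOrder) k → k ℕ.≤ a ℕ.+ b
    length≤ k (N , chain) = chain-bound isOrder k N chain (gens-dualBases a b c) (det-gens a b c)
      (λ i → order⊆submodule isOrder (proj₁ chain zero) {gens a b c i}
        (𝓞⊆𝓞ᴱ a b c c∈𝔬 {gens a b c i} (gen∈ a b c i)) (gen∈ a b c i))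

    -- The exponent `a` is lowered to 0 before `b` is touched: `(0 , c , π^(b+1))` lies in `𝓞 a b c`
    -- only if `c ∈ (π^a)`, which is automatic once `a = 0`. Truncated subtraction performs the
    -- switch.
    level : ℕ → Subset
    level k = 𝓞 (a ℕ.∸ k) (b ℕ.∸ (k ℕ.∸ a)) c

    private
      Step : (O O′ : Subset) → Set (κ ⊔ ℓ)
      Step O O′ = O ⊆ O′ × ∃ λ e → e ∈ 𝓞ᴱ × e ∈ O′ × ¬ e ∈ O

      step-a : ∀ a b → Step (𝓞 (suc a) b c) (𝓞 a b c)
      step-a a b = sub , gens a b c 1F , 𝓞⊆𝓞ᴱ a b c c∈𝔬 {gens a b c 1F} (gen∈ a b c 1F) ,
        gen∈ a b c 1F , ∉
        where
        sub : 𝓞 (suc a) b c ⊆ 𝓞 a b c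
        sub {e} e∈ = let x∈ , Vy , Vz = ∈𝓞⇒ (suc a) b c e e∈ in
          ∈𝓞⇐ a b c e (x∈ , V-≤ (ℤ.+≤+ (ℕ.n≤1+n a)) Vy , Vz)
        ∉ : ¬ gens a b c 1F ∈ 𝓞 (suc a) b c
        ∉ p = ℕ.<-irrefl ≡.refl (ℤ.drop‿+≤+ (V⇒≤ (ord-π^ (+ a)) (V-resp
          (solve 3 (λ p c q → p :- :0 :- c :* (q :* (:0 :- :0)) := p) refl (π^ (+ a)) c
            (π^ (ℤ.- (+ b))))
          (proj₁ (proj₂ (∈𝓞⇒ (suc a) b c (gens a b c 1F) p))))))

      step-b : ∀ b → Step (𝓞 0 (suc b) c) (𝓞 0 b c)
      step-b b = sub , gens 0 b c 2F , 𝓞⊆𝓞ᴱ 0 b c c∈𝔬 {gens 0 b c 2F} (gen∈ 0 b c 2F) ,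
        gen∈ 0 b c 2F , ∉
        where
        sub : 𝓞 0 (suc b) c ⊆ 𝓞 0 b c
        sub {e} e∈ =
          let x∈ , _ , Vz = ∈𝓞⇒ 0 (suc b) c e e∈
              _ , y∈ , _ = 𝓞⊆𝓞ᴱ 0 (suc b) c c∈𝔬 {e} e∈
              Vz′ = V-≤ (ℤ.+≤+ (ℕ.n≤1+n b)) Vz in
          ∈𝓞⇐ 0 b c e (x∈ , V-- (V-- y∈ x∈) (*∈𝔬 c∈𝔬 (Equivalence.to (V⇔𝔬 b _) Vz′)) , Vz′)
        ∉ : ¬ gens 0 b c 2F ∈ 𝓞 0 (suc b) c
        ∉ p = ℕ.<-irrefl ≡.refl (ℤ.drop‿+≤+ (V⇒≤ (ord-π^ (+ b)) (V-resp
          (solve 1 (λ q → q :- :0 := q) refl (π^ (+ b)))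
          (proj₂ (proj₂ (∈𝓞⇒ 0 (suc b) c (gens 0 b c 2F) p))))))

      cast : ∀ {a a′ b b′ a₁ b₁ a₁′ b₁′} → a ≡ a₁ → b ≡ b₁ → a′ ≡ a₁′ → b′ ≡ b₁′ →
        Step (𝓞 a₁ b₁ c) (𝓞 a₁′ b₁′ c) → Step (𝓞 a b c) (𝓞 a′ b′ c)
      cast ≡.refl ≡.refl ≡.refl ≡.refl s = s

      level-step : ∀ k → k ℕ.< a ℕ.+ b → Step (level k) (level (suc k))
      level-step k k<a+b = by (a ℕ.≤? k)
        where
        by : Dec (a ℕ.≤ k) → Step (level k) (level (suc k))
        by (no a≰k) = cast {a′ = a ℕ.∸ suc k} (m∸n≡suc k<a)
          (≡.cong (b ℕ.∸_) (ℕ.m≤n⇒m∸n≡0 (ℕ.<⇒≤ k<a))) ≡.refl (≡.cong (b ℕ.∸_) (ℕ.m≤n⇒m∸n≡0 k<a))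
          (step-a (a ℕ.∸ suc k) b)
          where k<a = ℕ.≰⇒> a≰k
        by (yes a≤k) = cast (ℕ.m≤n⇒m∸n≡0 a≤k) (m∸n≡suc k∸a<b) (ℕ.m≤n⇒m∸n≡0 (ℕ.m≤n⇒m≤1+n a≤k))
          (≡.cong (b ℕ.∸_) (ℕ.+-∸-assoc 1 a≤k))
          (step-b (b ℕ.∸ suc (k ℕ.∸ a)))
          where
          k∸a<b : k ℕ.∸ a ℕ.< b
          k∸a<b = ℕ.+-cancelˡ-< a _ _ (≡.subst (ℕ._< a ℕ.+ b) (≡.sym (ℕ.m+[n∸m]≡n a≤k)) k<a+b)

      order⊆level : ∀ k → k ℕ.≤ a ℕ.+ b → 𝓞 a b c ⊆ level k
      order⊆level zero _ {e} e∈ = ≡.subst (λ n → e ∈ 𝓞 a (b ℕ.∸ n) c) (≡.sym (ℕ.0∸n≡0 a)) e∈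
      order⊆level (suc k) k<a+b {e} e∈ = proj₁ (level-step k k<a+b) {e}
        (order⊆level k (ℕ.<⇒≤ k<a+b) {e} e∈)

    length≥ : StrictChain (𝓞ᴱ/ isOrder) (a ℕ.+ b)
    length≥ = (λ i e → forget e ∈ level (toℕ i)) , (λ i → submodule (toℕ i) (ℕ.s≤s⁻¹ (toℕ<n i))) ,
      λ i → ≡.subst (λ k → (∀ {e} → forget e ∈ level k → forget e ∈ level (suc (toℕ i)))
                      × Satisfiable ((λ e → forget e ∈ level (suc (toℕ i))) ∖
                        (λ e → forget e ∈ level k)))
        (≡.sym (toℕ-inject₁ i)) (proper (toℕ i) (toℕ<n i))
      where
      submodule : ∀ k → k ℕ.≤ a ℕ.+ b → IsSubmodule (𝓞ᴱ/ isOrder) (λ e → forget e ∈ level k)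
      submodule k k≤ = record
        { resp = λ {x} {y} x∼y x∈ → M.resp (sub-sub (forget x) (forget y))
          (M.+∈ x∈ (neg∈ (order⊆level k k≤ x∼y)))
        ; 0∈ = M.0∈
        ; +∈ = M.+∈
        ; -∈ = neg∈
        ; *∈ = λ r x∈ → M.*∈ (proj₂ r) x∈
        }
        where
        module M = IsModule (𝓞-isModule (a ℕ.∸ k) (b ℕ.∸ (k ℕ.∸ a)) c)
        neg : ∀ x → - 1# * x ≈ - x
        neg = solve 1 (λ x → :- :1 :* x := :- x) refl
        neg∈ : ∀ {e} → e ∈ level k → E.- e ∈ level k
        neg∈ {x , y , z} e∈ = M.resp (neg x , neg y , neg z) (M.*∈ (-∈𝔬 1∈𝔬) e∈)
        cancel : ∀ x y → x - (x - y) ≈ y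
        cancel = solve 2 (λ x y → x :- (x :- y) := y) refl
        sub-sub : ∀ e e′ → e E.- (e E.- e′) E.≈ e′
        sub-sub (x , y , z) (x′ , y′ , z′) = cancel x x′ , cancel y y′ , cancel z z′
      proper : ∀ k → k ℕ.< a ℕ.+ b → (∀ {e} → forget e ∈ level k → forget e ∈ level (suc k))
                      × Satisfiable ((λ e → forget e ∈ level (suc k)) ∖ (λ e → forget e ∈ level k))
      proper k k< = let sub , e , e∈𝓞ᴱ , e∈ , e∉ = level-step k k< in
        (λ {e} → sub {forget e}) , embed {e} e∈𝓞ᴱ , e∈ , e∉

-- Trace duality for ideals; self-dual orders are Gorenstein.

module Duality {κ ℓ} (F : NonArchimedeanLocalField κ ℓ)
  (π : NonArchimedeanLocalField.Carrier F)
  (ord-π : NonArchimedeanLocalField.ord F π ≡ [ + 1 ]) where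
  open NonArchimedeanLocalField F hiding (zero)
  open CubicAlgebra F
  open Uniformizer π ord-π
  open Valuation F
  open Lattices F
  open Adjunction F
  open Denominators π ord-π
  open StandardOrders F
  open Normalisation F π ord-π
  open Sum E.semiring using (sum; sum-cong-≋; *-distribˡ-sum)
  private module SE = IntegerSolver E-commutativeRing

  -- The form is the trace of the product, so multiplications are self-adjoint and factors move
  -- freely across the pairing.
  ∙-slide : ∀ {e f e′ f′} → e E.* f E.≈ e′ E.* f′ → e ∙ f ≈ e′ ∙ f′
  ∙-slide = tr-cong

  preimage-isModule : ∀ {p} {M : Pred E.Carrier p} → IsModule M → ∀ g → IsModule (λ x → x E.* g ∈ M)
  preimage-isModule M-mod g = record
    { resp = λ {x} {y} x≈y → M.resp (E.*-congʳ {g} {x} {y} x≈y)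
    ; 0∈ = M.resp (E.sym {E.0# E.* g} (E.zeroˡ g)) M.0∈
    ; +∈ = λ {x} {y} p q → M.resp (E.sym {(x E.+ y) E.* g} (E.distribʳ g x y)) (M.+∈ p q)
    ; *∈ = λ {r} {x} r∈ p → M.resp (E.sym {(Δ r E.* x) E.* g} (E.*-assoc (Δ r) x g)) (M.*∈ r∈ p)
    }
    where module M = IsModule M-mod

  -- The dual of w⁻¹ L under the form tr (w · ·) has the basis dual to that of L.
  twist : ∀ {b f w w⁻} → w E.* w⁻ E.≈ E.1# → DualBases b f →
    DualBases (λ i → w⁻ E.* b i) (λ i → w E.* f i)
  twist {b} {f} {w} {w⁻} ww⁻≈1 B = record
    { expand = twisted {b} {f} {w} {w⁻} B.expand ww⁻≈1
    ; expand* = twisted {f} {b} {w⁻} {w} B.expand* (E.trans {w⁻ E.* w} (E.*-comm w⁻ w) ww⁻≈1)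
    ; integral = λ i j → V-resp (sym (∙-slide (E.trans {(w⁻ E.* b i) E.* (w E.* f j)}
        (SE.solve 4 (λ w w⁻ b f → (w⁻ SE.:* b) SE.:* (w SE.:* f) SE.:=
          (w SE.:* w⁻) SE.:* (b SE.:* f)) E.refl w w⁻ (b i) (f j))
        (E.trans {(w E.* w⁻) E.* (b i E.* f j)} (E.*-congʳ {b i E.* f j} {w E.* w⁻} {E.1#} ww⁻≈1)
          (E.*-identityˡ (b i E.* f j)))))) (B.integral i j)
    }
    where
    module B = DualBases B
    twisted : ∀ {b f w w⁻} → (∀ e → e E.≈ comb (λ i → e ∙ f i) b) → w E.* w⁻ E.≈ E.1# →
      ∀ e → e E.≈ comb (λ i → e ∙ (w E.* f i)) (λ i → w⁻ E.* b i)
    twisted {b} {f} {w} {w⁻} expand ww⁻≈1 e = E.trans {e}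
      (E.sym {w⁻ E.* (w E.* e)} (E.trans {w⁻ E.* (w E.* e)}
        (SE.solve 3 (λ w w⁻ e → w⁻ SE.:* (w SE.:* e) SE.:= (w SE.:* w⁻) SE.:* e) E.refl w w⁻ e)
        (E.trans {(w E.* w⁻) E.* e} (E.*-congʳ {e} {w E.* w⁻} {E.1#} ww⁻≈1) (E.*-identityˡ e))))
      (E.trans {w⁻ E.* (w E.* e)} (E.*-congˡ {w⁻} {w E.* e} (expand (w E.* e)))
      (E.trans {w⁻ E.* comb (λ i → (w E.* e) ∙ f i) b}
        (*-distribˡ-sum w⁻ (λ i → Δ ((w E.* e) ∙ f i) E.* b i))
      (sum-cong-≋ {_} {λ i → w⁻ E.* (Δ ((w E.* e) ∙ f i) E.* b i)} {λ i →
        Δ (e ∙ (w E.* f i)) E.* (w⁻ E.* b i)} (λ i → E.trans {w⁻ E.* (Δ ((w E.* e) ∙ f i) E.* b i)}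
        (SE.solve 3 (λ w⁻ d b → w⁻ SE.:* (d SE.:* b) SE.:= d SE.:* (w⁻ SE.:* b)) E.refl w⁻
          (Δ ((w E.* e) ∙ f i)) (b i))
        (E.*-congʳ {w⁻ E.* b i} (Δ-cong (∙-slide
          (SE.solve 3 (λ w e f → w SE.:* e SE.:* f SE.:= e SE.:* (w SE.:* f)) E.refl w e
            (f i)))))))))

  module _ {O : Subset} (isOrder : IsOrder O) where
    private
      module O = IsOrder isOrder
      Om = order-isModule isOrder

    Δ𝔬∈ : ∀ {r} → r ∈ Δ[ 𝔬 ] → r ∈ O
    Δ𝔬∈ {r} (s , s∈ , r≈) = O.resp (E.sym {r} r≈) (O.Δ𝔬⊆ s∈)

    stable⇒ideal : ∀ {b f} → DualBases b f → (∀ {o} → o ∈ O → ∀ i → o E.* b i ∈ Dual f) →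
      IsFractionalIdeal O (Span Δ[ 𝔬 ] b)
    stable⇒ideal {b} {f} B stable =
      (3 , b , (λ (r , r∈ , e≈) → r , (λ i → Δ𝔬∈ (r∈ i)) , e≈) , O-span⊆) ,
        spansE {M = Span Δ[ 𝔬 ] b} B (gen∈span b)
      where
      O-span⊆ : Span O b ⊆ Span Δ[ 𝔬 ] b
      O-span⊆ {e} (r , r∈ , e≈) = IsModule.resp (span-isModule b) (E.sym {e} e≈)
        (IsModule.sum∈ (span-isModule b) (λ i → r i E.* b i)
          (λ i → DualBases.dual⊆span B {r i E.* b i} (stable (r∈ i) i)))

    module _ {I : Subset} (ideal : IsFractionalIdeal O I) where
      private
        k = proj₁ (proj₁ ideal)
        g = proj₁ (proj₂ (proj₁ ideal))
        I⊆ = proj₁ (proj₂ (proj₂ (proj₁ ideal)))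
        ⊆I = proj₂ (proj₂ (proj₂ (proj₁ ideal)))
        module C = SpanClosure {O} O.0∈ O.+∈ O.*∈ g

      ideal-* : ∀ {o x} → o ∈ O → x ∈ I → o E.* x ∈ I
      ideal-* o∈ x∈ = ⊆I (C.*∈ o∈ (I⊆ x∈))

      ideal-isModule : IsModule I
      ideal-isModule = record
        { resp = λ x≈y x∈ → ⊆I (C.resp∈ x≈y (I⊆ x∈))
        ; 0∈ = ⊆I C.0∈
        ; +∈ = λ x∈ y∈ → ⊆I (C.+∈ (I⊆ x∈) (I⊆ y∈))
        ; *∈ = λ r∈ x∈ → ideal-* (O.Δ𝔬⊆ r∈) x∈
        }

      ideal-gen∈ : ∀ i → g i ∈ I
      ideal-gen∈ i = ⊆I ((λ j → Δ (kronecker i j)) ,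
        (λ j → O.Δ𝔬⊆ (kronecker∈𝔬 i j)) , proj₂ (proj₂ (gen∈span g i)))

      -- Over `𝔬` the ideal is generated by the finitely many products of the generators of `O` and
      -- of `I`. A lattice inside `I` containing them all is `I`.
      ideal-lattice : ∃₂ λ b f → DualBases b f × (∀ i → b i ∈ I) × I ⊆ Dual f
      ideal-lattice = enclose O.finite
        where
        enclose : (∃₂ λ l (h : Vector E.Carrier l) → O ≐ Span Δ[ 𝔬 ] h) → ∃₂ λ b f →
          DualBases b f × (∀ i → b i ∈ I) × I ⊆ Dual f
        enclose (l , h , O⊆ , ⊆O) =
          let b , f , B , b∈ , v∈ = lattice {I} (spansE⇒fullRank ideal-isModule
                (proj₂ ideal)) (λ i j → h i E.* g j)
                (λ i j → ideal-* (⊆O (gen∈span h i)) (ideal-gen∈ j)) in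
          b , f , B , b∈ , λ {e} e∈ → let r , r∈ , e≈ = I⊆ e∈ in
            IsModule.resp (dual-isModule f) {_} {e} (E.sym {e} e≈)
              (IsModule.sum∈ (dual-isModule f) (λ j → r j E.* g j)
              (λ j → IsModule.span⊆ (preimage-isModule (dual-isModule f) (g j)) {g = h}
                (λ i → v∈ i j) {r j} (O⊆ (r∈ j))))

    -- If O is its own dual under the form tr (w · ·), then the dual of I is the
    -- inverse of I: the dual of I I* is (I : I) = O.
    selfDual⇒Gorenstein : ∀ {w w⁻} → w E.* w⁻ E.≈ E.1# →
      (∀ {y} → y ∈ O → w ∙ y ∈ 𝔬) →
      (∀ y → (∀ {x} → x ∈ O → (w E.* y) ∙ x ∈ 𝔬) → y ∈ O) →
      IsGorenstein O
    selfDual⇒Gorenstein {w} {w⁻} ww⁻≈1 integral dual∈ I ideal (mult⊆ , _) =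
      invert (ideal-lattice ideal)
      where
      module I = IsModule (ideal-isModule ideal)
      absorb : ∀ {e} t → e E.≈ (w E.* w⁻) E.* t → e E.≈ t
      absorb {e} t eq = E.trans {e} eq (E.trans {(w E.* w⁻) E.* t}
        (E.*-congʳ {t} {w E.* w⁻} {E.1#} ww⁻≈1) (E.*-identityˡ t))
      invert : (∃₂ λ b f → DualBases b f × (∀ i → b i ∈ I) × I ⊆ Dual f) → IsInvertible O I
      invert (b , f , B , b∈ , I⊆) = J , stable⇒ideal T stable , IJ⊆ , ⊆IJ
        where
        -- `J` is the set of `y` with `tr (w x y)` integral for all `x ∈ I`, the dual of `I` under
        -- the twisted form; this is its basis.
        f′ : Vector E.Carrier 3
        f′ j = w⁻ E.* f j
        J : Subset
        J = Span Δ[ 𝔬 ] f′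
        T : DualBases f′ (λ i → w E.* b i)
        T = twist ww⁻≈1 (DualBases.flip B)
        stable : ∀ {o} → o ∈ O → ∀ i → o E.* f′ i ∈ Dual (λ j → w E.* b j)
        stable {o} o∈ i j = V-resp (sym (∙-slide (absorb ((o E.* b j) E.* f i)
            (SE.solve 5 (λ o w w⁻ f b → (o SE.:* (w⁻ SE.:* f)) SE.:* (w SE.:* b) SE.:=
              (w SE.:* w⁻) SE.:* ((o SE.:* b) SE.:* f)) E.refl o w w⁻ (f i) (b j)))))
          (I⊆ {o E.* b j} (ideal-* ideal o∈ (b∈ j)) i)
        pairing : ∀ {x y} → x ∈ I → y ∈ J → x ∙ (w E.* y) ∈ 𝔬
        pairing {x} {y} x∈ y∈ = DualBases.dual⊆ B (V∙-isModule (+ 0) (w E.* y))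
          (λ j → V-resp (∙-slide (SE.solve 3 (λ w y b → y SE.:* (w SE.:* b) SE.:=
            b SE.:* (w SE.:* y)) E.refl w y (b j))) (DualBases.span⊆dual T {y} y∈ j))
          {x} (I⊆ {x} x∈)
        IJ⊆ : I · J ⊆ O
        IJ⊆ {e} (n , u , v , u∈ , v∈ , e≈) = O.resp (E.sym {e} e≈)
          (IsModule.sum∈ Om (λ i → u i E.* v i)
          (λ i → dual∈ (u i E.* v i) (λ {x} x∈ → V-resp
            (∙-slide (SE.solve 4 (λ w u v x → (x SE.:* u) SE.:* (w SE.:* v) SE.:=
              (w SE.:* (u SE.:* v)) SE.:* x) E.refl w (u i) (v i) x))
            (pairing {x E.* u i} {v i} (ideal-* ideal x∈ (u∈ i)) (v∈ i)))))
        -- `I J` is the `𝔬`-span of these nine products, hence a lattice with a dual basis of its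
        -- own, against which membership can be tested.
        products : Vector E.Carrier 9
        products k = b (proj₁ (remQuot {3} 3 k)) E.* f′ (proj₂ (remQuot {3} 3 k))
        P : Subset
        P = Span Δ[ 𝔬 ] products
        P-mod : IsModule P
        P-mod = span-isModule products
        P⊆IJ : P ⊆ I · J
        P⊆IJ {e} (r , r∈ , e≈) =
          9 , (λ k → r k E.* b (proj₁ (remQuot {3} 3 k))) , (λ k → f′ (proj₂ (remQuot {3} 3 k))) ,
          (λ k → ideal-* ideal (Δ𝔬∈ (r∈ k)) (b∈ (proj₁ (remQuot {3} 3 k)))) ,
          (λ k → gen∈span f′ (proj₂ (remQuot {3} 3 k))) ,
          E.trans {e} e≈ (sum-cong-≋ {9} {λ k → r k E.* products k} {λ k →
            (r k E.* b (proj₁ (remQuot {3} 3 k))) E.* f′ (proj₂ (remQuot {3} 3 k))}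
            (λ k → E.sym {(r k E.* b (proj₁ (remQuot {3} 3 k))) E.* f′ (proj₂ (remQuot {3} 3 k))}
              (E.*-assoc (r k) (b (proj₁ (remQuot {3} 3 k))) (f′ (proj₂ (remQuot {3} 3 k))))))
        product∈ : ∀ i j → b i E.* f′ j ∈ P
        product∈ i j = ≡.subst (λ (q , r) → b q E.* f′ r ∈ P) (remQuot-combine {3} {3} i j)
          (gen∈span products (combine i j))
        *∈P : ∀ {x y} → x ∈ I → y ∈ J → x E.* y ∈ P
        *∈P {x} {y} x∈ y∈ = DualBases.dual⊆ B (preimage-isModule P-mod y) row {x} (I⊆ {x} x∈)
          where
          row : ∀ i → b i E.* y ∈ P
          row i = IsModule.resp P-mod (E.*-comm y (b i))
            (IsModule.span⊆ (preimage-isModule P-mod (b i)) {g = f′}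
            (λ j → IsModule.resp P-mod (E.*-comm (b i) (f′ j)) (product∈ i j)) {y} y∈)
        rank : FullRank P
        rank = fullRank-* P-mod (spansE⇒fullRank (ideal-isModule ideal) (proj₂ ideal))
          (spansE⇒fullRank (span-isModule f′) (spansE {M = J} T (gen∈span f′)))
            (λ {x} {y} → *∈P {x} {y})
        ⊆IJ : O ⊆ I · J
        ⊆IJ {y} y∈ = P⊆IJ {y} (reflexive-P (lattice {P} rank (λ i j → b i E.* f′ j) product∈))
          where
          reflexive-P : (∃₂ λ b″ f″ → DualBases b″ f″ × (∀ i → b″ i ∈ P) ×
            (∀ i j → b i E.* f′ j ∈ Dual f″)) → y ∈ P
          -- It remains to see that `y ∙ f″ k` is integral. The element `w⁻ * f″ k` multiplies `I`
          -- into the double dual of `I`, which is `I`, so it lies in the multiplier ring `O`; so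
          -- does its product with `y`, and `integral` applies.
          reflexive-P (b″ , f″ , B″ , b″∈ , products∈) = DualBases.dual⊆ B″ P-mod b″∈ {y} λ k →
            V-resp (∙-slide (absorb (y E.* f″ k)
              (SE.solve 4 (λ w w⁻ f y → w SE.:* ((w⁻ SE.:* f) SE.:* y) SE.:=
                (w SE.:* w⁻) SE.:* (y SE.:* f)) E.refl w w⁻ (f″ k) y)))
              (integral (O.*∈ (x∈O k) y∈))
            where
            x∈O : ∀ k → w⁻ E.* f″ k ∈ O
            x∈O k = mult⊆ λ u u∈ → DualBases.dual⊆ B
              (ideal-isModule ideal) b∈ {(w⁻ E.* f″ k) E.* u} λ j →
              V-resp (∙-slide (SE.solve 4 (λ u w⁻ f f″ → (u SE.:* (w⁻ SE.:* f)) SE.:* f″ SE.:=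
                ((w⁻ SE.:* f″) SE.:* u) SE.:* f) E.refl u w⁻ (f j) (f″ k)))
                (DualBases.dual⊆ B (preimage-isModule (dual-isModule f″) (f′ j))
                  (λ i → products∈ i j) {u} (I⊆ {u} u∈) k)

-- Forms under which the Gorenstein orders are self-dual.

module GorensteinOrders {κ ℓ} (F : NonArchimedeanLocalField κ ℓ)
  (π : NonArchimedeanLocalField.Carrier F)
  (ord-π : NonArchimedeanLocalField.ord F π ≡ [ + 1 ]) where
  open NonArchimedeanLocalField F hiding (zero)
  open CubicAlgebra F
  open Uniformizer π ord-π
  open Valuation F
  open Powers π ord-π
  open Lattices F
  open StandardOrders F
  open Orders π ord-π
  open Conditions F
  open Duality F π ord-π
  open IntegerSolver commutativeRing

  private
    inverseᴱ : ∀ {x y z} → x ≉ 0# → y ≉ 0# → z ≉ 0# → ∃ λ w⁻ → (x , y , z) E.* w⁻ E.≈ E.1#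
    inverseᴱ {x} {y} {z} x≉0 y≉0 z≉0 =
      let x⁻ , p = inverse x x≉0 ; y⁻ , q = inverse y y≉0 ; z⁻ , r = inverse z z≉0 in
      (x⁻ , y⁻ , z⁻) , (p , q , r)

    *-≉0 : ∀ {x y} → x ≉ 0# → y ≉ 0# → x * y ≉ 0#
    *-≉0 x≉0 y≉0 = ord≡⇒≉0 (ord-*-≡ (proj₂ (≉0⇒ord x≉0)) (proj₂ (≉0⇒ord y≉0)))

    neg-≉0 : ∀ {x} → x ≉ 0# → - x ≉ 0#
    neg-≉0 x≉0 = ord≡⇒≉0 (ord-neg (proj₂ (≉0⇒ord x≉0)))

    π^≉0 : ∀ j → π^ j ≉ 0#
    π^≉0 j = ord≡⇒≉0 (ord-π^ j)

  module _ (a b : ℕ) (c : Carrier) (c∈𝔬 : c ∈ 𝔬) (isOrder : IsOrder (𝓞 a b c)) where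
    private
      A A⁻ B B⁻ : Carrier
      A = π^ (+ a)
      A⁻ = π^ (ℤ.- (+ a))
      B = π^ (+ b)
      B⁻ = π^ (ℤ.- (+ b))
      𝓞abc : Subset
      𝓞abc = 𝓞 a b c

    -- tr (w · ·) takes the coordinate along (0 , π^a , 0) of a product; its Gram
    -- determinant in the basis gens is - c (c - π^b) / π^a.
    unitDiscriminant⇒Gorenstein : ord (c * (c - B)) ≡ [ + a ] → IsGorenstein (𝓞 a b c)
    unitDiscriminant⇒Gorenstein eq = selfDual⇒Gorenstein isOrder {w} {w⁻} ww⁻≈1 integral dual∈
      where
      w : E.Carrier
      -- This is `dualGens a b c 1F` with `c * B⁻ - 1#` rewritten as `B⁻ * (c - B)`, so that the
      -- hypothesis shows each component to be nonzero.
      w = A⁻ * (B⁻ * (c - B)) , A⁻ , A⁻ * (- (B⁻ * c))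
      product≉0 : c * (c - B) ≉ 0#
      product≉0 = ord≡⇒≉0 eq
      c≉0 : c ≉ 0#
      c≉0 c≈0 = product≉0 (trans (*-congʳ c≈0) (zeroˡ _))
      c-B≉0 : c - B ≉ 0#
      c-B≉0 c-B≈0 = product≉0 (trans (*-congˡ c-B≈0) (zeroʳ c))
      A⁻≉0 = π^≉0 (ℤ.- (+ a))
      B⁻≉0 = π^≉0 (ℤ.- (+ b))
      inv : ∃ λ w⁻ → w E.* w⁻ E.≈ E.1#
      inv = inverseᴱ (*-≉0 A⁻≉0 (*-≉0 B⁻≉0 c-B≉0)) A⁻≉0 (*-≉0 A⁻≉0 (neg-≉0 (*-≉0 B⁻≉0 c≉0)))
      w⁻ : E.Carrier
      w⁻ = proj₁ inv
      ww⁻≈1 : w E.* w⁻ E.≈ E.1#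
      ww⁻≈1 = proj₂ inv
      w∙ : ∀ e → w ∙ e ≈ A⁻ * coord₁ a b c e
      w∙ (x , y , z) = trans (solve 7 (λ x y z c p q q⁻ →
          p :* (q⁻ :* (c :- q)) :* x :+ p :* y :+ p :* (:- (q⁻ :* c)) :* z :=
          p :* (y :- q :* q⁻ :* x :- c :* (q⁻ :* (z :- x)))) refl x y z c A⁻ B B⁻)
        (*-congˡ (+-congʳ (+-congˡ (-‿cong (trans (*-congʳ (π^-inverse b)) (*-identityˡ x))))))
      integral : ∀ {y} → y ∈ 𝓞abc → w ∙ y ∈ 𝔬
      integral {y} y∈ = V-resp (sym (w∙ y)) (Equivalence.to (V⇔𝔬 a (coord₁ a b c y))
        (proj₁ (proj₂ (∈𝓞⇒ a b c y y∈))))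
      dual∈ : ∀ y → (∀ {x} → x ∈ 𝓞abc → (w E.* y) ∙ x ∈ 𝔬) → y ∈ 𝓞abc
      dual∈ e@(x , y , z) p = ∈𝓞⇐ a b c e (x∈𝔬 , Vg , Equivalence.from (V⇔𝔬 b (z - x)) s∈𝔬)
        where
        V-coord : ∀ i → V (+ a) (coord₁ a b c (e E.* gens a b c i))
        V-coord i = Equivalence.from (V⇔𝔬 a (coord₁ a b c (e E.* gens a b c i)))
          (V-resp (trans (∙-slide {w E.* e} {gens a b c i} {w} {e E.* gens a b c i}
            (E.*-assoc w e (gens a b c i))) (w∙ (e E.* gens a b c i))) (p (gen∈ a b c i)))
        s g : Carrier
        s = B⁻ * (z - x)
        g = y - x - c * s
        Vg : V (+ a) g
        Vg = V-resp (solve 5 (λ x y z c q → y :* :1 :- x :* :1 :- c :* (q :* (z :* :1 :- x :* :1))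
          := y :- x :- c :* (q :* (z :- x))) refl x y z c B⁻) (V-coord 0F)
        y∈𝔬 : y ∈ 𝔬
        y∈𝔬 = V-unscale (ord-π^ (+ a)) (≡.subst (λ k → V k (A * y)) (≡.sym (ℤ.+-identityʳ (+ a)))
          (V-resp (solve 6 (λ x y z c p q → y :* p :- x :* :0 :- c :* (q :* (z :* :0 :- x :* :0)) :=
            p :* y) refl x y z c A B⁻) (V-coord 1F)))
        Vyz : V (+ a) (c * (g + c * s - B * s))
        Vyz = V-resp (trans (solve 6 (λ x y z c q q⁻ →
          y :* c :- x :* :0 :- c :* (q⁻ :* (z :* q :- x :* :0)) :=
          c :* (y :- x :- q :* q⁻ :* (z :- x)) :+ c :* x :* (:1 :- q :* q⁻)) refl x y z c B B⁻)
          (trans (+-congˡ (trans (*-congˡ (trans (+-congˡ (-‿cong (π^-inverse b))) (-‿inverseʳ 1#)))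
            (zeroʳ _)))
            (solve 6 (λ x y z c q q⁻ → c :* (y :- x :- q :* q⁻ :* (z :- x)) :+ :0 :=
              c :* (y :- x :- c :* (q⁻ :* (z :- x)) :+ c :* (q⁻ :* (z :- x)) :- q
              :* (q⁻ :* (z :- x)))) refl x y z c B B⁻)))
          (V-coord 2F)
        -- Removing `c * g` from `Vyz` leaves `c * (c - B) * s` in `(π^a)`, where `c * (c - B)` has
        -- valuation exactly `a`.
        s∈𝔬 : s ∈ 𝔬
        s∈𝔬 = V-unscale eq (≡.subst (λ k → V k (c * (c - B) * s)) (≡.sym (ℤ.+-identityʳ (+ a)))
          (V-resp (solve 4 (λ c g s q → c :* (g :+ c :* s :- q :* s) :- c :* g :=
            c :* (c :- q) :* s) refl c g s B)
            (V-- Vyz (V-*ˡ c∈𝔬 Vg))))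
        x∈𝔬 : x ∈ 𝔬
        x∈𝔬 = V-resp (solve 4 (λ x y c s → y :- (y :- x :- c :* s) :- c :* s := x) refl x y c s)
          (V-- (V-- y∈𝔬 (V-≤ (ℤ.+≤+ ℕ.z≤n) Vg)) (*∈𝔬 c∈𝔬 s∈𝔬))

  -- For `a = 0` the order is the middle factor `𝔬` times the pairs `x ≡ z` modulo `π^b`. The form
  -- is `y` on the first plus `(z - x) / π^b` on the second, and each factor is its own dual under
  -- its part.
  a≡0⇒Gorenstein : ∀ b c → c ∈ 𝔬 → IsOrder (𝓞 0 b c) → IsGorenstein (𝓞 0 b c)
  a≡0⇒Gorenstein b c c∈𝔬 isOrder = selfDual⇒Gorenstein isOrder {w} {w⁻} ww⁻≈1 integral dual∈
    where
    B B⁻ : Carrier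
    B = π^ (+ b)
    B⁻ = π^ (ℤ.- (+ b))
    O : Subset
    O = 𝓞 0 b c
    w : E.Carrier
    w = - B⁻ , 1# , B⁻
    inv : ∃ λ w⁻ → w E.* w⁻ E.≈ E.1#
    inv = inverseᴱ (neg-≉0 (π^≉0 (ℤ.- (+ b)))) 1≉0 (π^≉0 (ℤ.- (+ b)))
    w⁻ : E.Carrier
    w⁻ = proj₁ inv
    ww⁻≈1 : w E.* w⁻ E.≈ E.1#
    ww⁻≈1 = proj₂ inv
    w∙ : ∀ x y z → w ∙ (x , y , z) ≈ y + B⁻ * (z - x)
    w∙ x y z = solve 4 (λ x y z q → (:- q) :* x :+ :1 :* y :+ q :* z := y :+ q :* (z :- x)) refl x y
      z B⁻
    integral : ∀ {y} → y ∈ O → w ∙ y ∈ 𝔬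
    integral {e@(x , y , z)} e∈ = V-resp (sym (w∙ x y z))
      (V-+ (proj₁ (proj₂ (𝓞⊆𝓞ᴱ 0 b c c∈𝔬 {e} e∈)))
        (Equivalence.to (V⇔𝔬 b (z - x)) (proj₂ (proj₂ (∈𝓞⇒ 0 b c e e∈)))))
    dual∈ : ∀ y → (∀ {x} → x ∈ O → (w E.* y) ∙ x ∈ 𝔬) → y ∈ O
    dual∈ e@(x , y , z) p = ∈𝓞⇐ 0 b c e (x∈𝔬 , V-- (V-- y∈𝔬 x∈𝔬) (*∈𝔬 c∈𝔬 s∈𝔬) ,
      Equivalence.from (V⇔𝔬 b (z - x)) s∈𝔬)
      where
      s : Carrier
      s = B⁻ * (z - x)
      y∈𝔬 : y ∈ 𝔬
      y∈𝔬 = V-resp (solve 4 (λ x y z q → (:- q) :* x :* :0 :+ :1 :* y :* :1 :+ q :* z :* :0 := y)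
        refl x y z B⁻) (p (gen∈ 0 b c 1F))
      s∈𝔬 : s ∈ 𝔬
      s∈𝔬 = V-cancelˡ y∈𝔬 (V-resp (solve 4 (λ x y z q →
        (:- q) :* x :* :1 :+ :1 :* y :* :1 :+ q :* z :* :1 := y :+ q :* (z :- x)) refl x y z B⁻)
        (p (gen∈ 0 b c 0F)))
      z∈𝔬 : z ∈ 𝔬
      z∈𝔬 = V-cancelˡ (*∈𝔬 c∈𝔬 y∈𝔬) (V-resp
        (trans (solve 6 (λ x y z c q q⁻ → (:- q⁻) :* x :* :0 :+ :1 :* y :* c :+ q⁻ :* z :* q :=
          c :* y :+ q :* q⁻ :* z) refl x y z c B B⁻)
          (+-congˡ (trans (*-congʳ (π^-inverse b)) (*-identityˡ z))))
        (p (gen∈ 0 b c 2F)))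
      x∈𝔬 : x ∈ 𝔬
      x∈𝔬 = V-cancelˡ (V-≤ (ℤ.+≤+ ℕ.z≤n) (Equivalence.from (V⇔𝔬 b (z - x)) s∈𝔬))
        (V-resp (solve 2 (λ x z → z := (z :- x) :+ x) refl x z) z∈𝔬)

  module _ (a : ℕ) (c : Carrier) (c∈𝔬 : c ∈ 𝔬) (isOrder : IsOrder (𝓞 a 0 c)) where
    private
      A A⁻ : Carrier
      A = π^ (+ a)
      A⁻ = π^ (ℤ.- (+ a))
      O : Subset
      O = 𝓞 a 0 c
      -- π^ (+ 0) and π^ (ℤ.- (+ 0)) are both 1#.
      ∈O⇒ : ∀ {x y z} → (x , y , z) ∈ O → x ∈ 𝔬 × V (+ a) (y - x - c * (z - x)) × z - x ∈ 𝔬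
      ∈O⇒ {x} {y} {z} e∈ = let p , q , r = ∈𝓞⇒ a 0 c (x , y , z) e∈ in
        p , V-resp (+-congˡ (-‿cong (*-congˡ (*-identityˡ (z - x))))) q , r
      ∈O⇐ : ∀ {x y z} → x ∈ 𝔬 → V (+ a) (y - x - c * (z - x)) → z - x ∈ 𝔬 → (x , y , z) ∈ O
      ∈O⇐ {x} {y} {z} p q r = ∈𝓞⇐ a 0 c (x , y , z)
        (p , V-resp (+-congˡ (-‿cong (*-congˡ (sym (*-identityˡ (z - x)))))) q , r)

    -- Here the order is the pairs `x ≡ y` modulo `π^a` times the last factor `𝔬`; the form is
    -- `(y - x) / π^a + z`.
    V-c⇒Gorenstein : V (+ a) c → IsGorenstein (𝓞 a 0 c)
    V-c⇒Gorenstein Vc = selfDual⇒Gorenstein isOrder {w} {w⁻} ww⁻≈1 integral dual∈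
      where
      w : E.Carrier
      w = - A⁻ , A⁻ , 1#
      inv : ∃ λ w⁻ → w E.* w⁻ E.≈ E.1#
      inv = inverseᴱ (neg-≉0 (π^≉0 (ℤ.- (+ a)))) (π^≉0 (ℤ.- (+ a))) 1≉0
      w⁻ : E.Carrier
      w⁻ = proj₁ inv
      ww⁻≈1 : w E.* w⁻ E.≈ E.1#
      ww⁻≈1 = proj₂ inv
      integral : ∀ {y} → y ∈ O → w ∙ y ∈ 𝔬
      integral {x , y , z} e∈ = let x∈ , Vy , z-x∈ = ∈O⇒ e∈ in
        V-resp (solve 4 (λ x y z p → p :* (y :- x) :+ z :=
          (:- p) :* x :+ p :* y :+ :1 :* z) refl x y z A⁻)
          (V-+ (Equivalence.to (V⇔𝔬 a (y - x)) (V-cancelʳ (V-neg (V-*ʳ Vc z-x∈)) Vy))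
            (V-cancelʳ (V-neg x∈) z-x∈))
      dual∈ : ∀ y → (∀ {x} → x ∈ O → (w E.* y) ∙ x ∈ 𝔬) → y ∈ O
      dual∈ (x , y , z) p = ∈O⇐ x∈𝔬 (V-- Vy-x (V-*ʳ Vc (V-- z∈𝔬 x∈𝔬))) (V-- z∈𝔬 x∈𝔬)
        where
        y∈𝔬 : y ∈ 𝔬
        y∈𝔬 = V-resp (trans (solve 5 (λ x y z p p⁻ →
          (:- p⁻) :* x :* :0 :+ p⁻ :* y :* p :+ :1 :* z :* :0 := p :* p⁻ :* y) refl x y z A A⁻)
          (trans (*-congʳ (π^-inverse a)) (*-identityˡ y))) (p (gen∈ a 0 c 1F))
        z∈𝔬 : z ∈ 𝔬
        z∈𝔬 = V-cancelˡ (*∈𝔬 (Equivalence.to (V⇔𝔬 a c) Vc) y∈𝔬) (V-resp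
          (solve 5 (λ x y z c p⁻ → (:- p⁻) :* x :* :0 :+ p⁻ :* y :* c :+ :1 :* z :* :1 :=
            p⁻ :* c :* y :+ z) refl x y z c A⁻)
          (p (gen∈ a 0 c 2F)))
        Vy-x : V (+ a) (y - x)
        Vy-x = Equivalence.from (V⇔𝔬 a (y - x)) (V-cancelʳ z∈𝔬 (V-resp
          (solve 4 (λ x y z p⁻ → (:- p⁻) :* x :* :1 :+ p⁻ :* y :* :1 :+ :1 :* z :* :1 :=
            p⁻ :* (y :- x) :+ z) refl x y z A⁻)
          (p (gen∈ a 0 c 0F))))
        x∈𝔬 : x ∈ 𝔬
        x∈𝔬 = V-resp (solve 2 (λ x y → y :- (y :- x) := x) refl x y)
          (V-- y∈𝔬 (V-≤ (ℤ.+≤+ ℕ.z≤n) Vy-x))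

    -- Modulo `π^a`, `c ≡ 1` turns `coord₁` into `y - z`: the order is the first factor `𝔬` times
    -- the pairs `y ≡ z`, with the form `x + (z - y) / π^a`.
    V-c-1⇒Gorenstein : V (+ a) (c - 1#) → IsGorenstein (𝓞 a 0 c)
    V-c-1⇒Gorenstein Vc-1 = selfDual⇒Gorenstein isOrder {w} {w⁻} ww⁻≈1 integral dual∈
      where
      w : E.Carrier
      w = 1# , - A⁻ , A⁻
      inv : ∃ λ w⁻ → w E.* w⁻ E.≈ E.1#
      inv = inverseᴱ 1≉0 (neg-≉0 (π^≉0 (ℤ.- (+ a)))) (π^≉0 (ℤ.- (+ a)))
      w⁻ : E.Carrier
      w⁻ = proj₁ inv
      ww⁻≈1 : w E.* w⁻ E.≈ E.1#
      ww⁻≈1 = proj₂ inv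
      integral : ∀ {y} → y ∈ O → w ∙ y ∈ 𝔬
      integral {x , y , z} e∈ = let x∈ , Vy , z-x∈ = ∈O⇒ e∈ in
        V-resp (solve 5 (λ x y z c p → x :- p :* ((y :- x :- c :* (z :- x)) :+ (c :- :1)
          :* (z :- x)) := :1 :* x :+ (:- p) :* y :+ p :* z) refl x y z c A⁻)
          (V-- x∈ (Equivalence.to (V⇔𝔬 a _) (V-+ Vy (V-*ʳ Vc-1 z-x∈))))
      dual∈ : ∀ y → (∀ {x} → x ∈ O → (w E.* y) ∙ x ∈ 𝔬) → y ∈ O
      dual∈ (x , y , z) p = ∈O⇐ x∈𝔬
        (V-resp (solve 4 (λ x y z c → (c :- :1) :* (x :- z) :- (z :- y) := y :- x :- c :* (z :- x))
          refl x y z c)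
          (V-- (V-*ʳ Vc-1 (V-- x∈𝔬 z∈𝔬)) Vz-y))
        (V-- z∈𝔬 x∈𝔬)
        where
        y∈𝔬 : y ∈ 𝔬
        y∈𝔬 = V-resp (trans (solve 5 (λ x y z p p⁻ →
          :- (:1 :* x :* :0 :+ (:- p⁻) :* y :* p :+ p⁻ :* z :* :0) := p :* p⁻ :* y) refl x y z A A⁻)
          (trans (*-congʳ (π^-inverse a)) (*-identityˡ y))) (V-neg (p (gen∈ a 0 c 1F)))
        Vz-cy : V (+ a) (z - c * y)
        Vz-cy = Equivalence.from (V⇔𝔬 a (z - c * y)) (V-resp
          (solve 5 (λ x y z c p⁻ → :1 :* x :* :0 :+ (:- p⁻) :* y :* c :+ p⁻ :* z :* :1 :=
            p⁻ :* (z :- c :* y)) refl x y z c A⁻)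
          (p (gen∈ a 0 c 2F)))
        Vz-y : V (+ a) (z - y)
        Vz-y = V-resp (solve 3 (λ y z c → (z :- c :* y) :+ (c :- :1) :* y := z :- y) refl y z c)
          (V-+ Vz-cy (V-*ʳ Vc-1 y∈𝔬))
        z∈𝔬 : z ∈ 𝔬
        z∈𝔬 = V-cancelʳ (V-neg y∈𝔬) (V-≤ (ℤ.+≤+ ℕ.z≤n) Vz-y)
        x∈𝔬 : x ∈ 𝔬
        x∈𝔬 = V-cancelʳ (Equivalence.to (V⇔𝔬 a (z - y)) Vz-y) (V-resp
          (solve 4 (λ x y z p⁻ → :1 :* x :* :1 :+ (:- p⁻) :* y :* :1 :+ p⁻ :* z :* :1 :=
            x :+ p⁻ :* (z :- y)) refl x y z A⁻)
          (p (gen∈ a 0 c 0F)))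

-- Orders whose trace dual is not invertible.

module NonGorensteinOrders {κ ℓ} (F : NonArchimedeanLocalField κ ℓ)
  (π : NonArchimedeanLocalField.Carrier F)
  (ord-π : NonArchimedeanLocalField.ord F π ≡ [ + 1 ]) where
  open NonArchimedeanLocalField F hiding (zero)
  open CubicAlgebra F
  open Uniformizer π ord-π
  open Valuation F
  open Powers π ord-π
  open Lattices F
  open StandardOrders F
  open Orders π ord-π
  open Conditions F
  open Duality F π ord-π
  open Normalisation F π ord-π
  open Sum E.semiring using (sum)
  open IntegerSolver commutativeRing
  private
    module SE = IntegerSolver E-commutativeRing
    module ℤS = ℤSolver.+-*-Solver

  -- Decidability of `V` extracts the summand. It is applied to an expression of 1 as an element of
  -- `I J`, where it plays the part of locality of `O`.
  summand∉ : ∀ {k n} (v : Vector E.Carrier k) → ¬ V n (proj₁ (sum v)) → ∃ λ i → ¬ V n (proj₁ (v i))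
  summand∉ {zero}      v ¬p = contradiction V-0 ¬p
  summand∉ {suc k} {n} v ¬p = by (V? n (proj₁ (v zero)))
    where
    by : Dec (V n (proj₁ (v zero))) → ∃ λ i → ¬ V n (proj₁ (v i))
    by (no ¬q) = zero , ¬q
    by (yes q) = let i , ¬r = summand∉ (v ∘ suc) (λ r → ¬p (V-+ q r)) in suc i , ¬r

  module _ (a b : ℕ) (c : Carrier) (c∈𝔬 : c ∈ 𝔬) (isOrder : IsOrder (𝓞 a b c))
    (0<a : 0 ℕ.< a) (0<b : 0 ℕ.< b) (Vcc : V (+ suc a) (c * (c - π^ (+ b)))) where
    private
      B B⁻ : Carrier
      B = π^ (+ b)
      B⁻ = π^ (ℤ.- (+ b))
      O I : Subset
      O = 𝓞 a b c
      g f : Vector E.Carrier 3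
      g = gens a b c
      f = dualGens a b c
      G : DualBases g f
      G = gens-dualBases a b c
      module O = IsOrder isOrder
      I = Span Δ[ 𝔬 ] f

      -- If `c` were a unit then, as `b > 0`, so would be `c - π^b`, against `Vcc`.
      V1-c : V (+ 1) c
      V1-c = by (V? (+ 1) c)
        where
        V1-B : V (+ 1) B
        V1-B = V-≤ (ℤ.+≤+ 0<b) (ord⇒V (ord-π^ (+ b)))
        by : Dec (V (+ 1) c) → V (+ 1) c
        by (yes p) = p
        by (no ¬p) = contradiction (V⇒≤ (ord-*-≡ ord-c (ord-+ˡ ord-c (V-neg V1-B))) Vcc)
          λ { (ℤ.+≤+ ()) }
          where
          ord-c : ord c ≡ [ + 0 ]
          ord-c = V⇒ord c∈𝔬 ¬p

    -- Multiplication by y acts on m = (g 1F , g 2F) modulo π O as the scalar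
    -- proj₁ y: here c (c - π^b) ∈ π^(a+1) 𝔬 makes the products of elements of
    -- m vanish modulo π.
    scalar : ∀ {u y} → u ∈ Dual g → y ∈ O → ∀ i → V (+ 1)
      (u ∙ (y E.* g (suc i)) - proj₁ y * (u ∙ g (suc i)))
    scalar {u} {y@(x₀ , x₁ , x₂)} u∈ y∈ i = V-resp difference (V-resp
      (∙-congˡ {u} {comb (λ j → q i ∙ f j) g} {q i} (E.sym {q i} (DualBases.expand G (q i))))
      (V-∙-comb u (λ j → q i ∙ f j) g (coordinates i) u∈))
      where
      -- `u ∙ q i` expands over the coordinates of `q i` in `g`, with integral factors `u ∙ g j`; it
      -- is enough that all three coordinates are divisible by `π`.
      q : Fin 2 → E.Carrier
      q i = (y E.- Δ x₀) E.* g (suc i)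
      difference : u ∙ q i ≈ u ∙ (y E.* g (suc i)) - x₀ * (u ∙ g (suc i))
      difference = trans (∙-congˡ {u} {q i} (SE.solve 3 (λ y x g →
        (y SE.:- x) SE.:* g SE.:= y SE.:* g SE.:- x SE.:* g) E.refl y (Δ x₀) (g (suc i))))
        (∙-Δ-Δʳ u (y E.* g (suc i)) x₀ (g (suc i)))
      coords = ∈𝓞⇒ a b c y y∈
      s r : Carrier
      s = B⁻ * (x₂ - x₀)
      r = x₁ - x₀ - c * s
      s∈𝔬 : s ∈ 𝔬
      s∈𝔬 = Equivalence.to (V⇔𝔬 b (x₂ - x₀)) (proj₂ (proj₂ coords))
      Vr : V (+ a) r
      Vr = proj₁ (proj₂ coords)
      V1-first : ∀ {e} → proj₁ e ≈ 0# → V (+ 1) (e ∙ f 0F)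
      V1-first {e} p = V-resp (sym (trans (∙-dual₀ a b c e) p)) V-0
      V1-middle : ∀ {e} → V (+ suc a) (coord₁ a b c e) → V (+ 1) (e ∙ f 1F)
      V1-middle {e} p = V-resp (sym (∙-dual₁ a b c e))
        (≡.subst (λ k → V k (π^ (ℤ.- (+ a)) * coord₁ a b c e))
        (ℤS.solve 1 (λ a → ℤS.:- a ℤS.:+ (ℤS.con (+ 1) ℤS.:+ a) ℤS.:= ℤS.con (+ 1)) ≡.refl (+ a))
          (V-scale (ord-π^ (ℤ.- (+ a))) p))
      V1-last : ∀ {e} → V (+ suc b) (e .proj₂ .proj₂ - e .proj₁) → V (+ 1) (e ∙ f 2F)
      V1-last {e} p = V-resp (sym (∙-dual₂ a b c e)) (≡.subst (λ k →
        V k (B⁻ * (e .proj₂ .proj₂ - e .proj₁)))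
        (ℤS.solve 1 (λ a → ℤS.:- a ℤS.:+ (ℤS.con (+ 1) ℤS.:+ a) ℤS.:= ℤS.con (+ 1)) ≡.refl (+ b))
          (V-scale (ord-π^ (ℤ.- (+ b))) p))
      coordinates : ∀ i j → V (+ 1) (q i ∙ f j)
      coordinates 0F 0F = V1-first {q 0F} (zeroʳ _)
      coordinates 1F 0F = V1-first {q 1F} (zeroʳ _)
      coordinates 0F 1F = V1-middle {q 0F} (V-resp
        (solve 6 (λ x₀ x₁ x₂ p c q⁻ → (x₁ :- x₀ :- c
          :* (q⁻ :* (x₂ :- x₀)) :+ c :* (q⁻ :* (x₂ :- x₀))) :* p :=
          (x₁ :- x₀) :* p :- (x₀ :- x₀) :* :0 :- c
          :* (q⁻ :* ((x₂ :- x₀) :* :0 :- (x₀ :- x₀) :* :0)))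
          refl x₀ x₁ x₂ (π^ (+ a)) c B⁻)
        (V-* (V-+ (V-≤ (ℤ.+≤+ 0<a) Vr) (V-*ʳ V1-c s∈𝔬)) (ord⇒V (ord-π^ (+ a)))))
      coordinates 0F 2F = V1-last {q 0F} (V-resp (solve 2 (λ x₀ x₂ → :0 :=
        (x₂ :- x₀) :* :0 :- (x₀ :- x₀) :* :0) refl x₀ x₂) V-0)
      coordinates 1F 1F = V1-middle {q 1F} (V-resp identity (V-+ (V-* V1-c Vr) (V-*ʳ Vcc s∈𝔬)))
        where
        identity : c * r + c * (c - B) * s ≈ coord₁ a b c (q 1F)
        identity = solve 6 (λ x₀ x₁ x₂ c q q⁻ →
          let s = q⁻ :* (x₂ :- x₀) in
          c :* (x₁ :- x₀ :- c :* s) :+ c :* (c :- q) :* s :=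
          (x₁ :- x₀) :* c :- (x₀ :- x₀) :* :0 :- c :* (q⁻ :* ((x₂ :- x₀) :* q :- (x₀ :- x₀) :* :0)))
          refl x₀ x₁ x₂ c B B⁻
      coordinates 1F 2F = V1-last {q 1F} (V-resp (solve 3
        (λ x₀ x₂ q → q :* (x₂ :- x₀) := (x₂ :- x₀) :* q :- (x₀ :- x₀) :* :0) refl x₀ x₂ B)
        (V-≤ (ℤ.+≤+ (ℕ.+-monoˡ-≤ b 0<b)) (V-* (ord⇒V (ord-π^ (+ b))) (proj₂ (proj₂ coords)))))

    private
      Dual⇒I : Dual g ⊆ I
      Dual⇒I {e} = DualBases.dual⊆span (DualBases.flip G) {e}
      I⇒Dual : I ⊆ Dual g
      I⇒Dual {e} = DualBases.span⊆dual (DualBases.flip G) {e}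
      Dual⇒O : Dual f ⊆ O
      Dual⇒O {e} = DualBases.dual⊆span G {e}
      O⇒Dual : O ⊆ Dual f
      O⇒Dual {e} = DualBases.span⊆dual G {e}

      stable : ∀ {o} → o ∈ O → ∀ i → o E.* f i ∈ Dual g
      stable {o} o∈ i j = V-resp (∙-slide (SE.solve 3
        (λ o f g → o SE.:* g SE.:* f SE.:= o SE.:* f SE.:* g) E.refl o (f i) (g j)))
        (O⇒Dual {o E.* g j} (O.*∈ o∈ (gen∈ a b c j)) i)

      ideal : IsFractionalIdeal O I
      ideal = stable⇒ideal isOrder (DualBases.flip G) stable

      -- As 1 is the first generator of `O`, pairing `y * f j ∈ I` with it shows that the coordinate
      -- `y ∙ f j` is integral.
      multiplier⊆ : multiplierRing I ⊆ O
      multiplier⊆ {y} p = Dual⇒O {y} λ j →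
        V-resp (∙-slide (E.*-identityʳ (y E.* f j)))
          (I⇒Dual {y E.* f j} (p (f j) (gen∈span f j)) 0F)

      ⊆multiplier : O ⊆ multiplierRing I
      ⊆multiplier {o} o∈ x x∈ = IsModule.resp (span-isModule f) (E.*-comm x o)
        (IsModule.span⊆ (preimage-isModule (span-isModule f) o) {g = f}
          (λ i → IsModule.resp (span-isModule f) (E.*-comm o (f i))
            (Dual⇒I {o E.* f i} (stable o∈ i))) {x} x∈)

    -- If `I J = O`, some product `ε = u v` has `proj₁ ε` a unit. Then `ε f j = u o j` with
    -- `o j = f j v` in `O`, so modulo `π` and up to a unit the vectors `(f j ∙ g 1F , f j ∙ g 2F)`
    -- are all multiples of the single vector `(β , γ)`. For `j = 1F` and `j = 2F` they are
    -- `(1 , 0)` and `(0 , 1)`.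
    not-invertible : ¬ IsInvertible O I
    not-invertible (J , _ , IJ⊆O , O⊆IJ) = unit (O⊆IJ {E.1#} O.1∈)
      where
      product∈ : ∀ {x y} → x ∈ I → y ∈ J → x E.* y ∈ O
      product∈ {x} {y} x∈ y∈ = IJ⊆O {x E.* y} (1 , (λ _ → x) , (λ _ → y) , (λ _ → x∈) ,
        (λ _ → y∈) , E.sym {x E.* y E.+ E.0#} (E.+-identityʳ (x E.* y)))
      ¬V1-1 : ¬ V (+ 1) 1#
      ¬V1-1 p = contradiction (V⇒≤ ord-1 p) λ { (ℤ.+≤+ ()) }
      unit : ¬ (I · J) E.1#
      unit (n , u , v , u∈ , v∈ , 1≈) = found (summand∉ (λ i → u i E.* v i)
        (λ p → ¬V1-1 (V-resp (sym (proj₁ 1≈)) p)))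
        where
        found : ¬ ∃ λ i → ¬ V (+ 1) (proj₁ (u i E.* v i))
        found (i , ¬V1) = contradiction (V⇒≤ (ord-*-≡ ord-χ ord-χ) V1-χχ) λ { (ℤ.+≤+ ()) }
          where
          ε : E.Carrier
          ε = u i E.* v i
          ε∈ : ε ∈ O
          ε∈ = product∈ (u∈ i) (v∈ i)
          o : Fin 3 → E.Carrier
          o j = f j E.* v i
          o∈ : ∀ j → o j ∈ O
          o∈ j = product∈ (gen∈span f j) (v∈ i)
          χ : Carrier
          χ = proj₁ ε
          ord-χ : ord χ ≡ [ + 0 ]
          ord-χ = V⇒ord (proj₁ (𝓞⊆𝓞ᴱ a b c c∈𝔬 {ε} ε∈)) ¬V1
          -- From ε f j = u o j, paired with g (suc k).
          relation : ∀ j k → V (+ 1) (χ * (f j ∙ g (suc k)) - proj₁ (o j) * (u i ∙ g (suc k)))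
          relation j k = V-resp (trans (+-congˡ (-‿cong (+-congʳ slide)))
              (solve 3 (λ p q r → (p :- q) :- (p :- r) := r :- q) refl (u i ∙ (o j E.* g (suc k)))
                (proj₁ (o j) * (u i ∙ g (suc k))) (χ * (f j ∙ g (suc k)))))
            (V-- (scalar {u i} {o j} (I⇒Dual {u i} (u∈ i)) (o∈ j) k)
              (scalar {f j} {ε} (I⇒Dual {f j} (gen∈span f j)) ε∈ k))
            where
            slide : f j ∙ (ε E.* g (suc k)) ≈ u i ∙ (o j E.* g (suc k))
            slide = ∙-slide (SE.solve 4 (λ f u v g → f SE.:* (u SE.:* v SE.:* g) SE.:=
              u SE.:* (f SE.:* v SE.:* g)) E.refl (f j) (u i) (v i) (g (suc k)))
          β γ x₁ x₂ : Carrier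
          β = u i ∙ g 1F
          γ = u i ∙ g 2F
          x₁ = proj₁ (o 1F)
          x₂ = proj₁ (o 2F)
          evaluate : ∀ j k {y} → V (+ 1) (χ * (f j ∙ g (suc k)) - y) →
            V (+ 1) (χ * kronecker (suc k) j - y)
          evaluate j k = V-resp (+-congʳ (*-congˡ (trans (∙-comm (f j) (g (suc k)))
            (gens∙dual a b c (suc k) j))))
          R₁₁ : V (+ 1) (χ * 1# - x₁ * β)
          R₁₁ = evaluate 1F 0F (relation 1F 0F)
          R₁₂ : V (+ 1) (χ * 0# - x₁ * γ)
          R₁₂ = evaluate 1F 1F (relation 1F 1F)
          R₂₂ : V (+ 1) (χ * 1# - x₂ * γ)
          R₂₂ = evaluate 2F 1F (relation 2F 1F)
          χ∈𝔬 : χ ∈ 𝔬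
          χ∈𝔬 = ord⇒V ord-χ
          x₁∈𝔬 : x₁ ∈ 𝔬
          x₁∈𝔬 = proj₁ (𝓞⊆𝓞ᴱ a b c c∈𝔬 {o 1F} (o∈ 1F))
          x₂∈𝔬 : x₂ ∈ 𝔬
          x₂∈𝔬 = proj₁ (𝓞⊆𝓞ᴱ a b c c∈𝔬 {o 2F} (o∈ 2F))
          β∈𝔬 : β ∈ 𝔬
          β∈𝔬 = I⇒Dual {u i} (u∈ i) 1F
          γ∈𝔬 : γ ∈ 𝔬
          γ∈𝔬 = I⇒Dual {u i} (u∈ i) 2F
          -- Modulo `π`: `χ = x₁ β`, `0 = x₁ γ` and `χ = x₂ γ`, whence `χ² = x₂ γ x₁ β = 0`.
          V1-χχ : V (+ 1) (χ * χ)
          V1-χχ = V-resp (solve 5 (λ χ x₁ x₂ β γ →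
              χ :* (χ :* :1 :- x₂ :* γ) :+ (x₂ :* γ) :* (χ :* :1 :- x₁ :* β) :- (x₂ :* β)
                :* (χ :* :0 :- x₁ :* γ) := χ :* χ)
              refl χ x₁ x₂ β γ)
            (V-- (V-+ (V-*ˡ χ∈𝔬 R₂₂) (V-*ˡ (*∈𝔬 x₂∈𝔬 γ∈𝔬) R₁₁)) (V-*ˡ (*∈𝔬 x₂∈𝔬 β∈𝔬) R₁₂))

    not-Gorenstein : ¬ IsGorenstein O
    not-Gorenstein gorenstein = not-invertible (gorenstein I ideal (multiplier⊆ , ⊆multiplier))

-- Arithmetic of the Gorenstein condition.

module GorensteinCriterion {κ ℓ} (F : NonArchimedeanLocalField κ ℓ)
  (π : NonArchimedeanLocalField.Carrier F)
  (ord-π : NonArchimedeanLocalField.ord F π ≡ [ + 1 ]) where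
  open NonArchimedeanLocalField F hiding (zero)
  open CubicAlgebra F
  open Uniformizer π ord-π
  open Valuation F
  open Powers π ord-π
  open StandardOrders F
  open Orders π ord-π
  open Conditions F
  open GorensteinOrders F π ord-π
  open NonGorensteinOrders F π ord-π
  open IntegerSolver commutativeRing
  private module ℤS = ℤSolver.+-*-Solver

  module _ (a b : ℕ) (c : Carrier) (c∈𝔬 : c ∈ 𝔬) where
    private
      B : Carrier
      B = π^ (+ b)
      tri : Ultrametric c B (+ b)
      tri = ultrametric c∈𝔬 (ord-π^ (+ b))
      <⇒¬V : ∀ {x n} → ord x <⁺ [ n ] → ¬ V n x
      <⇒¬V {x} = go (ord x)
        where
        go : ∀ u {n} → u <⁺ [ n ] → ¬ [ n ] ≤⁺ u
        go [ m ] <⁺.[ p ] ≤⁺.[ q ] = ℤ.<⇒≱ p q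
      ¬V⇒< : ∀ {x n} → ¬ V n x → ord x <⁺ [ n ]
      ¬V⇒< ¬p = let m , eq , m<n = ¬V⇒ord ¬p in ≡.subst (_<⁺ [ _ ]) (≡.sym eq) <⁺.[ m<n ]
      sum-≤ : ∀ {m n k : ℕ} → m ℕ.+ n ≡ k → k ℕ.≤ m → n ≡ 0
      sum-≤ {m} {n} ≡.refl p = ℕ.n≤0⇒n≡0 (ℕ.+-cancelˡ-≤ m n 0
        (≡.subst (m ℕ.+ n ℕ.≤_) (≡.sym (ℕ.+-identityʳ m)) p))
      suc-V : V (+ suc b) (c - B) → ord (c - B) ≢ [ + b ]
      suc-V p eq = ℕ.<-irrefl ≡.refl (ℤ.drop‿+≤+ (V⇒≤ eq p))
      Large : Set (κ ⊔ ℓ)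
      Large = c - B ∈ ⟨π^ + suc b ⟩
      Large⇔V : Large ⇔ V (+ suc b) (c - B)
      Large⇔V = ⟨π^⟩⇔V (+ suc b)

    -- The last alternative makes the Gram determinant of the coordinate form a unit. In the first
    -- two, an order splits off a factor `𝔬`.
    Unimodular : Set
    Unimodular = a ≡ 0 ⊎ b ≡ 0 ⊎ ord (c * (c - B)) ≡ [ + a ]

    private
      quotient-ord : ∀ {x y m n} → ord (x * y) ≡ [ m ] → ord x ≡ [ n ] → ord y ≡ [ m ℤ.- n ]
      quotient-ord {x} {y} {m} {n} p q = let x⁻ , xx⁻≈1 , q⁻ = inverse-ord q in
        ≡.trans (ord-cong (trans (sym (*-identityˡ y))
          (trans (*-congʳ (trans (sym xx⁻≈1) (*-comm x x⁻))) (*-assoc x⁻ x y))))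
          (≡.trans (ord-*-≡ q⁻ p) (≡.cong [_] (ℤ.+-comm (ℤ.- n) m)))

      +-b : ∀ {m} → m ≡ + a ℤ.- + b → + b ℤ.+ m ≡ + a
      +-b ≡.refl = ℤS.solve 2 (λ a b → b ℤS.:+ (a ℤS.:- b) ℤS.:= a) ≡.refl (+ a) (+ b)

      ord<⇒a≢0 : ord c <⁺ [ + a ] → a ≢ 0
      ord<⇒a≢0 p ≡.refl = contradiction c∈𝔬 (<⇒¬V p)

    module _ (V-ring : V (+ a) (c * (c - B))) where
      private
        -- For `b = 0`, `¬ Large` makes `c - 1` a unit, so the ring condition puts `c` into `(π^a)`,
        -- against `ord c < a`.
        b≡0⇒ : ord c <⁺ [ + a ] → ¬ Large → b ≢ 0
        b≡0⇒ c<a small ≡.refl = by tri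
          where
          by : ¬ Ultrametric c B (+ 0)
          by (below k _ (ℤ.+<+ ()) _)
          by (above _ ord-c-B) = <⇒¬V c<a (V-unscale ord-c-B
            (≡.subst (λ k → V k ((c - B) * c)) (≡.sym (ℤ.+-identityˡ (+ a)))
            (V-resp (*-comm c (c - B)) V-ring)))
          by (equal ord-c V0) = <⇒¬V c<a (V-≤ (V⇒≤
            (ord-*-≡ ord-c (V⇒ord V0 (small ∘ Equivalence.from Large⇔V))) V-ring) (ord⇒V ord-c))

      -- The three clauses solve `ord c + ord (c - π^b) = a`. If `ord c ≥ a` then
      -- `ord (c - π^b) = 0`, whence `a = 0` or `b = 0`. `Large` forces `ord c = b`, hence
      -- `ord (c - π^b) = a - b`. Otherwise either both summands are equal and at most `b`, or
      -- `ord c > b` and the second is `b`.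
      unimodular⇒condition : Unimodular → GorensteinCondition a b c
      unimodular⇒condition uni = first uni , second uni , third uni
        where
        first : Unimodular → [ + a ] ≤⁺ ord c → a ≡ 0 ⊎ b ≡ 0
        first (inj₁ p) _ = inj₁ p
        first (inj₂ (inj₁ p)) _ = inj₂ p
        first (inj₂ (inj₂ eq)) Vc = by tri
          where
          by : Ultrametric c B (+ b) → a ≡ 0 ⊎ b ≡ 0
          by (below k ord-c _ ord-c-B) =
            let k+k≡a = ℤ.+-injective ([]-injective (≡.trans (≡.sym (ord-*-≡ ord-c ord-c-B)) eq))
                k≡0 = sum-≤ k+k≡a (ℤ.drop‿+≤+ (V⇒≤ ord-c Vc))
            in inj₁ (≡.trans (≡.sym k+k≡a) (≡.cong₂ ℕ._+_ k≡0 k≡0))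
          by (above _ ord-c-B) = inj₂ (ℕ.n≤0⇒n≡0 (ℕ.+-cancelˡ-≤ a b 0
            (≡.subst (a ℕ.+ b ℕ.≤_) (≡.sym (ℕ.+-identityʳ a))
            (ℤ.drop‿+≤+ (V⇒≤ eq (V-* Vc (ord⇒V ord-c-B)))))))
          by (equal ord-c Vb) = inj₂ (ℕ.n≤0⇒n≡0 (ℕ.+-cancelˡ-≤ b b 0
            (≡.subst (b ℕ.+ b ℕ.≤_) (≡.sym (ℕ.+-identityʳ b))
            (ℕ.≤-trans (ℤ.drop‿+≤+ (V⇒≤ eq (V-* (ord⇒V ord-c) Vb))) (ℤ.drop‿+≤+ (V⇒≤ ord-c Vc))))))

        second : Unimodular → ord c <⁺ [ + a ] → Large →
          (ord (c - B) ≡ [ + a ℤ.- + b ] × + a ℤ.- + b ℤ.> + 0) ⊎ b ≡ 0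
        second (inj₁ p) c<a _ = contradiction p (ord<⇒a≢0 c<a)
        second (inj₂ (inj₁ p)) _ _ = inj₂ p
        second (inj₂ (inj₂ eq)) c<a large = by tri
          where
          V-c-B = Equivalence.to Large⇔V large
          by : Ultrametric c B (+ b) → (ord (c - B) ≡ [ + a ℤ.- + b ] × + a ℤ.- + b ℤ.> + 0) ⊎ b ≡ 0
          by (below k _ k<b ord-c-B) = contradiction (V⇒≤ ord-c-B V-c-B)
            (ℤ.<⇒≱ (ℤ.<-trans k<b (ℤ.+<+ (ℕ.n<1+n b))))
          by (above _ ord-c-B) = contradiction ord-c-B (suc-V V-c-B)
          by (equal ord-c _) = inj₁ (quotient-ord eq ord-c ,
            <-from (ℤ.≰⇒> (λ a≤b → <⇒¬V c<a (V-≤ a≤b (ord⇒V ord-c))))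
            (ℤS.solve 2 (λ a b → a ℤS.:- b ℤS.:- ℤS.con (+ 0) ℤS.:= a ℤS.:- b) ≡.refl (+ a) (+ b)))

        third : Unimodular → ord c <⁺ [ + a ] → ¬ Large →
          (ord c +⁺ ord c ≡ [ + a ] × a ℕ.≤ 2 ℕ.* b) ⊎
            (ord c ≡ [ + a ℤ.- + b ] × + a ℤ.- + b ℤ.> + b)
        third (inj₁ p) c<a _ = contradiction p (ord<⇒a≢0 c<a)
        third (inj₂ (inj₁ p)) c<a small = contradiction p (b≡0⇒ c<a small)
        third (inj₂ (inj₂ eq)) c<a small = by tri
          where
          twice : ∀ {k} → ord c ≡ [ + k ] → ord (c - B) ≡ [ + k ] → k ℕ.≤ b →
            ord c +⁺ ord c ≡ [ + a ] × a ℕ.≤ 2 ℕ.* b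
          twice {k} ord-c ord-c-B k≤b =
            ≡.trans (≡.cong₂ _+⁺_ ord-c ord-c) (≡.cong [_] k+k≡a) ,
            ≡.subst₂ ℕ._≤_ (ℤ.+-injective k+k≡a) (≡.sym (2*n≡n+n b)) (ℕ.+-mono-≤ k≤b k≤b)
            where
            k+k≡a : + k ℤ.+ + k ≡ + a
            k+k≡a = []-injective (≡.trans (≡.sym (ord-*-≡ ord-c ord-c-B)) eq)
          by : Ultrametric c B (+ b) → (ord c +⁺ ord c ≡ [ + a ] × a ℕ.≤ 2 ℕ.* b) ⊎
            (ord c ≡ [ + a ℤ.- + b ] × + a ℤ.- + b ℤ.> + b)
          by (below k ord-c k<b ord-c-B) = inj₁ (twice ord-c ord-c-B (ℕ.<⇒≤ (ℤ.drop‿+<+ k<b)))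
          by (above Vc ord-c-B) = inj₂ (ord-c , ℤ.suc[i]≤j⇒i<j (V⇒≤ ord-c Vc))
            where
            ord-c : ord c ≡ [ + a ℤ.- + b ]
            ord-c = quotient-ord (≡.trans (ord-cong (*-comm (c - B) c)) eq) ord-c-B
          by (equal ord-c Vb) = inj₁ (twice ord-c (V⇒ord Vb (small ∘ Equivalence.from Large⇔V))
            ℕ.≤-refl)

    condition⇒unimodular : GorensteinCondition a b c → Unimodular
    condition⇒unimodular (first , second , third) = split (V? (+ a) c)
      where
      large : (ord (c - B) ≡ [ + a ℤ.- + b ] × + a ℤ.- + b ℤ.> + 0) ⊎ b ≡ 0 → V (+ suc b) (c - B) →
        Unimodular
      large (inj₂ b≡0) _ = inj₂ (inj₁ b≡0)
      large (inj₁ (ord-c-B , _)) V-c-B = by tri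
        where
        by : Ultrametric c B (+ b) → Unimodular
        by (below k _ k<b ord-c-B′) = contradiction (V⇒≤ ord-c-B′ V-c-B)
          (ℤ.<⇒≱ (ℤ.<-trans k<b (ℤ.+<+ (ℕ.n<1+n b))))
        by (above _ ord-c-B′) = contradiction ord-c-B′ (suc-V V-c-B)
        by (equal ord-c _) = inj₂ (inj₂ (≡.trans (ord-*-≡ ord-c ord-c-B) (≡.cong [_] (+-b ≡.refl))))
      small : (ord c +⁺ ord c ≡ [ + a ] × a ℕ.≤ 2 ℕ.* b) ⊎
        (ord c ≡ [ + a ℤ.- + b ] × + a ℤ.- + b ℤ.> + b) →
        ¬ V (+ suc b) (c - B) → Unimodular
      small (inj₁ (eq , a≤2b)) ¬V = by tri
        where
        ord-cc : ord (c * c) ≡ [ + a ]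
        ord-cc = ≡.trans (ord-* c c) eq
        by : Ultrametric c B (+ b) → Unimodular
        by (below k ord-c _ ord-c-B) = inj₂ (inj₂ (≡.trans (ord-*-≡ ord-c ord-c-B)
          (≡.trans (≡.sym (ord-*-≡ ord-c ord-c)) ord-cc)))
        -- `ord c > b` would give `a = 2 ord c ≥ 2b + 2`, against `a ≤ 2b`.
        by (above Vc _) = contradiction (ℕ.≤-trans (ℤ.drop‿+≤+ (V⇒≤ ord-cc (V-* Vc Vc)))
          (≡.subst (a ℕ.≤_) (2*n≡n+n b) a≤2b))
          (ℕ.<⇒≱ (ℕ.+-mono-< (ℕ.n<1+n b) (ℕ.n<1+n b)))
        by (equal ord-c Vb) = inj₂ (inj₂ (≡.trans (ord-*-≡ ord-c (V⇒ord Vb ¬V))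
          (≡.trans (≡.sym (ord-*-≡ ord-c ord-c)) ord-cc)))
      small (inj₂ (ord-c , b<a-b)) ¬V = by tri
        where
        by : Ultrametric c B (+ b) → Unimodular
        by (below k ord-c′ k<b _) = contradiction (≡.subst (ℤ._< + b)
          ([]-injective (≡.trans (≡.sym ord-c′) ord-c)) k<b) (ℤ.<-asym b<a-b)
        by (above _ ord-c-B) = inj₂ (inj₂ (≡.trans (ord-*-≡ ord-c ord-c-B)
          (≡.cong [_] (≡.trans (ℤ.+-comm (+ a ℤ.- + b) (+ b)) (+-b ≡.refl)))))
        by (equal ord-c′ _) = contradiction b<a-b (ℤ.<-irrefl
          ([]-injective (≡.trans (≡.sym ord-c′) ord-c)))
      split : Dec (V (+ a) c) → Unimodular
      split (yes p) = cast (first p)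
        where
        cast : a ≡ 0 ⊎ b ≡ 0 → Unimodular
        cast (inj₁ q) = inj₁ q
        cast (inj₂ q) = inj₂ (inj₁ q)
      split (no ¬p) = cases (V? (+ suc b) (c - B))
        where
        cases : Dec (V (+ suc b) (c - B)) → Unimodular
        cases (yes q) = large (second (¬V⇒< ¬p) (Equivalence.from Large⇔V q)) q
        cases (no ¬q) = small (third (¬V⇒< ¬p) (¬q ∘ Equivalence.to Large⇔V)) ¬q

  module _ (a b : ℕ) (c : Carrier) (c∈𝔬 : c ∈ 𝔬) (isOrder : IsOrder (𝓞 a b c)) where

    unimodular⇒Gorenstein : Unimodular a b c c∈𝔬 → IsGorenstein (𝓞 a b c)
    unimodular⇒Gorenstein (inj₁ ≡.refl) = a≡0⇒Gorenstein b c c∈𝔬 isOrder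
    -- With `b = 0` one of `c` and `c - 1` is a unit, so the ring condition puts the other into
    -- `(π^a)`.
    unimodular⇒Gorenstein (inj₂ (inj₁ ≡.refl)) = by (ultrametric c∈𝔬 ord-1)
      where
      V-ring : V (+ a) (c * (c - 1#))
      V-ring = ring⇒ a 0 c isOrder
      V-factor : ∀ {x y} → c * (c - 1#) ≈ x * y → ord x ≡ [ + 0 ] → V (+ a) y
      V-factor {x} {y} eq ord-x = V-unscale ord-x (≡.subst (λ k → V k (x * y))
        (≡.sym (ℤ.+-identityˡ (+ a))) (V-resp eq V-ring))
      by : Ultrametric c 1# (+ 0) → IsGorenstein (𝓞 a 0 c)
      by (below k _ (ℤ.+<+ ()) _)
      by (above _ ord-c-1) = V-c⇒Gorenstein a c c∈𝔬 isOrder (V-factor (*-comm c (c - 1#)) ord-c-1)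
      by (equal ord-c _) = V-c-1⇒Gorenstein a c c∈𝔬 isOrder (V-factor refl ord-c)
    unimodular⇒Gorenstein (inj₂ (inj₂ eq)) = unitDiscriminant⇒Gorenstein a b c c∈𝔬 isOrder eq

    Gorenstein⇒unimodular : IsGorenstein (𝓞 a b c) → Unimodular a b c c∈𝔬
    Gorenstein⇒unimodular gorenstein = byA (a ℕ.≟ 0) (b ℕ.≟ 0) (V? (+ suc a) (c * (c - π^ (+ b))))
      where
      byA : Dec (a ≡ 0) → Dec (b ≡ 0) → Dec (V (+ suc a) (c * (c - π^ (+ b)))) →
        Unimodular a b c c∈𝔬
      byA (yes p) _ _ = inj₁ p
      byA (no _) (yes p) _ = inj₂ (inj₁ p)
      byA (no _) (no _) (no ¬p) = inj₂ (inj₂ (V⇒ord (ring⇒ a b c isOrder) ¬p))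
      byA (no a≢0) (no b≢0) (yes p) = contradiction gorenstein
        (not-Gorenstein a b c c∈𝔬 isOrder (ℕ.n≢0⇒n>0 a≢0) (ℕ.n≢0⇒n>0 b≢0) p)

proposition5p7 :
  ∀ {κ ℓ} (F : NonArchimedeanLocalField κ ℓ) →
  let open NonArchimedeanLocalField F
      open CubicAlgebra F
  in
  (π : Carrier) (ord-π : ord π ≡ [ + 1 ]) →
  let open Uniformizer π ord-π
  in
  -- (1)
  ( (∀ O → IsOrder O →
      ∃ λ a → ∃ λ b → ∃ λ c → c ∈ 𝔬 × OrderCondition a b c × O ≐ 𝓞 a b c)
  × (∀ a b c → c ∈ 𝔬 → OrderCondition a b c → IsOrder (𝓞 a b c)) )
  ×
  -- (2)
  (∀ a′ b′ c′ a b c → c′ ∈ 𝔬 → c ∈ 𝔬 →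
    IsOrder (𝓞 a′ b′ c′) → OrderCondition a′ b′ c′ → IsOrder (𝓞 a b c) →
    let δ = + b ℤ.- + b′ in
    (𝓞 a b c ⊆ 𝓞 a′ b′ c′ ⇔ ContainmentCondition a′ b′ c′ a b c)
    × (𝓞 a b c ⊆ 𝓞 a′ b′ c′ → ord c <⁺ [ + a′ ] →
        (a′ ℕ.≤ 2 ℕ.* b′ →
          [ + ⌈ a′ /2⌉ ] ≤⁺ ord c -⁺ δ × ord c -⁺ δ ≡ ord c′)
        × (a′ ℕ.> 2 ℕ.* b′ → a′ ℕ.> b)))
  ×
  -- (3)
  (∀ a′ b′ c′ a b c → c′ ∈ 𝔬 → c ∈ 𝔬 →
    IsOrder (𝓞 a′ b′ c′) → IsOrder (𝓞 a b c) →
    (𝓞 a′ b′ c′ ≐ 𝓞 a b c) ⇔ (a ≡ a′ × b ≡ b′ × c - c′ ∈ ⟨π^ + a ⟩))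
  ×
  -- (4)
  (∀ a b c → c ∈ 𝔬 → (isOrder : IsOrder (𝓞 a b c)) →
    let f₁ = max[ + b , + (a ℕ.+ b) - ord (c - π^ (+ b)) ]
        f₂ = + a
        f₃ = max[ + b , + (a ℕ.+ b) - ord c ]
    in
    S[ isOrder ]≡ (a ℕ.+ b)
    × conductor (𝓞 a b c) ≐ (⟨π^ f₁ ⟩ ⟨×⟩ ⟨π^ f₂ ⟩ ⟨×⟩ ⟨π^ f₃ ⟩)
    × ([ + a ] ≤⁺ ord c → f₁ ≡ + (a ℕ.⊔ b) × f₃ ≡ + b)
    × (∀ n → ord c ≡ [ n ] → n ℤ.< + a →
        f₁ ≡ max[ + b , + (a ℕ.+ b) - ord (c - π^ (+ b)) ]
        × f₃ ≡ + (a ℕ.+ b) ℤ.- n))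
  ×
  -- (5)
  (∀ a b c → c ∈ 𝔬 → IsOrder (𝓞 a b c) →
    IsGorenstein (𝓞 a b c) ⇔ GorensteinCondition a b c)
proposition5p7 F π ord-π =
  (( λ O → normalise {O}) , λ a b c c∈𝔬 cond → ⇒ring a b c c∈𝔬 (condition⇒ring π ord-π a b c∈𝔬 cond)) ,
  (λ a′ b′ c′ a b c _ _ _ cond _ →
    mk⇔ (⊆⇒condition a′ b′ c′ a b c) (condition⇒⊆ a′ b′ c′ a b c) , ⊆⇒halfBound a′ b′ c′ a b c cond) ,
  (λ a′ b′ c′ a b c _ _ _ _ → mk⇔ (equal⇒ a′ b′ c′ a b c) (equal⇐ a′ b′ c′ a b c)) ,
  (λ a b c c∈𝔬 isOrder →
    (length≥ a b c∈𝔬 isOrder , length≤ a b c∈𝔬 isOrder) ,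
    (conductor⊆ a b c , ⊆conductor a b c) ,
    conductorExponents≥ a b c ,
    λ n eq n<a → ≡.refl , conductorExponents< a b c n eq n<a) ,
  (λ a b c c∈𝔬 isOrder → mk⇔
    (unimodular⇒condition a b c c∈𝔬 (ring⇒ a b c isOrder) ∘ Gorenstein⇒unimodular a b c c∈𝔬 isOrder)
    (unimodular⇒Gorenstein a b c c∈𝔬 isOrder ∘ condition⇒unimodular a b c c∈𝔬))
  where
  open CubicAlgebra F
  open StandardOrders F
  open Orders π ord-π
  open Conditions F
  open Normalisation F π ord-π
  open Containment F π ord-π
  open ConductorAndLength F π ord-π
  open GorensteinCriterion F π ord-π
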